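{- Let $v,m$ be integers with $1\le m\le v/2$, let $A$ be the adjacency matrix of the Johnson graph $J(v,m)$, and let $r\in\mathbb N^+$. PST under $A^r$ between distinct vertices occurs if and only if one of the following holds. (i) $J(v,m)=J(2,1)=K_2$ and the exponent $r$ is odd; in this case the minimum positive transfer time is $\pi/2$. (ii) $J(v,m)=J(6,3)$, the exponent $r$ is even, and the two vertices are complementary $3$-subsets; in this case the minimum positive transfer time is \[ \frac{\pi}{3^r-1}. \]
   Context: $\mathbb N^+=\{1,2,3,\ldots\}$. The vertices of $J(v,m)$ are the $m$-subsets of a fixed $v$-element set; two vertices are adjacent when their intersection has size $m-1$. A real symmetric matrix $K$ indexed by a finite vertex set has perfect state transfer (PST) from vertex $a$ to vertex $b$ at time $\tau>0$ (a transfer time) if $\exp(-\mathrm i\tau K)e_a=\gamma e_b$ for some $\gamma\in\mathbb C$ with $|\gamma|=1$, where $e_x$ is the standard basis vector indexed by $x$; PST under $K$ between $a$ and $b$ occurs if this holds for some $\tau>0$. -}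

module Defs where

open import Algebra.Bundles.Raw using (RawSemiring)
import Algebra.Definitions.RawSemiring as RawSemiringDefs
open import Data.Bool.Base using (if_then_else_)
import Data.Bool.Properties as Bool
open import Data.Fin.Subset using (Subset; inside; outside; ∣_∣; _∩_; ∁)
import Data.Integer.Base as ℤ
open import Data.List.Base using (List; []; _∷_; _++_; map; foldr)
open import Data.List.Membership.Propositional using (_∈_)
open import Data.List.Membership.Propositional.Properties
  using (∈-map⁺; ∈-map⁻; ∈-++⁺ˡ; ∈-++⁺ʳ)
open import Data.List.Relation.Binary.Disjoint.Propositional using (Disjoint)
open import Data.List.Relation.Unary.All using ([])
open import Data.List.Relation.Unary.Any using (here)
open import Data.List.Relation.Unary.Unique.Propositional using (Unique; []; _∷_)
open import Data.List.Relation.Unary.Unique.Propositional.Properties using (map⁺; ++⁺)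
open import Data.Nat.Base as ℕ using (ℕ; zero; suc; _!)
import Data.Nat.Properties as ℕ
open import Data.Nat.Divisibility using (_∣_)
open import Data.Product.Base using (Σ; Σ-syntax; ∃-syntax; _×_; _,_; proj₁; proj₂)
open import Data.Rational.Base as ℚ using (ℚ; 0ℚ; 1ℚ; ½)
import Data.Rational.Properties as ℚ
open import Data.Rational.Solver using (module +-*-Solver)
open import Data.Vec.Base using ([]; _∷_)
open import Data.Vec.Properties using (≡-dec; ∷-injectiveʳ)
open import Level using (0ℓ)
open import Relation.Binary.Definitions using (DecidableEquality)
open import Relation.Binary.PropositionalEquality
  using (_≡_; refl; sym; trans; cong; cong₂; subst; module ≡-Reasoning)
open import Relation.Nullary using (¬_; Dec; does; map′)

------------------------------------------------------------------------
-- Real numbers: Cauchy sequences of rationals, with equality _≃_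

IsCauchy : (ℕ → ℚ) → Set
IsCauchy f = ∀ ε → 0ℚ ℚ.< ε →
  ∃[ N ] (∀ m n → N ℕ.≤ m → N ℕ.≤ n → ℚ.∣ f m ℚ.- f n ∣ ℚ.< ε)

record ℝ : Set where
  constructor mkℝ
  field
    seq    : ℕ → ℚ
    cauchy : IsCauchy seq

open ℝ public

abstract

  ½*p : ∀ p → ½ ℚ.* p ℚ.+ ½ ℚ.* p ≡ p
  ½*p p = trans (sym (ℚ.*-distribʳ-+ p ½ ½)) (ℚ.*-identityˡ p)

  0<p*q : ∀ {p q} → 0ℚ ℚ.< p → 0ℚ ℚ.< q → 0ℚ ℚ.< p ℚ.* q
  0<p*q {p} {q} 0<p 0<q = ℚ.positive⁻¹ (p ℚ.* q)
    {{ℚ.pos*pos⇒pos p {{ℚ.positive 0<p}} q {{ℚ.positive 0<q}}}}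

  0<½p : ∀ {p} → 0ℚ ℚ.< p → 0ℚ ℚ.< ½ ℚ.* p
  0<½p = 0<p*q (ℚ.positive⁻¹ ½)

  bounded : ∀ {f} → IsCauchy f →
    ∃[ B ] 0ℚ ℚ.< B × ∃[ N ] (∀ n → N ℕ.≤ n → ℚ.∣ f n ∣ ℚ.≤ B)
  bounded {f} cf with cf 1ℚ (ℚ.positive⁻¹ 1ℚ)
  ... | N , close = 1ℚ ℚ.+ ℚ.∣ f N ∣
                  , ℚ.<-≤-trans (ℚ.positive⁻¹ 1ℚ) 1≤B
                  , N , bound
    where
    open ℚ.≤-Reasoning
    1≤B : 1ℚ ℚ.≤ 1ℚ ℚ.+ ℚ.∣ f N ∣
    1≤B = begin
      1ℚ                ≡⟨ ℚ.+-identityʳ 1ℚ ⟨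
      1ℚ ℚ.+ 0ℚ         ≤⟨ ℚ.+-monoʳ-≤ 1ℚ (ℚ.0≤∣p∣ (f N)) ⟩
      1ℚ ℚ.+ ℚ.∣ f N ∣  ∎
    split : ∀ p q → p ≡ (p ℚ.- q) ℚ.+ q
    split = solve 2 (λ p q → p := (p :- q) :+ q) refl
      where open +-*-Solver
    bound : ∀ n → N ℕ.≤ n → ℚ.∣ f n ∣ ℚ.≤ 1ℚ ℚ.+ ℚ.∣ f N ∣
    bound n N≤n = begin
      ℚ.∣ f n ∣                          ≡⟨ cong ℚ.∣_∣ (split (f n) (f N)) ⟩
      ℚ.∣ (f n ℚ.- f N) ℚ.+ f N ∣        ≤⟨ ℚ.∣p+q∣≤∣p∣+∣q∣ (f n ℚ.- f N) (f N) ⟩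
      ℚ.∣ f n ℚ.- f N ∣ ℚ.+ ℚ.∣ f N ∣    ≤⟨ ℚ.+-monoˡ-≤ ℚ.∣ f N ∣ (ℚ.<⇒≤ (close n N N≤n ℕ.≤-refl)) ⟩
      1ℚ ℚ.+ ℚ.∣ f N ∣                   ∎

  -- δ with B δ = ε
  shrink : ∀ B ε → 0ℚ ℚ.< B → 0ℚ ℚ.< ε → ∃[ δ ] 0ℚ ℚ.< δ × B ℚ.* δ ≡ ε
  shrink B ε 0<B 0<ε = B⁻¹ ℚ.* ε , 0<p*q 0<B⁻¹ 0<ε , eq
    where
    instance
      B-pos : ℚ.Positive B
      B-pos = ℚ.positive 0<B
      B-nz : ℚ.NonZero B
      B-nz = ℚ.pos⇒nonZero B
    B⁻¹ : ℚ
    B⁻¹ = ℚ.1/ B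
    0<B⁻¹ : 0ℚ ℚ.< B⁻¹
    0<B⁻¹ = ℚ.positive⁻¹ B⁻¹ {{ℚ.1/pos⇒pos B}}
    open ≡-Reasoning
    eq : B ℚ.* (B⁻¹ ℚ.* ε) ≡ ε
    eq = begin
      B ℚ.* (B⁻¹ ℚ.* ε)  ≡⟨ ℚ.*-assoc B B⁻¹ ε ⟨
      (B ℚ.* B⁻¹) ℚ.* ε  ≡⟨ cong (ℚ._* ε) (ℚ.*-inverseʳ B) ⟩
      1ℚ ℚ.* ε           ≡⟨ ℚ.*-identityˡ ε ⟩
      ε                  ∎

  ∣p*q∣<B*δ : ∀ {p q B δ} → 0ℚ ℚ.< B → ℚ.∣ p ∣ ℚ.≤ B → ℚ.∣ q ∣ ℚ.< δ →
              ℚ.∣ p ℚ.* q ∣ ℚ.< B ℚ.* δ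
  ∣p*q∣<B*δ {p} {q} {B} {δ} 0<B ∣p∣≤B ∣q∣<δ = begin-strict
    ℚ.∣ p ℚ.* q ∣         ≡⟨ ℚ.∣p*q∣≡∣p∣*∣q∣ p q ⟩
    ℚ.∣ p ∣ ℚ.* ℚ.∣ q ∣   ≤⟨ ℚ.*-monoʳ-≤-nonNeg ℚ.∣ q ∣ {{ℚ.∣-∣-nonNeg q}} ∣p∣≤B ⟩
    B ℚ.* ℚ.∣ q ∣         <⟨ ℚ.*-monoʳ-<-pos B {{ℚ.positive 0<B}} ∣q∣<δ ⟩
    B ℚ.* δ               ∎
    where open ℚ.≤-Reasoning

  const-cauchy : ∀ p → IsCauchy (λ _ → p)
  const-cauchy p ε 0<ε =
    0 , λ _ _ _ _ → subst (λ q → ℚ.∣ q ∣ ℚ.< ε) (sym (ℚ.+-inverseʳ p)) 0<ε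

  +-cauchy : ∀ f g → IsCauchy f → IsCauchy g → IsCauchy (λ n → f n ℚ.+ g n)
  +-cauchy f g cf cg ε 0<ε with cf (½ ℚ.* ε) (0<½p 0<ε) | cg (½ ℚ.* ε) (0<½p 0<ε)
  ... | N₁ , close₁ | N₂ , close₂ = N₁ ℕ.⊔ N₂ , λ m n N≤m N≤n → begin-strict
      ℚ.∣ (f m ℚ.+ g m) ℚ.- (f n ℚ.+ g n) ∣
        ≡⟨ cong ℚ.∣_∣ (rearrange (f m) (g m) (f n) (g n)) ⟩
      ℚ.∣ (f m ℚ.- f n) ℚ.+ (g m ℚ.- g n) ∣
        ≤⟨ ℚ.∣p+q∣≤∣p∣+∣q∣ (f m ℚ.- f n) (g m ℚ.- g n) ⟩
      ℚ.∣ f m ℚ.- f n ∣ ℚ.+ ℚ.∣ g m ℚ.- g n ∣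
        <⟨ ℚ.+-mono-< (close₁ m n (ℕ.m⊔n≤o⇒m≤o N₁ N₂ N≤m) (ℕ.m⊔n≤o⇒m≤o N₁ N₂ N≤n))
                      (close₂ m n (ℕ.m⊔n≤o⇒n≤o N₁ N₂ N≤m) (ℕ.m⊔n≤o⇒n≤o N₁ N₂ N≤n)) ⟩
      ½ ℚ.* ε ℚ.+ ½ ℚ.* ε
        ≡⟨ ½*p ε ⟩
      ε ∎
    where
    open ℚ.≤-Reasoning
    rearrange : ∀ a b c d → (a ℚ.+ b) ℚ.- (c ℚ.+ d) ≡ (a ℚ.- c) ℚ.+ (b ℚ.- d)
    rearrange = solve 4 (λ a b c d → (a :+ b) :- (c :+ d) := (a :- c) :+ (b :- d)) refl
      where open +-*-Solver

  neg-cauchy : ∀ f → IsCauchy f → IsCauchy (λ n → ℚ.- f n)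
  neg-cauchy f cf ε 0<ε with cf ε 0<ε
  ... | N , close = N , λ m n N≤m N≤n →
      subst (ℚ._< ε) (sym (eq (f m) (f n))) (close m n N≤m N≤n)
    where
    eq : ∀ p q → ℚ.∣ (ℚ.- p) ℚ.- (ℚ.- q) ∣ ≡ ℚ.∣ p ℚ.- q ∣
    eq p q = trans (cong ℚ.∣_∣ (sym (ℚ.neg-distrib-+ p (ℚ.- q)))) (ℚ.∣-p∣≡∣p∣ (p ℚ.- q))

  *-cauchy : ∀ f g → IsCauchy f → IsCauchy g → IsCauchy (λ n → f n ℚ.* g n)
  *-cauchy f g cf cg ε 0<ε =
    let B , 0<B , M₁ , f≤B = bounded cf
        C , 0<C , M₂ , g≤C = bounded cg
        δ₁ , 0<δ₁ , Bδ₁ = shrink B (½ ℚ.* ε) 0<B (0<½p 0<ε)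
        δ₂ , 0<δ₂ , Cδ₂ = shrink C (½ ℚ.* ε) 0<C (0<½p 0<ε)
        N₁ , close₁ = cg δ₁ 0<δ₁
        N₂ , close₂ = cf δ₂ 0<δ₂
        M = M₁ ℕ.⊔ M₂
        N = N₁ ℕ.⊔ N₂
    in M ℕ.⊔ N , λ m n M⊔N≤m M⊔N≤n →
    let M≤m = ℕ.m⊔n≤o⇒m≤o M N M⊔N≤m
        M≤n = ℕ.m⊔n≤o⇒m≤o M N M⊔N≤n
        N≤m = ℕ.m⊔n≤o⇒n≤o M N M⊔N≤m
        N≤n = ℕ.m⊔n≤o⇒n≤o M N M⊔N≤n
    in estimate (f m) (g m) (f n) (g n) B C δ₁ δ₂ ε 0<B 0<C Bδ₁ Cδ₂
         (f≤B m (ℕ.m⊔n≤o⇒m≤o M₁ M₂ M≤m))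
         (g≤C n (ℕ.m⊔n≤o⇒n≤o M₁ M₂ M≤n))
         (close₁ m n (ℕ.m⊔n≤o⇒m≤o N₁ N₂ N≤m) (ℕ.m⊔n≤o⇒m≤o N₁ N₂ N≤n))
         (close₂ m n (ℕ.m⊔n≤o⇒n≤o N₁ N₂ N≤m) (ℕ.m⊔n≤o⇒n≤o N₁ N₂ N≤n))
    where
    open ℚ.≤-Reasoning
    rearrange : ∀ a b c d → a ℚ.* b ℚ.- c ℚ.* d ≡ a ℚ.* (b ℚ.- d) ℚ.+ d ℚ.* (a ℚ.- c)
    rearrange = solve 4
      (λ a b c d → (a :* b) :- (c :* d) := (a :* (b :- d)) :+ (d :* (a :- c))) refl
      where open +-*-Solver
    estimate : ∀ a b c d B C δ₁ δ₂ ε → 0ℚ ℚ.< B → 0ℚ ℚ.< C →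
      B ℚ.* δ₁ ≡ ½ ℚ.* ε → C ℚ.* δ₂ ≡ ½ ℚ.* ε →
      ℚ.∣ a ∣ ℚ.≤ B → ℚ.∣ d ∣ ℚ.≤ C → ℚ.∣ b ℚ.- d ∣ ℚ.< δ₁ → ℚ.∣ a ℚ.- c ∣ ℚ.< δ₂ →
      ℚ.∣ a ℚ.* b ℚ.- c ℚ.* d ∣ ℚ.< ε
    estimate a b c d B C δ₁ δ₂ ε 0<B 0<C Bδ₁ Cδ₂ a≤B d≤C b-d<δ₁ a-c<δ₂ = begin-strict
      ℚ.∣ a ℚ.* b ℚ.- c ℚ.* d ∣
        ≡⟨ cong ℚ.∣_∣ (rearrange a b c d) ⟩
      ℚ.∣ a ℚ.* (b ℚ.- d) ℚ.+ d ℚ.* (a ℚ.- c) ∣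
        ≤⟨ ℚ.∣p+q∣≤∣p∣+∣q∣ (a ℚ.* (b ℚ.- d)) (d ℚ.* (a ℚ.- c)) ⟩
      ℚ.∣ a ℚ.* (b ℚ.- d) ∣ ℚ.+ ℚ.∣ d ℚ.* (a ℚ.- c) ∣
        <⟨ ℚ.+-mono-< (∣p*q∣<B*δ {a} {b ℚ.- d} 0<B a≤B b-d<δ₁)
                      (∣p*q∣<B*δ {d} {a ℚ.- c} 0<C d≤C a-c<δ₂) ⟩
      B ℚ.* δ₁ ℚ.+ C ℚ.* δ₂
        ≡⟨ cong₂ ℚ._+_ Bδ₁ Cδ₂ ⟩
      ½ ℚ.* ε ℚ.+ ½ ℚ.* ε
        ≡⟨ ½*p ε ⟩
      ε ∎

fromℚ : ℚ → ℝ
fromℚ p = mkℝ (λ _ → p) (const-cauchy p)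

0ℝ 1ℝ : ℝ
0ℝ = fromℚ 0ℚ
1ℝ = fromℚ 1ℚ

infixl 7 _*ℝ_
infixl 6 _+ℝ_ _-ℝ_
infix  8 -ℝ_
infix  4 _≃ℝ_ _<ℝ_ _≤ℝ_

_+ℝ_ _*ℝ_ : ℝ → ℝ → ℝ
x +ℝ y = mkℝ (λ n → seq x n ℚ.+ seq y n) (+-cauchy (seq x) (seq y) (cauchy x) (cauchy y))
x *ℝ y = mkℝ (λ n → seq x n ℚ.* seq y n) (*-cauchy (seq x) (seq y) (cauchy x) (cauchy y))

-ℝ_ : ℝ → ℝ
-ℝ x = mkℝ (λ n → ℚ.- seq x n) (neg-cauchy (seq x) (cauchy x))

_-ℝ_ : ℝ → ℝ → ℝ
x -ℝ y = x +ℝ (-ℝ y)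

_≃ℝ_ _<ℝ_ _≤ℝ_ : ℝ → ℝ → Set
x ≃ℝ y = ∀ ε → 0ℚ ℚ.< ε → ∃[ N ] (∀ n → N ℕ.≤ n → ℚ.∣ seq x n ℚ.- seq y n ∣ ℚ.< ε)
x <ℝ y = ∃[ ε ] 0ℚ ℚ.< ε × ∃[ N ] (∀ n → N ℕ.≤ n → seq x n ℚ.+ ε ℚ.≤ seq y n)
x ≤ℝ y = ¬ (y <ℝ x)

ℝ-rawSemiring : RawSemiring 0ℓ 0ℓ
ℝ-rawSemiring = record
  { Carrier = ℝ ; _≈_ = _≃ℝ_ ; _+_ = _+ℝ_ ; _*_ = _*ℝ_ ; 0# = 0ℝ ; 1# = 1ℝ }

infix 4 _⟶ℝ_

_⟶ℝ_ : (ℕ → ℝ) → ℝ → Set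
s ⟶ℝ L = ∀ ε → 0ℚ ℚ.< ε →
  ∃[ N ] (∀ n → N ℕ.≤ n → (L -ℝ fromℚ ε <ℝ s n) × (s n <ℝ L +ℝ fromℚ ε))

------------------------------------------------------------------------
-- Complex numbers

record ℂ : Set where
  constructor _+i_
  field
    re im : ℝ

open ℂ public

infixl 7 _*ℂ_
infixl 6 _+ℂ_
infix  8 -ℂ_
infix  4 _≃ℂ_ _⟶ℂ_

_≃ℂ_ : ℂ → ℂ → Set
z ≃ℂ w = (re z ≃ℝ re w) × (im z ≃ℝ im w)

_+ℂ_ _*ℂ_ : ℂ → ℂ → ℂ
z +ℂ w = (re z +ℝ re w) +i (im z +ℝ im w)
z *ℂ w = (re z *ℝ re w -ℝ im z *ℝ im w) +i (re z *ℝ im w +ℝ im z *ℝ re w)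

-ℂ_ : ℂ → ℂ
-ℂ z = (-ℝ re z) +i (-ℝ im z)

fromℝ : ℝ → ℂ
fromℝ x = x +i 0ℝ

𝕚 : ℂ
𝕚 = 0ℝ +i 1ℝ

∣_∣² : ℂ → ℝ
∣ z ∣² = re z *ℝ re z +ℝ im z *ℝ im z

ℂ-rawSemiring : RawSemiring 0ℓ 0ℓ
ℂ-rawSemiring = record
  { Carrier = ℂ ; _≈_ = _≃ℂ_ ; _+_ = _+ℂ_ ; _*_ = _*ℂ_
  ; 0# = fromℝ 0ℝ ; 1# = fromℝ 1ℝ }

_⟶ℂ_ : (ℕ → ℂ) → ℂ → Set
s ⟶ℂ L = ((λ n → re (s n)) ⟶ℝ re L) × ((λ n → im (s n)) ⟶ℝ im L)

------------------------------------------------------------------------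
-- Matrices indexed by a finite set

record FiniteSet : Set₁ where
  field
    Carrier  : Set
    _≟_      : DecidableEquality Carrier
    elements : List Carrier
    complete : ∀ x → x ∈ elements
    unique   : Unique elements

module LinearAlgebra {c ℓ} (R : RawSemiring c ℓ) where

  open RawSemiring R renaming (Carrier to S)

  -- f 0 + f 1 + ⋯ + f (n - 1)
  partialSum : (ℕ → S) → ℕ → S
  partialSum f zero    = 0#
  partialSum f (suc n) = partialSum f n + f n

  module _ (V : FiniteSet) where

    open FiniteSet V

    Vector : Set c
    Vector = Carrier → S

    Matrix : Set c
    Matrix = Carrier → Carrier → S

    ∑ : Vector → S
    ∑ u = foldr _+_ 0# (map u elements)

    basis : Carrier → Vector
    basis x y = if does (x ≟ y) then 1# else 0#

    mulVec : Matrix → Vector → Vector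
    mulVec M u x = ∑ (λ y → M x y * u y)

    matMul : Matrix → Matrix → Matrix
    matMul M N x y = ∑ (λ z → M x z * N z y)

    matPow : Matrix → ℕ → Matrix
    matPow M zero    = basis
    matPow M (suc k) = matMul M (matPow M k)

module Real    = LinearAlgebra ℝ-rawSemiring
module Complex = LinearAlgebra ℂ-rawSemiring

------------------------------------------------------------------------
-- Exponential, sine and π

1/_! : ℕ → ℝ
1/ k ! = fromℚ ((ℤ.+ 1 ℚ./ (k !)) {{k ℕ.!≢0}})

-- E = exp M, i.e. E is the entrywise sum of the series Σ Mᵏ / k!
-- (which converges for every M, to a limit unique up to _≃ℂ_).
IsExp : ∀ V → Complex.Matrix V → Complex.Matrix V → Set
IsExp V M E = ∀ x y →
  Complex.partialSum (λ k → fromℝ (1/ k !) *ℂ Complex.matPow V M k x y) ⟶ℂ E x y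

open RawSemiringDefs ℝ-rawSemiring using () renaming (_^_ to _^ℝ_)

-- s = sin x
IsSin : ℝ → ℝ → Set
IsSin x s =
  Real.partialSum (λ k → ((-ℝ 1ℝ) ^ℝ k) *ℝ (1/ suc (2 ℕ.* k) !) *ℝ (x ^ℝ suc (2 ℕ.* k)))
    ⟶ℝ s

-- π is the least positive zero of the sine, which determines it up to _≃ℝ_.
IsPi : ℝ → Set
IsPi p = (0ℝ <ℝ p) × IsSin p 0ℝ × (∀ x → 0ℝ <ℝ x → IsSin x 0ℝ → p ≤ℝ x)

infixl 7 _/ℝ_

_/ℝ_ : ℝ → (n : ℕ) → .{{ℕ.NonZero n}} → ℝ
x /ℝ n = x *ℝ fromℚ (ℤ.+ 1 ℚ./ n)

------------------------------------------------------------------------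
-- Perfect state transfer

module _ (V : FiniteSet) where

  open FiniteSet V using (Carrier)

  -- exp(-iτK) e_a = γ e_b for some γ of modulus 1; |γ| = 1 is written |γ|² = 1.
  TransferAt : Real.Matrix V → Carrier → Carrier → ℝ → Set
  TransferAt K a b τ =
    Σ[ E ∈ Complex.Matrix V ]
      IsExp V (λ x y → (-ℂ (𝕚 *ℂ fromℝ τ)) *ℂ fromℝ (K x y)) E ×
      (Σ[ γ ∈ ℂ ] (∣ γ ∣² ≃ℝ 1ℝ) ×
        (∀ x → Complex.mulVec V E (Complex.basis V a) x ≃ℂ γ *ℂ Complex.basis V b x))

  IsTransferTime : Real.Matrix V → Carrier → Carrier → ℝ → Set
  IsTransferTime K a b τ = (0ℝ <ℝ τ) × TransferAt K a b τ

  PST : Real.Matrix V → Carrier → Carrier → Set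
  PST K a b = Σ[ τ ∈ ℝ ] IsTransferTime K a b τ

  IsMinTransferTime : Real.Matrix V → Carrier → Carrier → ℝ → Set
  IsMinTransferTime K a b τ =
    IsTransferTime K a b τ × (∀ σ → IsTransferTime K a b σ → τ ≤ℝ σ)

------------------------------------------------------------------------
-- Johnson graphs

Vertex : ℕ → ℕ → Set
Vertex v m = Σ[ p ∈ Subset v ] ∣ p ∣ ≡ m

vertex-≡ : ∀ {v m} {a b : Vertex v m} → proj₁ a ≡ proj₁ b → a ≡ b
vertex-≡ {a = _ , h} {b = _ , k} refl = cong (_ ,_) (ℕ.≡-irrelevant h k)

vertex-≟ : ∀ {v m} → DecidableEquality (Vertex v m)
vertex-≟ a b = map′ vertex-≡ (cong proj₁) (≡-dec Bool._≟_ (proj₁ a) (proj₁ b))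

without : ∀ {v m} → Vertex v m → Vertex (suc v) m
without (p , h) = outside ∷ p , h

withZero : ∀ {v m} → Vertex v m → Vertex (suc v) (suc m)
withZero (p , h) = inside ∷ p , cong suc h

vertices : ∀ v m → List (Vertex v m)
vertices zero    zero    = ([] , refl) ∷ []
vertices zero    (suc m) = []
vertices (suc v) zero    = map without (vertices v zero)
vertices (suc v) (suc m) = map without (vertices v (suc m)) ++ map withZero (vertices v m)

vertices-complete : ∀ v m (a : Vertex v m) → a ∈ vertices v m
vertices-complete zero    zero    ([] , refl)        = here refl
vertices-complete (suc v) zero    (outside ∷ p , h)  =
  ∈-map⁺ without (vertices-complete v zero (p , h))
vertices-complete (suc v) (suc m) (outside ∷ p , h)  =
  ∈-++⁺ˡ (∈-map⁺ without (vertices-complete v (suc m) (p , h)))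
vertices-complete (suc v) (suc m) (inside ∷ p , h)   =
  subst (_∈ vertices (suc v) (suc m)) (vertex-≡ refl)
    (∈-++⁺ʳ (map without (vertices v (suc m)))
      (∈-map⁺ withZero (vertices-complete v m (p , ℕ.suc-injective h))))

private
  without-injective : ∀ {v m} {a b : Vertex v m} → without a ≡ without b → a ≡ b
  without-injective eq = vertex-≡ (∷-injectiveʳ (cong proj₁ eq))

  withZero-injective : ∀ {v m} {a b : Vertex v m} → withZero a ≡ withZero b → a ≡ b
  withZero-injective eq = vertex-≡ (∷-injectiveʳ (cong proj₁ eq))

  disjoint : ∀ {v m} (xs : List (Vertex v (suc m))) (ys : List (Vertex v m)) →
             Disjoint (map without xs) (map withZero ys)
  disjoint xs ys (p , q) with ∈-map⁻ without p | ∈-map⁻ withZero q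
  ... | _ , _ , refl | _ , _ , eq with cong proj₁ eq
  ... | ()

vertices-unique : ∀ v m → Unique (vertices v m)
vertices-unique zero    zero    = [] ∷ []
vertices-unique zero    (suc m) = []
vertices-unique (suc v) zero    = map⁺ without-injective (vertices-unique v zero)
vertices-unique (suc v) (suc m) =
  ++⁺ (map⁺ without-injective (vertices-unique v (suc m)))
      (map⁺ withZero-injective (vertices-unique v m))
      (disjoint (vertices v (suc m)) (vertices v m))

Johnson : ℕ → ℕ → FiniteSet
Johnson v m = record
  { Carrier  = Vertex v m
  ; _≟_      = vertex-≟
  ; elements = vertices v m
  ; complete = vertices-complete v m
  ; unique   = vertices-unique v m
  }

Adjacent : ∀ {v m} → Vertex v m → Vertex v m → Set
Adjacent {m = m} a b = suc ∣ proj₁ a ∩ proj₁ b ∣ ≡ m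

adjacent? : ∀ {v m} (a b : Vertex v m) → Dec (Adjacent a b)
adjacent? {m = m} a b = suc ∣ proj₁ a ∩ proj₁ b ∣ ℕ.≟ m

adjacency : ∀ v m → Real.Matrix (Johnson v m)
adjacency v m a b = if does (adjacent? a b) then 1ℝ else 0ℝ

Complementary : ∀ {v m} → Vertex v m → Vertex v m → Set
Complementary a b = proj₁ b ≡ ∁ (proj₁ a)

CaseI : (v m r : ℕ) → Set
CaseI v m r = v ≡ 2 × m ≡ 1 × ¬ (2 ∣ r)

CaseII : (v m r : ℕ) → Vertex v m → Vertex v m → Set
CaseII v m r a b = v ≡ 6 × m ≡ 3 × 2 ∣ r × Complementary a b

instance
  3^r∸1-nonZero : ∀ {r} → .{{ℕ.NonZero r}} → ℕ.NonZero (3 ℕ.^ r ℕ.∸ 1)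
  3^r∸1-nonZero {suc r} = ℕ.>-nonZero (ℕ.m<n⇒0<n∸m (begin-strict
    1                <⟨ ℕ.s≤s (ℕ.s≤s ℕ.z≤n) ⟩
    3                ≤⟨ ℕ.m≤m*n 3 (3 ℕ.^ r) {{ℕ.m^n≢0 3 r}} ⟩
    3 ℕ.* 3 ℕ.^ r    ∎))
    where open ℕ.≤-Reasoning

{-# OPTIONS --safe #-}
-- Pairing exp(-iτAʳ) e_a = γ e_b with an eigenvector f of A for an eigenvalue θ gives
-- e^{-iτθʳ} f(a) = γ f(b).  For f = x_i − x_j with a_i = a_j this forces b_i = b_j, so b is a union of
-- blocks of {a, ∁ a}; hence b = ∁ a and v = 2m.  A product of m − k factors x_i − x_j, each joining a
-- point of a to a point outside a, is an eigenvector for μ_k = k(k + 1) − m and changes by the sign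
-- (−1)^{m−k} from a to ∁ a.  Dividing consecutive relations eliminates γ and leaves
-- e^{iτ(μ_kʳ − μ_{k+1}ʳ)} = −1 for all k < m.  If e^{iτx} = e^{iτy} = −1 then x and y have the same 2-adic
-- valuation, and comparing valuations for k ≤ 3 leaves only m = 1 with r odd and m = 3 with r even.
-- There the spectral idempotents of A exhibit exp(-iτAʳ) as a multiple of the complementation matrix,
-- and k = 0, respectively k = 1, gives e^{-iτD} = −1 with D = 2, respectively D = 3ʳ − 1, so that
-- sin (τD) = 0 and τ ≥ π / D.
--
-- All operations on reals are pointwise on rational sequences, so identities are proved in the ring of
-- Gaussian rationals at each index and only estimates involve limits.  The number π is twice a zero of the
-- cosine between 1 and 2; it is the least positive zero of the sine because sin > 0 on (0, 2] and
-- cos p − cos q = −2 sin ((p + q) / 2) sin ((p − q) / 2).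
module Submission where

open import Defs
open import Algebra.Bundles using (CommutativeRing; CommutativeSemiring)
open import Algebra.Bundles.Raw using (RawSemiring)
import Algebra.Definitions.RawSemiring as RawSemiringDefs
import Algebra.Solver.Ring.AlmostCommutativeRing as ACR
import Algebra.Solver.Ring.Simple as RingSolver
open import Data.Bool.Base using (Bool; true; false; not; if_then_else_)
import Data.Bool.Properties as Bool
open import Data.Empty using (⊥; ⊥-elim)
open import Data.Fin.Base using (Fin; zero; suc; punchOut)
open import Data.Fin.Patterns using (0F; 1F; 2F; 3F)
import Data.Fin.Properties as Fin
open import Data.Fin.Subset using (Subset)
import Data.Integer.Base as ℤ
open ℤ using (ℤ; 0ℤ; 1ℤ)
import Data.Integer.Properties as ℤ
open import Data.Integer.Tactic.RingSolver using (solve-∀)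
open import Data.List.Base using (List; []; _∷_; _++_; foldr; allFin)
open import Data.List.Membership.Propositional using (_∈_)
open import Data.List.Relation.Unary.All using (All; []; _∷_; all?) renaming (lookup to All-lookup)
import Data.List.Relation.Unary.All.Properties as All
open import Data.List.Relation.Unary.Any using (here; there)
open import Data.List.Relation.Unary.Unique.Propositional using (Unique; []; _∷_)
open import Data.Nat.Base as ℕ using (ℕ; zero; suc; _!)
open import Data.Nat.Coprimality using (1-coprimeTo)
open import Data.Nat.Divisibility using (_∣_; divides)
open import Data.Nat.Induction using (<-rec)
import Data.Nat.Properties as ℕ
open import Data.Product.Base using (Σ-syntax; ∃-syntax; _×_; _,_; proj₁; proj₂)
open import Data.Rational.Solver using (module +-*-Solver)
open import Data.Sum.Base using (_⊎_; inj₁; inj₂)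
open import Data.Vec.Base using ([]; _∷_; lookup; removeAt; insertAt)
open import Data.Vec.Properties
  using (≡-dec; insertAt-lookup; lookup-map; removeAt-insertAt; removeAt-punchOut; tabulate-cong; tabulate∘lookup)
open import Function.Base using (_∘_)
open import Function.Bundles using (_⇔_; mk⇔)
open import Level using (0ℓ)
open import Relation.Binary.Definitions using (DecidableEquality)
open import Relation.Binary.PropositionalEquality
  using (_≡_; _≢_; refl; sym; trans; cong; cong₂; subst; isEquivalence; module ≡-Reasoning)
open import Relation.Nullary using (¬_; Dec; yes; no; does)
open import Relation.Nullary.Decidable using (True; toWitness; from-yes; dec-true; dec-false; map′; _×-dec_)

-- The time τ enters only through the homomorphism c ↦ e^{iτc} on the integers. Once γ is eliminated
-- all remaining reasoning is integer arithmetic, and every impossibility ends in 1 = -1; no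
-- logarithm or argument of a complex number is taken. The gaps are μ_k - μ_{k+1} = -2(k + 1), so
-- neighbouring gaps differ in 2-adic valuation, and odd powers of odd eigenvalues keep this
-- difference. For squares the gap is -4(k + 1)((k + 1)² - m). With m odd its valuation is known
-- outright only for odd k, so k = 1 is compared with k = 3; this requires m ≥ 4 and is why m = 3
-- survives. On the analytic side a real is a sequence of rationals whose sign cannot be decided.
-- The value e^{ix} is therefore a diagonal sequence, in which the truncation order and the
-- approximation to x advance together. This requires the functional equation with an error that is
-- uniform on bounded sets; the error obtained is a constant times 2^(-n).

module Analysis where

  import Data.Nat.Coprimality as Coprime
  open import Data.Rational.Base
  open import Data.Rational.Properties as ℚ
  import Data.Rational.Unnormalised.Base as ℚᵘ
  import Data.Rational.Unnormalised.Properties as ℚᵘ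

  -- Integers inside the rationals, and order lemmas.

  -- Given in lowest terms, so that `fromℤ 0ℤ` and `fromℤ 1ℤ` are `0ℚ` and `1ℚ` by computation.
  fromℤ : ℤ.ℤ → ℚ
  fromℤ i = mkℚ i 0 (Coprime.sym (1-coprimeTo ℤ.∣ i ∣))

  fromℤ-+ : ∀ i j → fromℤ (i ℤ.+ j) ≡ fromℤ i + fromℤ j
  fromℤ-+ i j = toℚᵘ-injective (begin
    ℚᵘ.mkℚᵘ (i ℤ.+ j) 0  ≡⟨ cong (λ k → ℚᵘ.mkℚᵘ k 0)
                                              (cong₂ ℤ._+_ (ℤ.*-identityʳ i) (ℤ.*-identityʳ j)) ⟨
    ℚᵘ.mkℚᵘ i 0 ℚᵘ.+ ℚᵘ.mkℚᵘ j 0  ≈⟨ toℚᵘ-homo-+ (fromℤ i) (fromℤ j) ⟨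
    toℚᵘ (fromℤ i + fromℤ j)  ∎)
    where open ℚᵘ.≃-Reasoning

  fromℤ-* : ∀ i j → fromℤ (i ℤ.* j) ≡ fromℤ i * fromℤ j
  fromℤ-* i j = toℚᵘ-injective (ℚᵘ.≃-sym (toℚᵘ-homo-* (fromℤ i) (fromℤ j)))

  fromℤ-neg : ∀ i → fromℤ (ℤ.- i) ≡ - fromℤ i
  fromℤ-neg i = toℚᵘ-injective (ℚᵘ.≃-sym (toℚᵘ-homo‿- (fromℤ i)))

  fromℕ : ℕ → ℚ
  fromℕ n = fromℤ (ℤ.+ n)

  inv : (n : ℕ) → .{{ℕ.NonZero n}} → ℚ
  inv n = ℤ.+ 1 / n

  inv-inverse : ∀ n .{{_ : ℕ.NonZero n}} → inv n * fromℕ n ≡ 1ℚ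
  inv-inverse n@(suc k) = toℚᵘ-injective (begin
    toℚᵘ (inv n * fromℕ n)  ≈⟨ toℚᵘ-homo-* (inv n) (fromℕ n) ⟩
    toℚᵘ (inv n) ℚᵘ.* toℚᵘ (fromℕ n)  ≈⟨ ℚᵘ.*-congʳ {ℚᵘ.mkℚᵘ (ℤ.+ n) 0} (toℚᵘ-fromℚᵘ (ℚᵘ.mkℚᵘ (ℤ.+ 1) k)) ⟩
    ℚᵘ.mkℚᵘ (ℤ.+ 1) k ℚᵘ.* ℚᵘ.mkℚᵘ (ℤ.+ n) 0  ≈⟨ ℚᵘ.*≡* (eq k) ⟩
    toℚᵘ 1ℚ  ∎)
    where
    open ℚᵘ.≃-Reasoning
    eq : ∀ k → (ℤ.+ 1 ℤ.* ℤ.+ suc k) ℤ.* ℤ.+ 1 ≡ ℤ.+ 1 ℤ.* (ℤ.+ (suc k ℕ.* 1))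
    eq k = trans (cong (ℤ._* ℤ.+ 1) (ℤ.*-identityˡ (ℤ.+ suc k)))
            (trans (ℤ.*-identityʳ (ℤ.+ suc k))
            (sym (trans (ℤ.*-identityˡ (ℤ.+ (suc k ℕ.* 1))) (cong ℤ.+_ (ℕ.*-identityʳ (suc k))))))

  0<inv : ∀ n .{{_ : ℕ.NonZero n}} → 0ℚ < inv n
  0<inv n = positive⁻¹ (inv n) {{normalize-pos 1 n}}

  fromℤ-mono-≤ : ∀ {i j} → i ℤ.≤ j → fromℤ i ≤ fromℤ j
  fromℤ-mono-≤ i≤j = *≤* (ℤ.*-monoʳ-≤-nonNeg (ℤ.+ 1) i≤j)

  fromℕ-mono-≤ : ∀ {m n} → m ℕ.≤ n → fromℕ m ≤ fromℕ n
  fromℕ-mono-≤ m≤n = fromℤ-mono-≤ (ℤ.+≤+ m≤n)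

  0≤fromℕ : ∀ n → 0ℚ ≤ fromℕ n
  0≤fromℕ n = fromℕ-mono-≤ {0} ℕ.z≤n

  fromℕ-suc : ∀ n → fromℕ (suc n) ≡ 1ℚ + fromℕ n
  fromℕ-suc n = fromℤ-+ (ℤ.+ 1) (ℤ.+ n)

  archimedean : ∀ p → ∃[ n ] p ≤ fromℕ n
  archimedean p@(mkℚ n d c) = ℤ.∣ n ∣ , *≤* le
    where
    n≤∣n∣ : ∀ i → i ℤ.≤ ℤ.+ ℤ.∣ i ∣
    n≤∣n∣ (ℤ.+ _)     = ℤ.≤-refl
    n≤∣n∣ ℤ.-[1+ _ ]  = ℤ.-≤+
    le : n ℤ.* ℤ.+ 1 ℤ.≤ ℤ.+ ℤ.∣ n ∣ ℤ.* ℤ.+ suc d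
    le = ℤ.≤-trans (ℤ.≤-trans (ℤ.≤-reflexive (ℤ.*-identityʳ n)) (n≤∣n∣ n))
           (ℤ.≤-trans (ℤ.+≤+ (ℕ.m≤m*n ℤ.∣ n ∣ (suc d))) (ℤ.≤-reflexive (ℤ.pos-* ℤ.∣ n ∣ (suc d))))

  abstract

    0≤* : ∀ {p q} → 0ℚ ≤ p → 0ℚ ≤ q → 0ℚ ≤ p * q
    0≤* {p} {q} 0≤p 0≤q = nonNegative⁻¹ (p * q)
      {{nonNeg*nonNeg⇒nonNeg p {{nonNegative 0≤p}} q {{nonNegative 0≤q}}}}

    *-mono-≤ : ∀ {p q r s} → 0ℚ ≤ p → p ≤ q → 0ℚ ≤ r → r ≤ s → p * r ≤ q * s
    *-mono-≤ {p} {q} {r} {s} 0≤p p≤q 0≤r r≤s = ≤-trans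
      (*-monoʳ-≤-nonNeg r {{nonNegative 0≤r}} p≤q)
      (*-monoˡ-≤-nonNeg q {{nonNegative (≤-trans 0≤p p≤q)}} r≤s)

    0≤+ : ∀ {p q} → 0ℚ ≤ p → 0ℚ ≤ q → 0ℚ ≤ p + q
    0≤+ = +-mono-≤ {0ℚ} {_} {0ℚ}

    p≤p+q : ∀ {p q} → 0ℚ ≤ q → p ≤ p + q
    p≤p+q {p} {q} 0≤q = subst (_≤ p + q) (+-identityʳ p) (+-monoʳ-≤ p 0≤q)

    ≤-by : ∀ {p q r} → 0ℚ ≤ r → p + r ≡ q → p ≤ q
    ≤-by {p} {q} {r} 0≤r refl = p≤p+q {p} {r} 0≤r

    <-by : ∀ {p q r} → 0ℚ < r → p + r ≡ q → p < q
    <-by {p} {_} {r} 0<r refl = subst (_< p + r) (+-identityʳ p) (+-monoʳ-< p 0<r)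

    p≤q⇒0≤q-p : ∀ {p q} → p ≤ q → 0ℚ ≤ q - p
    p≤q⇒0≤q-p {p} {q} p≤q = subst (_≤ q - p) (+-inverseʳ p) (+-monoˡ-≤ (- p) p≤q)

    p≤∣p∣ : ∀ p → p ≤ ∣ p ∣
    p≤∣p∣ p with ≤-total 0ℚ p
    ... | inj₁ 0≤p = ≤-reflexive (sym (0≤p⇒∣p∣≡p 0≤p))
    ... | inj₂ p≤0 = ≤-trans p≤0 (0≤∣p∣ p)

    -p≤∣p∣ : ∀ p → - p ≤ ∣ p ∣
    -p≤∣p∣ p = subst (- p ≤_) (∣-p∣≡∣p∣ p) (p≤∣p∣ (- p))

    inv-small : ∀ {ε} → 0ℚ < ε → ∃[ n ] inv (suc n) < ε
    inv-small {ε} 0<ε with shrink ε 1ℚ 0<ε (positive⁻¹ 1ℚ)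
    ... | ε⁻¹ , 0<ε⁻¹ , ε*ε⁻¹≡1 with archimedean ε⁻¹
    ...   | n , ε⁻¹≤n = n , ≰⇒> λ ε≤inv → <-irrefl refl (begin-strict
      1ℚ  ≡⟨ ε*ε⁻¹≡1 ⟨
      ε * ε⁻¹  ≤⟨ *-mono-≤ (<⇒≤ 0<ε) ε≤inv (<⇒≤ 0<ε⁻¹) ε⁻¹≤n ⟩
      inv (suc n) * fromℕ n  <⟨ *-monoʳ-<-pos (inv (suc n)) {{positive (0<inv (suc n))}} n<1+n ⟩
      inv (suc n) * fromℕ (suc n)  ≡⟨ inv-inverse (suc n) ⟩
      1ℚ  ∎)
      where
      open ≤-Reasoning
      n<1+n : fromℕ n < fromℕ (suc n)
      n<1+n = <-by (positive⁻¹ 1ℚ) (trans (+-comm (fromℕ n) 1ℚ) (sym (fromℕ-suc n)))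

  -- Gaussian rationals

  infix 4 _,ᵍ_

  record 𝔾 : Set where
    no-eta-equality
    pattern
    constructor _,ᵍ_
    field
      Re Im : ℚ

  open 𝔾 public

  infixl 7 _*ᵍ_
  infixl 6 _+ᵍ_ _-ᵍ_
  infix  8 -ᵍ_

  -ᵍ_ : 𝔾 → 𝔾
  -ᵍ (a ,ᵍ b) = - a ,ᵍ - b

  _+ᵍ_ _*ᵍ_ _-ᵍ_ : 𝔾 → 𝔾 → 𝔾
  (a ,ᵍ b) +ᵍ (c ,ᵍ d) = a + c ,ᵍ b + d
  (a ,ᵍ b) *ᵍ (c ,ᵍ d) = a * c - b * d ,ᵍ a * d + b * c
  z -ᵍ w = z +ᵍ (-ᵍ w)

  real imag : ℚ → 𝔾
  real p = p ,ᵍ 0ℚ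
  imag p = 0ℚ ,ᵍ p

  0ᵍ 1ᵍ : 𝔾
  0ᵍ = real 0ℚ
  1ᵍ = real 1ℚ

  abstract
    +ᵍ-assoc : ∀ x y z → (x +ᵍ y) +ᵍ z ≡ x +ᵍ (y +ᵍ z)
    +ᵍ-assoc (a ,ᵍ b) (c ,ᵍ d) (e ,ᵍ f) = cong₂ _,ᵍ_ (+-assoc a c e) (+-assoc b d f)

    +ᵍ-comm : ∀ x y → x +ᵍ y ≡ y +ᵍ x
    +ᵍ-comm (a ,ᵍ b) (c ,ᵍ d) = cong₂ _,ᵍ_ (+-comm a c) (+-comm b d)

    +ᵍ-identityˡ : ∀ x → 0ᵍ +ᵍ x ≡ x
    +ᵍ-identityˡ (a ,ᵍ b) = cong₂ _,ᵍ_ (+-identityˡ a) (+-identityˡ b)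

    +ᵍ-identityʳ : ∀ x → x +ᵍ 0ᵍ ≡ x
    +ᵍ-identityʳ (a ,ᵍ b) = cong₂ _,ᵍ_ (+-identityʳ a) (+-identityʳ b)

    +ᵍ-inverseˡ : ∀ x → (-ᵍ x) +ᵍ x ≡ 0ᵍ
    +ᵍ-inverseˡ (a ,ᵍ b) = cong₂ _,ᵍ_ (+-inverseˡ a) (+-inverseˡ b)

    +ᵍ-inverseʳ : ∀ x → x +ᵍ (-ᵍ x) ≡ 0ᵍ
    +ᵍ-inverseʳ (a ,ᵍ b) = cong₂ _,ᵍ_ (+-inverseʳ a) (+-inverseʳ b)

    *ᵍ-assoc : ∀ x y z → (x *ᵍ y) *ᵍ z ≡ x *ᵍ (y *ᵍ z)
    *ᵍ-assoc (a ,ᵍ b) (c ,ᵍ d) (e ,ᵍ f) = cong₂ _,ᵍ_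
      (solve 6 (λ a b c d e f →
        (a :* c :- b :* d) :* e :- (a :* d :+ b :* c) :* f
        := a :* (c :* e :- d :* f) :- b :* (c :* f :+ d :* e)) refl a b c d e f)
      (solve 6 (λ a b c d e f →
        (a :* c :- b :* d) :* f :+ (a :* d :+ b :* c) :* e
        := a :* (c :* f :+ d :* e) :+ b :* (c :* e :- d :* f)) refl a b c d e f)
      where open +-*-Solver

    *ᵍ-comm : ∀ x y → x *ᵍ y ≡ y *ᵍ x
    *ᵍ-comm (a ,ᵍ b) (c ,ᵍ d) = cong₂ _,ᵍ_
      (solve 4 (λ a b c d → a :* c :- b :* d := c :* a :- d :* b) refl a b c d)
      (solve 4 (λ a b c d → a :* d :+ b :* c := c :* b :+ d :* a) refl a b c d)
      where open +-*-Solver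

    *ᵍ-identityˡ : ∀ x → 1ᵍ *ᵍ x ≡ x
    *ᵍ-identityˡ (a ,ᵍ b) = cong₂ _,ᵍ_
      (solve 2 (λ a b → con 1ℚ :* a :- con 0ℚ :* b := a) refl a b)
      (solve 2 (λ a b → con 1ℚ :* b :+ con 0ℚ :* a := b) refl a b)
      where open +-*-Solver

    *ᵍ-identityʳ : ∀ x → x *ᵍ 1ᵍ ≡ x
    *ᵍ-identityʳ x = trans (*ᵍ-comm x 1ᵍ) (*ᵍ-identityˡ x)

    *ᵍ-distribˡ-+ᵍ : ∀ x y z → x *ᵍ (y +ᵍ z) ≡ (x *ᵍ y) +ᵍ (x *ᵍ z)
    *ᵍ-distribˡ-+ᵍ (a ,ᵍ b) (c ,ᵍ d) (e ,ᵍ f) = cong₂ _,ᵍ_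
      (solve 6 (λ a b c d e f →
        a :* (c :+ e) :- b :* (d :+ f) := (a :* c :- b :* d) :+ (a :* e :- b :* f)) refl a b c d e f)
      (solve 6 (λ a b c d e f →
        a :* (d :+ f) :+ b :* (c :+ e) := (a :* d :+ b :* c) :+ (a :* f :+ b :* e)) refl a b c d e f)
      where open +-*-Solver

    *ᵍ-distribʳ-+ᵍ : ∀ x y z → (y +ᵍ z) *ᵍ x ≡ (y *ᵍ x) +ᵍ (z *ᵍ x)
    *ᵍ-distribʳ-+ᵍ x y z = trans (*ᵍ-comm (y +ᵍ z) x)
      (trans (*ᵍ-distribˡ-+ᵍ x y z) (cong₂ _+ᵍ_ (*ᵍ-comm x y) (*ᵍ-comm x z)))

  𝔾-commutativeRing : CommutativeRing 0ℓ 0ℓ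
  𝔾-commutativeRing = record
    { Carrier = 𝔾 ; _≈_ = _≡_ ; _+_ = _+ᵍ_ ; _*_ = _*ᵍ_ ; -_ = λ z → -ᵍ z ; 0# = 0ᵍ ; 1# = 1ᵍ
    ; isCommutativeRing = record
      { isRing = record
        { +-isAbelianGroup = record
          { isGroup = record
            { isMonoid = record
              { isSemigroup = record
                { isMagma = record { isEquivalence = isEquivalence ; ∙-cong = cong₂ _+ᵍ_ }
                ; assoc = +ᵍ-assoc }
              ; identity = +ᵍ-identityˡ , +ᵍ-identityʳ }
            ; inverse = +ᵍ-inverseˡ , +ᵍ-inverseʳ
            ; ⁻¹-cong = cong (λ z → -ᵍ z) }
          ; comm = +ᵍ-comm }
        ; *-cong = cong₂ _*ᵍ_
        ; *-assoc = *ᵍ-assoc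
        ; *-identity = *ᵍ-identityˡ , *ᵍ-identityʳ
        ; distrib = *ᵍ-distribˡ-+ᵍ , *ᵍ-distribʳ-+ᵍ }
      ; *-comm = *ᵍ-comm } }

  _≟ᵍ_ : DecidableEquality 𝔾
  (a ,ᵍ b) ≟ᵍ (c ,ᵍ d) = map′ (λ (p , q) → cong₂ _,ᵍ_ p q) (λ eq → cong Re eq , cong Im eq)
    (a ℚ.≟ c ×-dec b ℚ.≟ d)

  module 𝔾-Solver = RingSolver (ACR.fromCommutativeRing 𝔾-commutativeRing) _≟ᵍ_

  -- The ℓ¹ norm: the modulus would leave the rationals, while this norm is rational and still
  -- submultiplicative.
  ‖_‖ : 𝔾 → ℚ
  ‖ a ,ᵍ b ‖ = ∣ a ∣ + ∣ b ∣

  abstract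
    0≤‖‖ : ∀ z → 0ℚ ≤ ‖ z ‖
    0≤‖‖ (a ,ᵍ b) = 0≤+ (0≤∣p∣ a) (0≤∣p∣ b)

    ‖+‖ : ∀ z w → ‖ z +ᵍ w ‖ ≤ ‖ z ‖ + ‖ w ‖
    ‖+‖ (a ,ᵍ b) (c ,ᵍ d) = begin
      ∣ a + c ∣ + ∣ b + d ∣  ≤⟨ +-mono-≤ (∣p+q∣≤∣p∣+∣q∣ a c) (∣p+q∣≤∣p∣+∣q∣ b d) ⟩
      ∣ a ∣ + ∣ c ∣ + (∣ b ∣ + ∣ d ∣)
        ≡⟨ solve 4 (λ a b c d → a :+ c :+ (b :+ d) := a :+ b :+ (c :+ d)) refl (∣ a ∣) (∣ b ∣) (∣ c ∣) (∣ d ∣) ⟩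
      ∣ a ∣ + ∣ b ∣ + (∣ c ∣ + ∣ d ∣)  ∎
      where open ≤-Reasoning
            open +-*-Solver

    ‖-‖ : ∀ z → ‖ -ᵍ z ‖ ≡ ‖ z ‖
    ‖-‖ (a ,ᵍ b) = cong₂ _+_ (∣-p∣≡∣p∣ a) (∣-p∣≡∣p∣ b)

    ‖*‖ : ∀ z w → ‖ z *ᵍ w ‖ ≤ ‖ z ‖ * ‖ w ‖
    ‖*‖ (a ,ᵍ b) (c ,ᵍ d) = begin
      ∣ a * c - b * d ∣ + ∣ a * d + b * c ∣
        ≤⟨ +-mono-≤ (∣p-q∣≤∣p∣+∣q∣ (a * c) (b * d)) (∣p+q∣≤∣p∣+∣q∣ (a * d) (b * c)) ⟩
      ∣ a * c ∣ + ∣ b * d ∣ + (∣ a * d ∣ + ∣ b * c ∣)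
        ≡⟨ cong₂ _+_ (cong₂ _+_ (∣p*q∣≡∣p∣*∣q∣ a c) (∣p*q∣≡∣p∣*∣q∣ b d))
                     (cong₂ _+_ (∣p*q∣≡∣p∣*∣q∣ a d) (∣p*q∣≡∣p∣*∣q∣ b c)) ⟩
      ∣ a ∣ * ∣ c ∣ + ∣ b ∣ * ∣ d ∣ + (∣ a ∣ * ∣ d ∣ + ∣ b ∣ * ∣ c ∣)
        ≡⟨ solve 4 (λ a b c d → a :* c :+ b :* d :+ (a :* d :+ b :* c) := (a :+ b) :* (c :+ d)) refl (∣ a ∣) (∣ b ∣) (∣ c ∣) (∣ d ∣) ⟩
      (∣ a ∣ + ∣ b ∣) * (∣ c ∣ + ∣ d ∣) ∎
      where open ≤-Reasoning
            open +-*-Solver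

    ‖real‖ : ∀ p → ‖ real p ‖ ≡ ∣ p ∣
    ‖real‖ p = +-identityʳ ∣ p ∣

    ‖imag‖ : ∀ p → ‖ imag p ‖ ≡ ∣ p ∣
    ‖imag‖ p = +-identityˡ ∣ p ∣

    ∣Re∣≤‖‖ : ∀ z → ∣ Re z ∣ ≤ ‖ z ‖
    ∣Re∣≤‖‖ (a ,ᵍ b) = p≤p+q (0≤∣p∣ b)

    ∣Im∣≤‖‖ : ∀ z → ∣ Im z ∣ ≤ ‖ z ‖
    ∣Im∣≤‖‖ (a ,ᵍ b) = ≤-trans (p≤p+q {∣ b ∣} (0≤∣p∣ a)) (≤-reflexive (+-comm ∣ b ∣ ∣ a ∣))

  -- Approximation along filters

  -- Limits occur along one index, along two independent indices and along iterated indices; a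
  -- filter lets the limit laws be proved once for all three. `map₂` expresses closure under
  -- supersets and binary intersections together.
  record Filter (I : Set) : Set₁ where
    field
      Eventually : (I → Set) → Set
      always     : ∀ {P : I → Set} → (∀ i → P i) → Eventually P
      map₂       : ∀ {P Q R : I → Set} → (∀ i → P i → Q i → R i) →
                   Eventually P → Eventually Q → Eventually R

    map : ∀ {P Q : I → Set} → (∀ i → P i → Q i) → Eventually P → Eventually Q
    map {P} f ep = map₂ {P} {P} (λ i p _ → f i p) ep ep

  open Filter

  module _ {I : Set} (F : Filter I) where

    record Null (u : I → 𝔾) : Set where
      constructor mkNull
      field eventually-< : ∀ ε → 0ℚ < ε → Eventually F (λ i → ‖ u i ‖ < ε)

    record Approx (u v : I → 𝔾) : Set where
      constructor mkApprox
      field null : Null (λ i → u i -ᵍ v i)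

    record Bounded (u : I → 𝔾) : Set where
      constructor mkBounded
      field
        bound   : ℚ
        0<bound : 0ℚ < bound
        ≤bound  : Eventually F (λ i → ‖ u i ‖ ≤ bound)

  open Null public
  open Approx public
  open Bounded public

  module _ {I : Set} {F : Filter I} where

    null-by : ∀ {u v : I → 𝔾} → Eventually F (λ i → ‖ u i ‖ ≤ ‖ v i ‖) → Null F v → Null F u
    null-by {u} {v} u≤v (mkNull v→0) = mkNull λ ε 0<ε →
      map₂ F {λ i → ‖ u i ‖ ≤ ‖ v i ‖} {λ i → ‖ v i ‖ < ε} (λ i → ≤-<-trans) u≤v (v→0 ε 0<ε)

    null-≗ : ∀ {u v : I → 𝔾} → (∀ i → u i ≡ v i) → Null F v → Null F u
    null-≗ {u} {v} eq = null-by (always F (λ i → ≤-reflexive (cong ‖_‖ (eq i))))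

    null-0 : Null F (λ _ → 0ᵍ)
    null-0 = mkNull λ ε 0<ε → always F (λ _ → 0<ε)

    null-+ : ∀ {u v : I → 𝔾} → Null F u → Null F v → Null F (λ i → u i +ᵍ v i)
    null-+ {u} {v} (mkNull u→0) (mkNull v→0) = mkNull λ ε 0<ε →
      map₂ F {λ i → ‖ u i ‖ < ½ * ε} {λ i → ‖ v i ‖ < ½ * ε}
        (λ i a b → ≤-<-trans (‖+‖ (u i) (v i)) (subst (‖ u i ‖ + ‖ v i ‖ <_) (½*p ε) (+-mono-< a b)))
        (u→0 (½ * ε) (0<½p 0<ε)) (v→0 (½ * ε) (0<½p 0<ε))

    null-neg : ∀ {u : I → 𝔾} → Null F u → Null F (λ i → -ᵍ u i)
    null-neg {u} = null-by (always F (λ i → ≤-reflexive (‖-‖ (u i))))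

    null-* : ∀ {u v : I → 𝔾} → Bounded F u → Null F v → Null F (λ i → u i *ᵍ v i)
    null-* {u} {v} (mkBounded B 0<B u≤B) (mkNull v→0) = mkNull λ ε 0<ε →
      let δ , 0<δ , Bδ≡ε = shrink B ε 0<B 0<ε in
      map₂ F {λ i → ‖ u i ‖ ≤ B} {λ i → ‖ v i ‖ < δ}
        (λ i a b → ≤-<-trans (‖*‖ (u i) (v i))
          (≤-<-trans (*-monoʳ-≤-nonNeg ‖ v i ‖ {{nonNegative (0≤‖‖ (v i))}} a)
            (subst (B * ‖ v i ‖ <_) Bδ≡ε (*-monoʳ-<-pos B {{positive 0<B}} b))))
        u≤B (v→0 δ 0<δ)

    bounded-by : ∀ {u : I → 𝔾} B → Eventually F (λ i → ‖ u i ‖ ≤ B) → Bounded F u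
    bounded-by {u} B u≤B = mkBounded (1ℚ + ∣ B ∣) (+-mono-<-≤ {0ℚ} {1ℚ} {0ℚ} (positive⁻¹ 1ℚ) (0≤∣p∣ B))
      (map F {λ i → ‖ u i ‖ ≤ B} (λ i u≤ → ≤-trans u≤ (≤-trans (p≤∣p∣ B) (≤-trans (p≤p+q (<⇒≤ (positive⁻¹ 1ℚ)))
          (≤-reflexive (+-comm ∣ B ∣ 1ℚ))))) u≤B)

    bounded-const : ∀ z → Bounded F (λ _ → z)
    bounded-const z = bounded-by ‖ z ‖ (always F (λ _ → ≤-refl))

    ≈-refl : ∀ {u : I → 𝔾} → Approx F u u
    ≈-refl {u} = mkApprox (null-≗ (λ i → +ᵍ-inverseʳ (u i)) null-0)

    ≈-sym : ∀ {u v : I → 𝔾} → Approx F u v → Approx F v u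
    ≈-sym {u} {v} (mkApprox u≈v) = mkApprox (null-≗ (λ i → eq (u i) (v i)) (null-neg u≈v))
      where
      open 𝔾-Solver
      eq : ∀ x y → y -ᵍ x ≡ -ᵍ (x -ᵍ y)
      eq = solve 2 (λ x y → y :- x := :- (x :- y)) refl

    ≈-trans : ∀ {u v w : I → 𝔾} → Approx F u v → Approx F v w → Approx F u w
    ≈-trans {u} {v} {w} (mkApprox u≈v) (mkApprox v≈w) =
      mkApprox (null-≗ (λ i → eq (u i) (v i) (w i)) (null-+ u≈v v≈w))
      where
      open 𝔾-Solver
      eq : ∀ x y z → x -ᵍ z ≡ (x -ᵍ y) +ᵍ (y -ᵍ z)
      eq = solve 3 (λ x y z → x :- z := (x :- y) :+ (y :- z)) refl

    ≈-reflexive : ∀ {u v : I → 𝔾} → (∀ i → u i ≡ v i) → Approx F u v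
    ≈-reflexive {u} {v} eq =
      mkApprox (null-≗ (λ i → trans (cong (_-ᵍ v i) (eq i)) (+ᵍ-inverseʳ (v i))) null-0)

    ≈-+ : ∀ {u v u′ v′ : I → 𝔾} → Approx F u v → Approx F u′ v′ →
          Approx F (λ i → u i +ᵍ u′ i) (λ i → v i +ᵍ v′ i)
    ≈-+ {u} {v} {u′} {v′} (mkApprox p) (mkApprox q) =
      mkApprox (null-≗ (λ i → eq (u i) (v i) (u′ i) (v′ i)) (null-+ p q))
      where
      open 𝔾-Solver
      eq : ∀ x y x′ y′ → (x +ᵍ x′) -ᵍ (y +ᵍ y′) ≡ (x -ᵍ y) +ᵍ (x′ -ᵍ y′)
      eq = solve 4 (λ x y x′ y′ → (x :+ x′) :- (y :+ y′) := (x :- y) :+ (x′ :- y′)) refl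

    ≈-neg : ∀ {u v : I → 𝔾} → Approx F u v → Approx F (λ i → -ᵍ u i) (λ i → -ᵍ v i)
    ≈-neg {u} {v} (mkApprox u≈v) = mkApprox (null-≗ (λ i → eq (u i) (v i)) (null-neg u≈v))
      where
      open 𝔾-Solver
      eq : ∀ x y → (-ᵍ x) -ᵍ (-ᵍ y) ≡ -ᵍ (x -ᵍ y)
      eq = solve 2 (λ x y → (:- x) :- (:- y) := :- (x :- y)) refl

    bounded-≈ : ∀ {u v : I → 𝔾} → Approx F u v → Bounded F v → Bounded F u
    bounded-≈ {u} {v} (mkApprox u≈v) (mkBounded B 0<B v≤B) =
      mkBounded (1ℚ + B) (+-mono-< {0ℚ} {1ℚ} {0ℚ} (positive⁻¹ 1ℚ) 0<B)
        (map₂ F {λ i → ‖ u i -ᵍ v i ‖ < 1ℚ} {λ i → ‖ v i ‖ ≤ B}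
          (λ i a b → ≤-trans (≤-reflexive (cong ‖_‖ (eq (u i) (v i))))
            (≤-trans (‖+‖ (u i -ᵍ v i) (v i)) (+-mono-≤ (<⇒≤ a) b)))
          (eventually-< u≈v 1ℚ (positive⁻¹ 1ℚ)) v≤B)
      where
      open 𝔾-Solver
      eq : ∀ x y → x ≡ (x -ᵍ y) +ᵍ y
      eq = solve 2 (λ x y → x := (x :- y) :+ y) refl

    ≈-* : ∀ {u v u′ v′ : I → 𝔾} → Bounded F v → Bounded F v′ → Approx F u v → Approx F u′ v′ →
          Approx F (λ i → u i *ᵍ u′ i) (λ i → v i *ᵍ v′ i)
    ≈-* {u} {v} {u′} {v′} bv bv′ p q = mkApprox (null-≗ (λ i → eq (u i) (v i) (u′ i) (v′ i))
        (null-+ (null-* (bounded-≈ p bv) (null q)) (null-* bv′ (null p))))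
      where
      open 𝔾-Solver
      eq : ∀ x y x′ y′ → (x *ᵍ x′) -ᵍ (y *ᵍ y′) ≡ (x *ᵍ (x′ -ᵍ y′)) +ᵍ (y′ *ᵍ (x -ᵍ y))
      eq = solve 4 (λ x y x′ y′ → (x :* x′) :- (y :* y′) := (x :* (x′ :- y′)) :+ (y′ :* (x :- y))) refl

  module _ where
    open 𝔾-Solver

    *ᵍ-zeroˡ : ∀ z → 0ᵍ *ᵍ z ≡ 0ᵍ
    *ᵍ-zeroˡ = solve 1 (λ z → con 0ᵍ :* z := con 0ᵍ) refl

    *ᵍ-zeroʳ : ∀ z → z *ᵍ 0ᵍ ≡ 0ᵍ
    *ᵍ-zeroʳ = solve 1 (λ z → z :* con 0ᵍ := con 0ᵍ) refl

    *ᵍ-swap : ∀ x y z → x *ᵍ (y *ᵍ z) ≡ y *ᵍ (x *ᵍ z)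
    *ᵍ-swap = solve 3 (λ x y z → x :* (y :* z) := y :* (x :* z)) refl

  real-+ : ∀ p q → real (p + q) ≡ real p +ᵍ real q
  real-+ p q = cong (p + q ,ᵍ_) refl

  real-* : ∀ p q → real (p * q) ≡ real p *ᵍ real q
  real-* p q = cong₂ _,ᵍ_
    (solve 2 (λ p q → p :* q := p :* q :- con 0ℚ :* con 0ℚ) refl p q)
    (solve 2 (λ p q → con 0ℚ := p :* con 0ℚ :+ con 0ℚ :* q) refl p q)
    where open +-*-Solver

  -- Cauchy products

  sum< : (ℕ → 𝔾) → ℕ → 𝔾
  sum< f zero    = 0ᵍ
  sum< f (suc n) = sum< f n +ᵍ f n

  sumℚ< : (ℕ → ℚ) → ℕ → ℚ
  sumℚ< f zero    = 0ℚ
  sumℚ< f (suc n) = sumℚ< f n + f n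

  sum<-cong : ∀ {f g} → (∀ i → f i ≡ g i) → ∀ n → sum< f n ≡ sum< g n
  sum<-cong eq zero    = refl
  sum<-cong eq (suc n) = cong₂ _+ᵍ_ (sum<-cong eq n) (eq n)

  sumℚ<-suc : ∀ f n → sumℚ< f (suc n) ≡ f 0 + sumℚ< (f ∘ suc) n
  sumℚ<-suc f zero    = +-comm 0ℚ (f 0)
  sumℚ<-suc f (suc n) = trans (cong (_+ f (suc n)) (sumℚ<-suc f n))
                              (+-assoc (f 0) (sumℚ< (f ∘ suc) n) (f (suc n)))

  sum<-suc : ∀ f n → sum< f (suc n) ≡ f 0 +ᵍ sum< (f ∘ suc) n
  sum<-suc f zero    = +ᵍ-comm 0ᵍ (f 0)
  sum<-suc f (suc n) = trans (cong (_+ᵍ f (suc n)) (sum<-suc f n))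
                             (+ᵍ-assoc (f 0) (sum< (f ∘ suc) n) (f (suc n)))

  -- conv f g n = Σ_{i ≤ n} f i g (n - i)
  conv : (f g : ℕ → 𝔾) → ℕ → 𝔾
  conv f g zero    = f 0 *ᵍ g 0
  conv f g (suc n) = f 0 *ᵍ g (suc n) +ᵍ conv (f ∘ suc) g n

  conv-cong : ∀ {f f′ g g′} → (∀ i → f i ≡ f′ i) → (∀ i → g i ≡ g′ i) → ∀ n → conv f g n ≡ conv f′ g′ n
  conv-cong p q zero    = cong₂ _*ᵍ_ (p 0) (q 0)
  conv-cong p q (suc n) = cong₂ _+ᵍ_ (cong₂ _*ᵍ_ (p 0) (q (suc n))) (conv-cong (p ∘ suc) q n)

  conv-scaleˡ : ∀ c f g n → conv (λ i → c *ᵍ f i) g n ≡ c *ᵍ conv f g n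
  conv-scaleˡ c f g zero    = *ᵍ-assoc c (f 0) (g 0)
  conv-scaleˡ c f g (suc n) =
    trans (cong₂ _+ᵍ_ (*ᵍ-assoc c (f 0) (g (suc n))) (conv-scaleˡ c (f ∘ suc) g n))
          (sym (*ᵍ-distribˡ-+ᵍ c _ _))

  conv-scaleʳ : ∀ c f g n → conv f (λ i → c *ᵍ g i) n ≡ c *ᵍ conv f g n
  conv-scaleʳ c f g zero    = *ᵍ-swap (f 0) c (g 0)
  conv-scaleʳ c f g (suc n) =
    trans (cong (f 0 *ᵍ (c *ᵍ g (suc n)) +ᵍ_) (conv-scaleʳ c (f ∘ suc) g n))
          (eq c (f 0) (g (suc n)) _)
    where
    open 𝔾-Solver
    eq : ∀ c x y z → x *ᵍ (c *ᵍ y) +ᵍ c *ᵍ z ≡ c *ᵍ (x *ᵍ y +ᵍ z)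
    eq = solve 4 (λ c x y z → x :* (c :* y) :+ c :* z := c :* (x :* y :+ z)) refl

  conv-+ˡ : ∀ f f′ g n → conv (λ i → f i +ᵍ f′ i) g n ≡ conv f g n +ᵍ conv f′ g n
  conv-+ˡ f f′ g zero    = *ᵍ-distribʳ-+ᵍ (g 0) (f 0) (f′ 0)
  conv-+ˡ f f′ g (suc n) =
    trans (cong ((f 0 +ᵍ f′ 0) *ᵍ g (suc n) +ᵍ_) (conv-+ˡ (f ∘ suc) (f′ ∘ suc) g n))
          (eq (f 0) (f′ 0) (g (suc n)) _ _)
    where
    open 𝔾-Solver
    eq : ∀ x x′ y z z′ → (x +ᵍ x′) *ᵍ y +ᵍ (z +ᵍ z′) ≡ (x *ᵍ y +ᵍ z) +ᵍ (x′ *ᵍ y +ᵍ z′)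
    eq = solve 5 (λ x x′ y z z′ → (x :+ x′) :* y :+ (z :+ z′) := (x :* y :+ z) :+ (x′ :* y :+ z′)) refl

  -- The coefficient sequence of the derivative of Σ f i xⁱ.
  deriv : (ℕ → 𝔾) → ℕ → 𝔾
  deriv f n = real (fromℕ (suc n)) *ᵍ f (suc n)

  -- Coefficients of (c + xF)′ = F + xF′, with c the constant term and F the shifted series.
  deriv-shift : ∀ f n → deriv (f ∘ suc) n +ᵍ f (suc (suc n)) ≡ deriv f (suc n)
  deriv-shift f n = trans (eq (real (fromℕ (suc n))) (f (suc (suc n))))
    (cong (λ c → real c *ᵍ f (suc (suc n))) (sym (fromℕ-suc (suc n))))
    where
    open 𝔾-Solver
    eq : ∀ c x → c *ᵍ x +ᵍ x ≡ (1ᵍ +ᵍ c) *ᵍ x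
    eq = solve 2 (λ c x → c :* x :+ x := (con 1ᵍ :+ c) :* x) refl

  -- The source of the binomial theorem without binomial coefficients: with this rule the product of
  -- two exponential series satisfies u′ = (z + w)u, which determines its coefficients.
  product-rule : ∀ f g n → deriv (conv f g) n ≡ conv (deriv f) g n +ᵍ conv f (deriv g) n
  product-rule f g zero = eq (f 0) (f 1) (g 0) (g 1)
    where
    open 𝔾-Solver
    eq : ∀ x x′ y y′ → 1ᵍ *ᵍ (x *ᵍ y′ +ᵍ x′ *ᵍ y) ≡ (1ᵍ *ᵍ x′) *ᵍ y +ᵍ x *ᵍ (1ᵍ *ᵍ y′)
    eq = solve 4 (λ x x′ y y′ → con 1ᵍ :* (x :* y′ :+ x′ :* y) := (con 1ᵍ :* x′) :* y :+ x :* (con 1ᵍ :* y′)) refl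
  product-rule f g (suc n) = begin
    real (fromℕ (suc (suc n))) *ᵍ (f 0 *ᵍ g (suc (suc n)) +ᵍ c₁)
      ≡⟨ cong (λ k → real k *ᵍ (f 0 *ᵍ g (suc (suc n)) +ᵍ c₁)) (fromℕ-suc (suc n)) ⟩
    (1ᵍ +ᵍ N) *ᵍ (f 0 *ᵍ g (suc (suc n)) +ᵍ c₁)
      ≡⟨ eq₁ N (f 0) (g (suc (suc n))) c₁ ⟩
    f 0 *ᵍ ((1ᵍ +ᵍ N) *ᵍ g (suc (suc n))) +ᵍ (N *ᵍ c₁ +ᵍ c₁)
      ≡⟨ cong₂ (λ k x → f 0 *ᵍ (real k *ᵍ g (suc (suc n))) +ᵍ (x +ᵍ c₁))
           (sym (fromℕ-suc (suc n))) (product-rule (f ∘ suc) g n) ⟩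
    f 0 *ᵍ deriv g (suc n) +ᵍ ((conv (deriv (f ∘ suc)) g n +ᵍ c₂) +ᵍ (f 1 *ᵍ g (suc n) +ᵍ c₃))
      ≡⟨ eq₂ (f 0 *ᵍ deriv g (suc n)) (conv (deriv (f ∘ suc)) g n) c₂ (f 1) (g (suc n)) c₃ ⟩
    (1ᵍ *ᵍ f 1) *ᵍ g (suc n) +ᵍ (conv (deriv (f ∘ suc)) g n +ᵍ c₃) +ᵍ (f 0 *ᵍ deriv g (suc n) +ᵍ c₂)
      ≡⟨ cong (λ x → (1ᵍ *ᵍ f 1) *ᵍ g (suc n) +ᵍ x +ᵍ (f 0 *ᵍ deriv g (suc n) +ᵍ c₂))
           (trans (sym (conv-+ˡ (deriv (f ∘ suc)) (λ i → f (suc (suc i))) g n))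
                  (conv-cong (deriv-shift f) (λ _ → refl) n)) ⟩
    (1ᵍ *ᵍ f 1) *ᵍ g (suc n) +ᵍ conv (deriv f ∘ suc) g n +ᵍ (f 0 *ᵍ deriv g (suc n) +ᵍ c₂) ∎
    where
    open ≡-Reasoning
    N c₁ c₂ c₃ : 𝔾
    N = real (fromℕ (suc n))
    c₁ = conv (f ∘ suc) g (suc n)
    c₂ = conv (f ∘ suc) (deriv g) n
    c₃ = conv (λ i → f (suc (suc i))) g n
    open 𝔾-Solver
    eq₁ : ∀ N x y c → (1ᵍ +ᵍ N) *ᵍ (x *ᵍ y +ᵍ c) ≡ x *ᵍ ((1ᵍ +ᵍ N) *ᵍ y) +ᵍ (N *ᵍ c +ᵍ c)
    eq₁ = solve 4 (λ N x y c → (con 1ᵍ :+ N) :* (x :* y :+ c) := x :* ((con 1ᵍ :+ N) :* y) :+ (N :* c :+ c)) refl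
    eq₂ : ∀ a b c x y d → a +ᵍ ((b +ᵍ c) +ᵍ (x *ᵍ y +ᵍ d)) ≡ (1ᵍ *ᵍ x) *ᵍ y +ᵍ (b +ᵍ d) +ᵍ (a +ᵍ c)
    eq₂ = solve 6 (λ a b c x y d → a :+ ((b :+ c) :+ (x :* y :+ d)) := (con 1ᵍ :* x) :* y :+ (b :+ d) :+ (a :+ c)) refl

  -- Summation can be moved onto the second factor because multiplication by 1/(1 - x) commutes with
  -- the product of series.
  sum<-conv : ∀ f g n → sum< (conv f g) (suc n) ≡ conv f (λ j → sum< g (suc j)) n
  sum<-conv f g zero = eq (f 0) (g 0)
    where
    open 𝔾-Solver
    eq : ∀ x y → 0ᵍ +ᵍ x *ᵍ y ≡ x *ᵍ (0ᵍ +ᵍ y)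
    eq = solve 2 (λ x y → con 0ᵍ :+ x :* y := x :* (con 0ᵍ :+ y)) refl
  sum<-conv f g (suc n) = trans (cong (_+ᵍ conv f g (suc n)) (sum<-conv f g n)) (sym (step f n))
    where
    h : ℕ → 𝔾
    h j = sum< g (suc j)
    open 𝔾-Solver
    eq₁ : ∀ x x′ y y′ → x *ᵍ ((0ᵍ +ᵍ y) +ᵍ y′) +ᵍ x′ *ᵍ (0ᵍ +ᵍ y) ≡ x *ᵍ (0ᵍ +ᵍ y) +ᵍ (x *ᵍ y′ +ᵍ x′ *ᵍ y)
    eq₁ = solve 4 (λ x x′ y y′ → x :* ((con 0ᵍ :+ y) :+ y′) :+ x′ :* (con 0ᵍ :+ y)
                               := x :* (con 0ᵍ :+ y) :+ (x :* y′ :+ x′ :* y)) refl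
    eq₂ : ∀ x y y′ c d → x *ᵍ (y +ᵍ y′) +ᵍ (c +ᵍ d) ≡ (x *ᵍ y +ᵍ c) +ᵍ (x *ᵍ y′ +ᵍ d)
    eq₂ = solve 5 (λ x y y′ c d → x :* (y :+ y′) :+ (c :+ d) := (x :* y :+ c) :+ (x :* y′ :+ d)) refl
    step : ∀ f n → conv f h (suc n) ≡ conv f h n +ᵍ conv f g (suc n)
    step f zero    = eq₁ (f 0) (f 1) (g 0) (g 1)
    step f (suc n) = trans (cong (f 0 *ᵍ h (suc (suc n)) +ᵍ_) (step (f ∘ suc) n))
      (eq₂ (f 0) (h (suc n)) (g (suc (suc n))) (conv (f ∘ suc) h n) (conv (f ∘ suc) g (suc n)))

  -- Mertens' rearrangement: when `h` lists the partial sums of the second series and `H` is a late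
  -- one, the defect of the product is a convolution with tails, which are small.
  sum<-*-conv : ∀ f h H n → sum< f (suc n) *ᵍ H -ᵍ conv f h n ≡ conv f (λ j → H -ᵍ h j) n
  sum<-*-conv f h H zero = eq (f 0) H (h 0)
    where
    open 𝔾-Solver
    eq : ∀ x H y → (0ᵍ +ᵍ x) *ᵍ H -ᵍ x *ᵍ y ≡ x *ᵍ (H -ᵍ y)
    eq = solve 3 (λ x H y → (con 0ᵍ :+ x) :* H :- x :* y := x :* (H :- y)) refl
  sum<-*-conv f h H (suc n) = begin
    sum< f (suc (suc n)) *ᵍ H -ᵍ conv f h (suc n)
      ≡⟨ cong (λ s → s *ᵍ H -ᵍ conv f h (suc n)) (sum<-suc f (suc n)) ⟩
    (f 0 +ᵍ s) *ᵍ H -ᵍ (f 0 *ᵍ h (suc n) +ᵍ c)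
      ≡⟨ eq (f 0) s H (h (suc n)) c ⟩
    f 0 *ᵍ (H -ᵍ h (suc n)) +ᵍ (s *ᵍ H -ᵍ c)
      ≡⟨ cong (f 0 *ᵍ (H -ᵍ h (suc n)) +ᵍ_) (sum<-*-conv (f ∘ suc) h H n) ⟩
    conv f (λ j → H -ᵍ h j) (suc n) ∎
    where
    open ≡-Reasoning
    s c : 𝔾
    s = sum< (f ∘ suc) (suc n)
    c = conv (f ∘ suc) h n
    open 𝔾-Solver
    eq : ∀ x s H y c → (x +ᵍ s) *ᵍ H -ᵍ (x *ᵍ y +ᵍ c) ≡ x *ᵍ (H -ᵍ y) +ᵍ (s *ᵍ H -ᵍ c)
    eq = solve 5 (λ x s H y c → (x :+ s) :* H :- (x :* y :+ c) := x :* (H :- y) :+ (s :* H :- c)) refl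

  -- The exponential series with explicit remainders.

  half^ : ℕ → ℚ
  half^ zero    = 1ℚ
  half^ (suc n) = ½ * half^ n

  0≤half^ : ∀ n → 0ℚ ≤ half^ n
  0≤half^ zero    = <⇒≤ (positive⁻¹ 1ℚ)
  0≤half^ (suc n) = 0≤* (<⇒≤ (positive⁻¹ ½)) (0≤half^ n)

  -- The geometric weights of positions i and n - i multiply to 2^(-n) in every summand, so the
  -- whole convolution decays although no single factor is small throughout.
  ‖conv‖ : ∀ f g (p : ℕ → ℚ) C n →
    (∀ i → ‖ f i ‖ ≤ half^ i * p i) → (∀ j → j ℕ.≤ n → ‖ g j ‖ ≤ half^ j * C) →
    ‖ conv f g n ‖ ≤ half^ n * (sumℚ< p (suc n) * C)
  ‖conv‖ f g p C zero f≤ g≤ = begin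
    ‖ f 0 *ᵍ g 0 ‖  ≤⟨ ‖*‖ (f 0) (g 0) ⟩
    ‖ f 0 ‖ * ‖ g 0 ‖  ≤⟨ *-mono-≤ (0≤‖‖ (f 0)) (f≤ 0) (0≤‖‖ (g 0)) (g≤ 0 ℕ.z≤n) ⟩
    (1ℚ * p 0) * (1ℚ * C)  ≡⟨ eq (p 0) C ⟩
    1ℚ * ((0ℚ + p 0) * C)  ∎
    where
    open ≤-Reasoning
    eq : ∀ p C → (1ℚ * p) * (1ℚ * C) ≡ 1ℚ * ((0ℚ + p) * C)
    eq = solve 2 (λ p C → (con 1ℚ :* p) :* (con 1ℚ :* C) := con 1ℚ :* ((con 0ℚ :+ p) :* C)) refl
      where open +-*-Solver
  ‖conv‖ f g p C (suc n) f≤ g≤ = begin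
    ‖ f 0 *ᵍ g (suc n) +ᵍ conv (f ∘ suc) g n ‖
      ≤⟨ ‖+‖ (f 0 *ᵍ g (suc n)) (conv (f ∘ suc) g n) ⟩
    ‖ f 0 *ᵍ g (suc n) ‖ + ‖ conv (f ∘ suc) g n ‖
      ≤⟨ +-mono-≤
          (≤-trans (‖*‖ (f 0) (g (suc n)))
            (*-mono-≤ (0≤‖‖ (f 0)) (f≤ 0) (0≤‖‖ (g (suc n))) (g≤ (suc n) ℕ.≤-refl)))
          (‖conv‖ (f ∘ suc) g (λ i → ½ * p (suc i)) C n
            (λ i → ≤-trans (f≤ (suc i)) (≤-reflexive (eq₁ (half^ i) (p (suc i)))))
            (λ j j≤n → g≤ j (ℕ.m≤n⇒m≤1+n j≤n))) ⟩
    (1ℚ * p 0) * (½ * half^ n * C) + half^ n * (sumℚ< (λ i → ½ * p (suc i)) (suc n) * C)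
      ≡⟨ cong (λ s → (1ℚ * p 0) * (½ * half^ n * C) + half^ n * (s * C)) (sum-½ (λ i → p (suc i)) (suc n)) ⟩
    (1ℚ * p 0) * (½ * half^ n * C) + half^ n * (½ * s * C)
      ≡⟨ eq₂ (p 0) (half^ n) C s ⟩
    ½ * half^ n * ((p 0 + s) * C)
      ≡⟨ cong (λ s → ½ * half^ n * (s * C)) (sym (sumℚ<-suc p (suc n))) ⟩
    half^ (suc n) * (sumℚ< p (suc (suc n)) * C) ∎
    where
    open ≤-Reasoning
    s : ℚ
    s = sumℚ< (λ i → p (suc i)) (suc n)
    open +-*-Solver
    eq₁ : ∀ h p → ½ * h * p ≡ h * (½ * p)
    eq₁ = solve 2 (λ h p → con ½ :* h :* p := h :* (con ½ :* p)) refl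
    eq₂ : ∀ p h C s → (1ℚ * p) * (½ * h * C) + h * (½ * s * C) ≡ ½ * h * ((p + s) * C)
    eq₂ = solve 4 (λ p h C s → (con 1ℚ :* p) :* (con ½ :* h :* C) :+ h :* (con ½ :* s :* C)
                             := con ½ :* h :* ((p :+ s) :* C)) refl
    sum-½ : ∀ q n → sumℚ< (λ i → ½ * q i) n ≡ ½ * sumℚ< q n
    sum-½ q zero    = refl
    sum-½ q (suc n) = trans (cong (_+ ½ * q n) (sum-½ q n)) (sym (*-distribˡ-+ ½ (sumℚ< q n) (q n)))

  -- zⁿ / n! in the recursive form from which the differential equation of the exponential is
  -- immediate.
  term : ℕ → 𝔾 → 𝔾
  term zero    z = 1ᵍ
  term (suc n) z = real (inv (suc n)) *ᵍ (z *ᵍ term n z)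

  expo : ℕ → 𝔾 → 𝔾
  expo n z = sum< (λ k → term k z) n

  -- Bⁿ / n!.
  majorant : ℕ → ℚ → ℚ
  majorant zero    B = 1ℚ
  majorant (suc n) B = inv (suc n) * (B * majorant n B)

  0≤inv : ∀ n .{{_ : ℕ.NonZero n}} → 0ℚ ≤ inv n
  0≤inv n = <⇒≤ (0<inv n)

  0≤majorant : ∀ n {B} → 0ℚ ≤ B → 0ℚ ≤ majorant n B
  0≤majorant zero    0≤B = <⇒≤ (positive⁻¹ 1ℚ)
  0≤majorant (suc n) 0≤B = 0≤* (0≤inv (suc n)) (0≤* 0≤B (0≤majorant n 0≤B))

  ‖term‖ : ∀ n z {B} → ‖ z ‖ ≤ B → ‖ term n z ‖ ≤ majorant n B
  ‖term‖ zero    z z≤B = ≤-refl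
  ‖term‖ (suc n) z {B} z≤B = begin
    ‖ real (inv (suc n)) *ᵍ (z *ᵍ term n z) ‖  ≤⟨ ‖*‖ (real (inv (suc n))) (z *ᵍ term n z) ⟩
    ‖ real (inv (suc n)) ‖ * ‖ z *ᵍ term n z ‖  ≡⟨ cong (_* ‖ z *ᵍ term n z ‖) (trans (‖real‖ (inv (suc n))) (0≤p⇒∣p∣≡p (0≤inv (suc n)))) ⟩
    inv (suc n) * ‖ z *ᵍ term n z ‖  ≤⟨ *-monoˡ-≤-nonNeg (inv (suc n)) {{nonNegative (0≤inv (suc n))}}
                                                     (≤-trans (‖*‖ z (term n z))
                                                       (*-mono-≤ (0≤‖‖ z) z≤B (0≤‖‖ (term n z)) (‖term‖ n z z≤B))) ⟩
    inv (suc n) * (B * majorant n B)  ∎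
    where open ≤-Reasoning

  -- Trades the factorial decay for the rate 2^(-n), at the price of doubling `B` in a series that
  -- still has bounded sums.
  majorant-half : ∀ n B → majorant n B ≡ half^ n * majorant n (B + B)
  majorant-half zero    B = refl
  majorant-half (suc n) B = trans (cong (λ t → inv (suc n) * (B * t)) (majorant-half n B))
                                  (eq (inv (suc n)) B (half^ n) (majorant n (B + B)))
    where
    open +-*-Solver
    eq : ∀ i B h t → i * (B * (h * t)) ≡ ½ * h * (i * ((B + B) * t))
    eq = solve 4 (λ i B h t → i :* (B :* (h :* t)) := con ½ :* h :* (i :* ((B :+ B) :* t))) refl

  -- The ratio of consecutive terms is B / (n + 1), hence at most ½ here.
  majorant-suc : ∀ n {B} → 0ℚ ≤ B → B + B ≤ fromℕ (suc n) → majorant (suc n) B + majorant (suc n) B ≤ majorant n B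
  majorant-suc n {B} 0≤B 2B≤ = begin
    i * (B * t) + i * (B * t)  ≡⟨ eq i B t ⟩
    i * ((B + B) * t)  ≤⟨ *-monoˡ-≤-nonNeg i {{nonNegative (0≤inv (suc n))}}
                                      (*-monoʳ-≤-nonNeg t {{nonNegative (0≤majorant n 0≤B)}} 2B≤) ⟩
    i * (fromℕ (suc n) * t)  ≡⟨ *-assoc i (fromℕ (suc n)) t ⟨
    i * fromℕ (suc n) * t  ≡⟨ cong (_* t) (inv-inverse (suc n)) ⟩
    1ℚ * t  ≡⟨ *-identityˡ t ⟩
    t  ∎
    where
    i t : ℚ
    i = inv (suc n)
    t = majorant n B
    open ≤-Reasoning
    open +-*-Solver
    eq : ∀ i B t → i * (B * t) + i * (B * t) ≡ i * ((B + B) * t)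
    eq = solve 3 (λ i B t → i :* (B :* t) :+ i :* (B :* t) := i :* ((B :+ B) :* t)) refl

  -- t_k + ⋯ + t_{k+j-1} ≤ 2 t_k − 2 t_{k+j} for t = majorant, the form in which the induction on j closes.
  tail≤ : ∀ k j {B} → 0ℚ ≤ B → B + B ≤ fromℕ (suc k) →
          sumℚ< (λ i → majorant (k ℕ.+ i) B) j + (majorant (k ℕ.+ j) B + majorant (k ℕ.+ j) B)
            ≤ majorant k B + majorant k B
  tail≤ k zero    {B} 0≤B 2B≤ = ≤-reflexive (trans (+-identityˡ _)
    (cong (λ n → majorant n B + majorant n B) (ℕ.+-identityʳ k)))
  tail≤ k (suc j) {B} 0≤B 2B≤ = ≤-trans (begin
    s + t + (majorant (k ℕ.+ suc j) B + majorant (k ℕ.+ suc j) B)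
      ≡⟨ cong (λ n → s + t + (majorant n B + majorant n B)) (ℕ.+-suc k j) ⟩
    s + t + (majorant (suc (k ℕ.+ j)) B + majorant (suc (k ℕ.+ j)) B)
      ≤⟨ +-monoʳ-≤ (s + t) (majorant-suc (k ℕ.+ j) 0≤B
           (≤-trans 2B≤ (fromℕ-mono-≤ (ℕ.s≤s (ℕ.m≤m+n k j))))) ⟩
    s + t + t  ≡⟨ +-assoc s t t ⟩
    s + (t + t)  ∎)
    (tail≤ k j 0≤B 2B≤)
    where
    s t : ℚ
    s = sumℚ< (λ i → majorant (k ℕ.+ i) B) j
    t = majorant (k ℕ.+ j) B
    open ≤-Reasoning

  sumℚ<-mono : ∀ {f g} → (∀ i → f i ≤ g i) → ∀ n → sumℚ< f n ≤ sumℚ< g n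
  sumℚ<-mono f≤g zero    = ≤-refl
  sumℚ<-mono f≤g (suc n) = +-mono-≤ (sumℚ<-mono f≤g n) (f≤g n)

  sumℚ<-+ : ∀ f k j → sumℚ< f (k ℕ.+ j) ≡ sumℚ< f k + sumℚ< (λ i → f (k ℕ.+ i)) j
  sumℚ<-+ f k zero    = trans (cong (sumℚ< f) (ℕ.+-identityʳ k)) (sym (+-identityʳ (sumℚ< f k)))
  sumℚ<-+ f k (suc j) = trans (cong (sumℚ< f) (ℕ.+-suc k j))
    (trans (cong (_+ f (k ℕ.+ j)) (sumℚ<-+ f k j)) (+-assoc (sumℚ< f k) (sumℚ< (λ i → f (k ℕ.+ i)) j) (f (k ℕ.+ j))))

  0≤sumℚ< : ∀ {f} → (∀ i → 0ℚ ≤ f i) → ∀ n → 0ℚ ≤ sumℚ< f n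
  0≤sumℚ< 0≤f zero    = ≤-refl
  0≤sumℚ< 0≤f (suc n) = 0≤+ (0≤sumℚ< 0≤f n) (0≤f n)

  sum<-tail : ∀ f k j → ‖ sum< f (k ℕ.+ j) -ᵍ sum< f k ‖ ≤ sumℚ< (λ i → ‖ f (k ℕ.+ i) ‖) j
  sum<-tail f k zero    = ≤-reflexive (trans (cong (λ n → ‖ sum< f n -ᵍ sum< f k ‖) (ℕ.+-identityʳ k))
                                             (cong ‖_‖ {sum< f k -ᵍ sum< f k} {0ᵍ} (+ᵍ-inverseʳ (sum< f k))))
  sum<-tail f k (suc j) = begin
    ‖ sum< f (k ℕ.+ suc j) -ᵍ sum< f k ‖
      ≡⟨ cong (λ n → ‖ sum< f n -ᵍ sum< f k ‖) (ℕ.+-suc k j) ⟩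
    ‖ (sum< f (k ℕ.+ j) +ᵍ f (k ℕ.+ j)) -ᵍ sum< f k ‖
      ≡⟨ cong ‖_‖ (eq (sum< f (k ℕ.+ j)) (f (k ℕ.+ j)) (sum< f k)) ⟩
    ‖ (sum< f (k ℕ.+ j) -ᵍ sum< f k) +ᵍ f (k ℕ.+ j) ‖
      ≤⟨ ‖+‖ (sum< f (k ℕ.+ j) -ᵍ sum< f k) (f (k ℕ.+ j)) ⟩
    ‖ sum< f (k ℕ.+ j) -ᵍ sum< f k ‖ + ‖ f (k ℕ.+ j) ‖
      ≤⟨ +-monoˡ-≤ ‖ f (k ℕ.+ j) ‖ (sum<-tail f k j) ⟩
    sumℚ< (λ i → ‖ f (k ℕ.+ i) ‖) (suc j) ∎
    where
    open ≤-Reasoning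
    open 𝔾-Solver
    eq : ∀ x y z → (x +ᵍ y) -ᵍ z ≡ (x -ᵍ z) +ᵍ y
    eq = solve 3 (λ x y z → (x :+ y) :- z := (x :- z) :+ y) refl

  -- A remainder of twice the first omitted term, sharp enough for the numerical estimates of sine
  -- and cosine made with five and seven terms.
  expo-tail : ∀ k n z {B} → k ℕ.≤ n → ‖ z ‖ ≤ B → B + B ≤ fromℕ (suc k) →
              ‖ expo n z -ᵍ expo k z ‖ ≤ majorant k B + majorant k B
  expo-tail k n z {B} k≤n z≤B 2B≤ = begin
    ‖ expo n z -ᵍ expo k z ‖
      ≡⟨ cong (λ n → ‖ expo n z -ᵍ expo k z ‖) (ℕ.m+[n∸m]≡n k≤n) ⟨
    ‖ expo (k ℕ.+ j) z -ᵍ expo k z ‖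
      ≤⟨ sum<-tail (λ i → term i z) k j ⟩
    sumℚ< (λ i → ‖ term (k ℕ.+ i) z ‖) j
      ≤⟨ sumℚ<-mono (λ i → ‖term‖ (k ℕ.+ i) z z≤B) j ⟩
    sumℚ< (λ i → majorant (k ℕ.+ i) B) j
      ≤⟨ p≤p+q (0≤+ (0≤majorant (k ℕ.+ j) 0≤B) (0≤majorant (k ℕ.+ j) 0≤B)) ⟩
    sumℚ< (λ i → majorant (k ℕ.+ i) B) j + (majorant (k ℕ.+ j) B + majorant (k ℕ.+ j) B)
      ≤⟨ tail≤ k j 0≤B 2B≤ ⟩
    majorant k B + majorant k B ∎
    where
    open ≤-Reasoning
    j : ℕ
    j = n ℕ.∸ k
    0≤B : 0ℚ ≤ B
    0≤B = ≤-trans (0≤‖‖ z) z≤B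

  -- Stands in for e^B: past the index where 2B ≤ k + 1 the terms at least halve.
  expBound : ∀ {B} → 0ℚ ≤ B → ∃[ C ] (∀ n → sumℚ< (λ i → majorant i B) n ≤ C)
  expBound {B} 0≤B = sumℚ< t k + (t k + t k) , λ n → begin
      sumℚ< t n  ≤⟨ p≤p+q {sumℚ< t n} (0≤sumℚ< (λ i → 0≤majorant (n ℕ.+ i) 0≤B) k) ⟩
      sumℚ< t n + sumℚ< (λ i → t (n ℕ.+ i)) k  ≡⟨ sumℚ<-+ t n k ⟨
      sumℚ< t (n ℕ.+ k)  ≡⟨ cong (sumℚ< t) (ℕ.+-comm n k) ⟩
      sumℚ< t (k ℕ.+ n)  ≡⟨ sumℚ<-+ t k n ⟩
      sumℚ< t k + sumℚ< (λ i → t (k ℕ.+ i)) n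
        ≤⟨ +-monoʳ-≤ (sumℚ< t k) (≤-trans (p≤p+q (0≤+ (0≤majorant (k ℕ.+ n) 0≤B) (0≤majorant (k ℕ.+ n) 0≤B))) (tail≤ k n 0≤B 2B≤)) ⟩
      sumℚ< t k + (t k + t k)  ∎
    where
    open ≤-Reasoning
    t : ℕ → ℚ
    t i = majorant i B
    k : ℕ
    k = proj₁ (archimedean (B + B))
    2B≤ : B + B ≤ fromℕ (suc k)
    2B≤ = ≤-trans (proj₂ (archimedean (B + B))) (fromℕ-mono-≤ (ℕ.n≤1+n k))

  -- Turns geometric decay into decay of order 1/n, to which the Archimedean property applies.
  half^≤ : ∀ n → half^ n * fromℕ (suc n) ≤ 1ℚ
  half^≤ zero    = ≤-refl
  half^≤ (suc n) = begin
    ½ * half^ n * fromℕ (suc (suc n))  ≡⟨ *-assoc ½ (half^ n) (fromℕ (suc (suc n))) ⟩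
    ½ * (half^ n * fromℕ (suc (suc n)))  ≤⟨ *-monoˡ-≤-nonNeg ½ (*-monoˡ-≤-nonNeg (half^ n) {{nonNegative (0≤half^ n)}} n+2≤) ⟩
    ½ * (half^ n * (fromℕ (suc n) + fromℕ (suc n)))
                                            ≡⟨ eq (half^ n) (fromℕ (suc n)) ⟩
    half^ n * fromℕ (suc n)  ≤⟨ half^≤ n ⟩
    1ℚ  ∎
    where
    open ≤-Reasoning
    n+2≤ : fromℕ (suc (suc n)) ≤ fromℕ (suc n) + fromℕ (suc n)
    n+2≤ = ≤-trans (≤-reflexive (fromℕ-suc (suc n)))
             (+-monoˡ-≤ (fromℕ (suc n)) {1ℚ} {fromℕ (suc n)} (fromℕ-mono-≤ {1} {suc n} (ℕ.s≤s ℕ.z≤n)))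
    open +-*-Solver
    eq : ∀ h f → ½ * (h * (f + f)) ≡ h * f
    eq = solve 2 (λ h f → con ½ :* (h :* (f :+ f)) := h :* f) refl

  half^-small : ∀ C {ε} → 0ℚ < ε → ∃[ N ] (∀ n → N ℕ.≤ n → half^ n * C < ε)
  half^-small C {ε} 0<ε with shrink (½ * ε) 1ℚ (0<½p 0<ε) (positive⁻¹ 1ℚ)
  ... | δ , 0<δ , ½εδ≡1 with archimedean (C * δ)
  ...   | N , Cδ≤N = N , λ n N≤n → begin-strict
      half^ n * C  ≤⟨ *-monoˡ-≤-nonNeg (half^ n) {{nonNegative (0≤half^ n)}} (C≤ n N≤n) ⟩
      half^ n * (fromℕ (suc n) * (½ * ε))  ≡⟨ *-assoc (half^ n) (fromℕ (suc n)) (½ * ε) ⟨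
      half^ n * fromℕ (suc n) * (½ * ε)  ≤⟨ *-monoʳ-≤-nonNeg (½ * ε) {{0≤½ε}} (half^≤ n) ⟩
      1ℚ * (½ * ε)  ≡⟨ *-identityˡ (½ * ε) ⟩
      ½ * ε  <⟨ <-by (0<½p 0<ε) (½*p ε) ⟩
      ε  ∎
    where
    open ≤-Reasoning
    0≤½ε : NonNegative (½ * ε)
    0≤½ε = nonNegative (<⇒≤ (0<½p 0<ε))
    C≤ : ∀ n → N ℕ.≤ n → C ≤ fromℕ (suc n) * (½ * ε)
    C≤ n N≤n = begin
      C  ≡⟨ *-identityʳ C ⟨
      C * 1ℚ  ≡⟨ cong (C *_) (trans (*-comm δ (½ * ε)) ½εδ≡1) ⟨
      C * (δ * (½ * ε))  ≡⟨ *-assoc C δ (½ * ε) ⟨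
      C * δ * (½ * ε)  ≤⟨ *-monoʳ-≤-nonNeg (½ * ε) {{0≤½ε}} (≤-trans Cδ≤N (fromℕ-mono-≤ (ℕ.m≤n⇒m≤1+n N≤n))) ⟩
      fromℕ (suc n) * (½ * ε)  ∎

  module _ {B} (0≤B : 0ℚ ≤ B) where

    -- Taken for `B + B`, since `majorant-half` leaves a series with doubled argument.
    expSum : ℚ
    expSum = proj₁ (expBound (0≤+ 0≤B 0≤B))

    sum≤expSum : ∀ n → sumℚ< (λ i → majorant i (B + B)) n ≤ expSum
    sum≤expSum = proj₂ (expBound (0≤+ 0≤B 0≤B))

    0≤expSum : 0ℚ ≤ expSum
    0≤expSum = sum≤expSum 0

    half-tail : ∀ k j → sumℚ< (λ i → majorant (k ℕ.+ i) B) j ≤ half^ k * expSum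
    half-tail k j = begin
      sumℚ< (λ i → majorant (k ℕ.+ i) B) j
        ≤⟨ sumℚ<-mono (λ i → ≤-trans (≤-reflexive (majorant-half (k ℕ.+ i) B))
             (*-monoʳ-≤-nonNeg (majorant (k ℕ.+ i) (B + B)) {{nonNegative (0≤majorant (k ℕ.+ i) (0≤+ 0≤B 0≤B))}} (half-mono k i))) j ⟩
      sumℚ< (λ i → half^ k * majorant (k ℕ.+ i) (B + B)) j
        ≡⟨ factor (half^ k) (λ i → majorant (k ℕ.+ i) (B + B)) j ⟩
      half^ k * sumℚ< (λ i → majorant (k ℕ.+ i) (B + B)) j
        ≤⟨ *-monoˡ-≤-nonNeg (half^ k) {{nonNegative (0≤half^ k)}} (begin
           sumℚ< (λ i → majorant (k ℕ.+ i) (B + B)) j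
             ≤⟨ p≤p+q (0≤sumℚ< (λ i → 0≤majorant i (0≤+ 0≤B 0≤B)) k) ⟩
           sumℚ< (λ i → majorant (k ℕ.+ i) (B + B)) j + sumℚ< (λ i → majorant i (B + B)) k
             ≡⟨ +-comm (sumℚ< (λ i → majorant (k ℕ.+ i) (B + B)) j) _ ⟩
           sumℚ< (λ i → majorant i (B + B)) k + sumℚ< (λ i → majorant (k ℕ.+ i) (B + B)) j
             ≡⟨ sumℚ<-+ (λ i → majorant i (B + B)) k j ⟨
           sumℚ< (λ i → majorant i (B + B)) (k ℕ.+ j)
             ≤⟨ sum≤expSum (k ℕ.+ j) ⟩
           expSum ∎) ⟩
      half^ k * expSum ∎
      where
      open ≤-Reasoning
      half-mono : ∀ k i → half^ (k ℕ.+ i) ≤ half^ k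
      half-mono k zero    = ≤-reflexive (cong half^ (ℕ.+-identityʳ k))
      half-mono k (suc i) = begin
        half^ (k ℕ.+ suc i)  ≡⟨ cong half^ (ℕ.+-suc k i) ⟩
        ½ * half^ (k ℕ.+ i)
          ≤⟨ *-monoʳ-≤-nonNeg (half^ (k ℕ.+ i)) {{nonNegative (0≤half^ (k ℕ.+ i))}} {½} {1ℚ} (*≤* (ℤ.+≤+ (ℕ.s≤s ℕ.z≤n))) ⟩
        1ℚ * half^ (k ℕ.+ i)  ≡⟨ *-identityˡ (half^ (k ℕ.+ i)) ⟩
        half^ (k ℕ.+ i)  ≤⟨ half-mono k i ⟩
        half^ k  ∎
      factor : ∀ c f n → sumℚ< (λ i → c * f i) n ≡ c * sumℚ< f n
      factor c f zero    = sym (*-zeroʳ c)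
      factor c f (suc n) = trans (cong (_+ c * f n) (factor c f n)) (sym (*-distribˡ-+ c (sumℚ< f n) (f n)))

    expo-diff : ∀ k j z → ‖ z ‖ ≤ B → ‖ expo (k ℕ.+ j) z -ᵍ expo k z ‖ ≤ half^ k * expSum
    expo-diff k j z z≤B = ≤-trans (sum<-tail (λ i → term i z) k j)
      (≤-trans (sumℚ<-mono (λ i → ‖term‖ (k ℕ.+ i) z z≤B) j) (half-tail k j))

    ‖expo‖ : ∀ n z → ‖ z ‖ ≤ B → ‖ expo n z ‖ ≤ expSum
    ‖expo‖ n z z≤B = subst (_≤ expSum) (cong ‖_‖ (eq (expo n z)))
      (≤-trans (expo-diff 0 n z z≤B) (≤-reflexive (*-identityˡ expSum)))
      where
      open 𝔾-Solver
      eq : ∀ x → x -ᵍ 0ᵍ ≡ x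
      eq = solve 1 (λ x → x :- con 0ᵍ := x) refl

    -- The functional equation with an error depending only on the common bound `B`: the partial
    -- sums of the product are convolutions of the first series with partial sums of the second, and
    -- the tails of the second carry the rate.
    expo-+-bound : ∀ n z w → ‖ z ‖ ≤ B → ‖ w ‖ ≤ B →
      ‖ expo (suc n) z *ᵍ expo (suc n) w -ᵍ expo (suc n) (z +ᵍ w) ‖ ≤ half^ n * (expSum * expSum)
    expo-+-bound n z w z≤B w≤B = begin
      ‖ expo (suc n) z *ᵍ H -ᵍ expo (suc n) (z +ᵍ w) ‖
        ≡⟨ cong (λ x → ‖ expo (suc n) z *ᵍ H -ᵍ x ‖)
             (trans (sum<-cong (λ k → sym (binomial k)) (suc n)) (sum<-conv f g n)) ⟩
      ‖ expo (suc n) z *ᵍ H -ᵍ conv f (λ j → expo (suc j) w) n ‖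
        ≡⟨ cong ‖_‖ (sum<-*-conv f (λ j → expo (suc j) w) H n) ⟩
      ‖ conv f (λ j → H -ᵍ expo (suc j) w) n ‖
        ≤⟨ ‖conv‖ f _ (λ i → majorant i (B + B)) expSum n
             (λ i → ≤-trans (‖term‖ i z z≤B) (≤-reflexive (majorant-half i B)))
             (λ j j≤n → ≤-trans (subst (λ m → ‖ expo m w -ᵍ expo (suc j) w ‖ ≤ half^ (suc j) * expSum)
                                   (cong suc (ℕ.m+[n∸m]≡n j≤n)) (expo-diff (suc j) (n ℕ.∸ j) w w≤B))
                (*-monoʳ-≤-nonNeg expSum {{nonNegative 0≤expSum}} (begin
                  ½ * half^ j  ≤⟨ *-monoʳ-≤-nonNeg (half^ j) {{nonNegative (0≤half^ j)}} {½} {1ℚ} (*≤* (ℤ.+≤+ (ℕ.s≤s ℕ.z≤n))) ⟩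
                  1ℚ * half^ j  ≡⟨ *-identityˡ (half^ j) ⟩
                  half^ j  ∎))) ⟩
      half^ n * (sumℚ< (λ i → majorant i (B + B)) (suc n) * expSum)
        ≤⟨ *-monoˡ-≤-nonNeg (half^ n) {{nonNegative (0≤half^ n)}} (*-monoʳ-≤-nonNeg expSum {{nonNegative 0≤expSum}} (sum≤expSum (suc n))) ⟩
      half^ n * (expSum * expSum) ∎
      where
      open ≤-Reasoning
      f g : ℕ → 𝔾
      f i = term i z
      g i = term i w
      H : 𝔾
      H = expo (suc n) w
      binomial : ∀ k → conv f g k ≡ term k (z +ᵍ w)
      binomial k = term-+ k
        where
        deriv-term : ∀ z k → deriv (λ i → term i z) k ≡ z *ᵍ term k z
        deriv-term z k = trans (sym (*ᵍ-assoc (real (fromℕ (suc k))) (real (inv (suc k))) (z *ᵍ term k z)))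
          (trans (cong (_*ᵍ (z *ᵍ term k z)) (trans (sym (real-* (fromℕ (suc k)) (inv (suc k))))
            (cong real (trans (*-comm (fromℕ (suc k)) (inv (suc k))) (inv-inverse (suc k))))))
            (*ᵍ-identityˡ (z *ᵍ term k z)))
        term-+ : ∀ k → conv f g k ≡ term k (z +ᵍ w)
        term-+ zero    = *ᵍ-identityˡ 1ᵍ
        -- Multiplying and dividing by k + 1 turns the coefficient into a coefficient of the
        -- derivative, to which the product rule applies.
        term-+ (suc k) = ≡.begin
          conv f g (suc k)
            ≡.≡⟨ *ᵍ-identityˡ (conv f g (suc k)) ⟨
          1ᵍ *ᵍ conv f g (suc k)
            ≡.≡⟨ cong (λ q → real q *ᵍ conv f g (suc k)) (inv-inverse (suc k)) ⟨
          real (inv (suc k) * fromℕ (suc k)) *ᵍ conv f g (suc k)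
            ≡.≡⟨ cong (_*ᵍ conv f g (suc k)) (real-* (inv (suc k)) (fromℕ (suc k))) ⟩
          (real (inv (suc k)) *ᵍ real (fromℕ (suc k))) *ᵍ conv f g (suc k)
            ≡.≡⟨ *ᵍ-assoc (real (inv (suc k))) (real (fromℕ (suc k))) (conv f g (suc k)) ⟩
          real (inv (suc k)) *ᵍ deriv (conv f g) k
            ≡.≡⟨ cong (real (inv (suc k)) *ᵍ_) (≡.begin
              deriv (conv f g) k  ≡.≡⟨ product-rule f g k ⟩
              conv (deriv f) g k +ᵍ conv f (deriv g) k
                ≡.≡⟨ cong₂ _+ᵍ_ (conv-cong (deriv-term z) (λ _ → refl) k) (conv-cong (λ _ → refl) (deriv-term w) k) ⟩
              conv (λ i → z *ᵍ f i) g k +ᵍ conv f (λ i → w *ᵍ g i) k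
                ≡.≡⟨ cong₂ _+ᵍ_ (conv-scaleˡ z f g k) (conv-scaleʳ w f g k) ⟩
              z *ᵍ conv f g k +ᵍ w *ᵍ conv f g k
                ≡.≡⟨ *ᵍ-distribʳ-+ᵍ (conv f g k) z w ⟨
              (z +ᵍ w) *ᵍ conv f g k
                ≡.≡⟨ cong ((z +ᵍ w) *ᵍ_) (term-+ k) ⟩
              (z +ᵍ w) *ᵍ term k (z +ᵍ w) ≡.∎) ⟩
          term (suc k) (z +ᵍ w) ≡.∎
          where module ≡ = ≡-Reasoning

  module _ {I : Set} (F : Filter I) where

    Tends : (I → ℕ) → Set
    Tends n = ∀ N → Eventually F (λ i → N ℕ.≤ n i)

  module _ {I : Set} {F : Filter I} where

    expo-bounded : ∀ {n : I → ℕ} {z} → Bounded F z → Bounded F (λ i → expo (n i) (z i))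
    expo-bounded {n} {z} (mkBounded B 0<B z≤B) = bounded-by (expSum (<⇒≤ 0<B))
      (map F {λ i → ‖ z i ‖ ≤ B} (λ i → ‖expo‖ (<⇒≤ 0<B) (n i) (z i)) z≤B)

    -- Both sides are compared with one fixed order `N`. This exchanges the number of terms of a
    -- series with the index of the rational approximation.
    expo-index : ∀ {n m : I → ℕ} {z} → Tends F n → Tends F m → Bounded F z →
                 Approx F (λ i → expo (n i) (z i)) (λ i → expo (m i) (z i))
    expo-index {n} {m} {z} n→∞ m→∞ (mkBounded B 0<B z≤B) = mkApprox (mkNull λ ε 0<ε →
      let N , small = half^-small (expSum (<⇒≤ 0<B)) (0<½p 0<ε)
      in map₂ F {λ i → ‖ z i ‖ ≤ B × N ℕ.≤ n i} {λ i → N ℕ.≤ m i}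
          (λ i (z≤ , n≥) m≥ → estimate ε N (small N ℕ.≤-refl) (z i) z≤ n≥ m≥)
          (map₂ F {λ i → ‖ z i ‖ ≤ B} {λ i → N ℕ.≤ n i} (λ i → _,_) z≤B (n→∞ N)) (m→∞ N))
      where
      open ≤-Reasoning
      near : ∀ N n z → ‖ z ‖ ≤ B → N ℕ.≤ n → ‖ expo n z -ᵍ expo N z ‖ ≤ half^ N * expSum (<⇒≤ 0<B)
      near N n z z≤ N≤n = subst (λ k → ‖ expo k z -ᵍ expo N z ‖ ≤ half^ N * expSum (<⇒≤ 0<B)) (ℕ.m+[n∸m]≡n N≤n)
        (expo-diff (<⇒≤ 0<B) N (n ℕ.∸ N) z z≤)
      open 𝔾-Solver
      eq : ∀ x y w → x -ᵍ y ≡ (x -ᵍ w) +ᵍ (-ᵍ (y -ᵍ w))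
      eq = solve 3 (λ x y w → x :- y := (x :- w) :+ (:- (y :- w))) refl
      estimate : ∀ ε N → half^ N * expSum (<⇒≤ 0<B) < ½ * ε → ∀ {n m} z → ‖ z ‖ ≤ B → N ℕ.≤ n → N ℕ.≤ m →
              ‖ expo n z -ᵍ expo m z ‖ < ε
      estimate ε N small {n} {m} z z≤ n≥ m≥ = begin-strict
        ‖ expo n z -ᵍ expo m z ‖
          ≡⟨ cong ‖_‖ (eq (expo n z) (expo m z) (expo N z)) ⟩
        ‖ (expo n z -ᵍ expo N z) +ᵍ (-ᵍ (expo m z -ᵍ expo N z)) ‖
          ≤⟨ ‖+‖ (expo n z -ᵍ expo N z) (-ᵍ (expo m z -ᵍ expo N z)) ⟩
        ‖ expo n z -ᵍ expo N z ‖ + ‖ -ᵍ (expo m z -ᵍ expo N z) ‖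
          ≡⟨ cong (‖ expo n z -ᵍ expo N z ‖ +_) (‖-‖ (expo m z -ᵍ expo N z)) ⟩
        ‖ expo n z -ᵍ expo N z ‖ + ‖ expo m z -ᵍ expo N z ‖
          <⟨ +-mono-< (≤-<-trans (near N n z z≤ n≥) small) (≤-<-trans (near N m z z≤ m≥) small) ⟩
        ½ * ε + ½ * ε
          ≡⟨ ½*p ε ⟩
        ε ∎

    expo-+ : ∀ {n : I → ℕ} {z w} → Tends F n → Bounded F z → Bounded F w →
             Approx F (λ i → expo (n i) (z i +ᵍ w i)) (λ i → expo (n i) (z i) *ᵍ expo (n i) (w i))
    expo-+ {n} {z} {w} n→∞ (mkBounded B 0<B z≤B) (mkBounded B′ 0<B′ w≤B′) = ≈-sym (mkApprox (mkNull λ ε 0<ε →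
      let N , small = half^-small (expSum 0≤D * expSum 0≤D) 0<ε
      in map₂ F {λ i → ‖ z i ‖ ≤ B × ‖ w i ‖ ≤ B′} {λ i → suc N ℕ.≤ n i}
          (λ i (z≤ , w≤) n≥ → estimate ε N small (z i) (w i) z≤ w≤ n≥)
          (map₂ F {λ i → ‖ z i ‖ ≤ B} {λ i → ‖ w i ‖ ≤ B′} (λ i → _,_) z≤B w≤B′) (n→∞ (suc N))))
      where
      D : ℚ
      D = B + B′
      0≤D : 0ℚ ≤ D
      0≤D = 0≤+ (<⇒≤ 0<B) (<⇒≤ 0<B′)
      estimate : ∀ ε N → (∀ n → N ℕ.≤ n → half^ n * (expSum 0≤D * expSum 0≤D) < ε) → ∀ {n} z w → ‖ z ‖ ≤ B → ‖ w ‖ ≤ B′ → suc N ℕ.≤ n →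
              ‖ expo n z *ᵍ expo n w -ᵍ expo n (z +ᵍ w) ‖ < ε
      estimate ε N small {suc n} z w z≤ w≤ (ℕ.s≤s n≥) = ≤-<-trans
        (expo-+-bound 0≤D n z w (≤-trans z≤ (p≤p+q (<⇒≤ 0<B′)))
          (≤-trans w≤ (≤-trans (p≤p+q {B′} (<⇒≤ 0<B)) (≤-reflexive (+-comm B′ B)))))
        (small n n≥)

    expo-0 : ∀ {n : I → ℕ} {h} → Tends F n → Null F h → Approx F (λ i → expo (n i) (h i)) (λ _ → 1ᵍ)
    expo-0 {n} {h} n→∞ h→0 = mkApprox (mkNull λ ε 0<ε →
      map₂ F {λ i → ‖ h i ‖ < 1ℚ × ‖ h i ‖ < ½ * ε} {λ i → 1 ℕ.≤ n i}
        (λ i (h<1 , h<ε) n≥1 → estimate ε (h i) n≥1 h<1 h<ε)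
        (map₂ F {λ i → ‖ h i ‖ < 1ℚ} {λ i → ‖ h i ‖ < ½ * ε} (λ i → _,_)
          (eventually-< h→0 1ℚ (positive⁻¹ 1ℚ)) (eventually-< h→0 (½ * ε) (0<½p 0<ε))) (n→∞ 1))
      where
      open ≤-Reasoning
      estimate : ∀ ε {n} h → 1 ℕ.≤ n → ‖ h ‖ < 1ℚ → ‖ h ‖ < ½ * ε → ‖ expo n h -ᵍ 1ᵍ ‖ < ε
      estimate ε {n} h 1≤n h<1 h<ε = begin-strict
        ‖ expo n h -ᵍ 1ᵍ ‖  ≡⟨ cong (λ z → ‖ expo n h -ᵍ z ‖) (+ᵍ-identityˡ 1ᵍ) ⟨
        ‖ expo n h -ᵍ expo 1 h ‖  ≤⟨ expo-tail 1 n h 1≤n ≤-refl (+-mono-≤ (<⇒≤ h<1) (<⇒≤ h<1)) ⟩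
        majorant 1 ‖ h ‖ + majorant 1 ‖ h ‖  ≡⟨ cong₂ _+_ (eq ‖ h ‖) (eq ‖ h ‖) ⟩
        ‖ h ‖ + ‖ h ‖  <⟨ +-mono-< h<ε h<ε ⟩
        ½ * ε + ½ * ε  ≡⟨ ½*p ε ⟩
        ε  ∎
        where
        eq : ∀ b → 1ℚ * (b * 1ℚ) ≡ b
        eq b = trans (*-identityˡ (b * 1ℚ)) (*-identityʳ b)

    null-bounded : ∀ {h : I → 𝔾} → Null F h → Bounded F h
    null-bounded {h} h→0 = bounded-by 1ℚ (map F {λ i → ‖ h i ‖ < 1ℚ} (λ i → <⇒≤) (eventually-< h→0 1ℚ (positive⁻¹ 1ℚ)))

    -- Continuity everywhere follows from continuity at 0, since exp z = exp w · exp (z - w).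
    expo-cong : ∀ {n : I → ℕ} {z w} → Tends F n → Bounded F w → Approx F z w →
                Approx F (λ i → expo (n i) (z i)) (λ i → expo (n i) (w i))
    expo-cong {n} {z} {w} n→∞ bw z≈w = 
      ≈-trans (≈-reflexive (λ i → cong (expo (n i)) (eq₁ (z i) (w i))))
      (≈-trans (expo-+ n→∞ bw (null-bounded (null z≈w)))
      (≈-trans (≈-* (expo-bounded {n = n} bw) (bounded-const 1ᵍ) ≈-refl (expo-0 n→∞ (null z≈w)))
        (≈-reflexive (λ i → *ᵍ-identityʳ (expo (n i) (w i))))))
      where
      open 𝔾-Solver
      eq₁ : ∀ z w → z ≡ w +ᵍ (z -ᵍ w)
      eq₁ = solve 2 (λ z w → z := w :+ (z :- w)) refl

  open RawSemiringDefs ℝ-rawSemiring using () renaming (_^_ to _^ℝ_)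

  -- Real and complex limits as approximations along filters.

  Seq : Filter ℕ
  Seq = record
    { Eventually = λ P → ∃[ N ] (∀ n → N ℕ.≤ n → P n)
    ; always = λ p → 0 , λ n _ → p n
    ; map₂ = λ f (M , p) (N , q) → M ℕ.⊔ N , λ n le →
        f n (p n (ℕ.m⊔n≤o⇒m≤o M N le)) (q n (ℕ.m⊔n≤o⇒n≤o M N le)) }

  Joint : Filter (ℕ × ℕ)
  Joint = record
    { Eventually = λ P → ∃[ N ] (∀ mn → N ℕ.≤ proj₁ mn × N ℕ.≤ proj₂ mn → P mn)
    ; always = λ p → 0 , λ n _ → p n
    ; map₂ = λ f (M , p) (N , q) → M ℕ.⊔ N , λ mn (le , le′) →
        f mn (p mn (ℕ.m⊔n≤o⇒m≤o M N le , ℕ.m⊔n≤o⇒m≤o M N le′))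
             (q mn (ℕ.m⊔n≤o⇒n≤o M N le , ℕ.m⊔n≤o⇒n≤o M N le′)) }

  -- For large n, and then for m large depending on n: the quantifier order of IsExp and IsSin,
  -- where n counts terms of the series and m is the index of the approximating rationals.
  Iterated : Filter (ℕ × ℕ)
  Iterated = record
    { Eventually = λ P → ∃[ N ] (∀ n → N ℕ.≤ n → ∃[ M ] (∀ m → M ℕ.≤ m → P (n , m)))
    ; always = λ p → 0 , λ n _ → 0 , λ m _ → p (n , m)
    ; map₂ = λ f (M , p) (N , q) → M ℕ.⊔ N , λ n le →
        let (M′ , p′) = p n (ℕ.m⊔n≤o⇒m≤o M N le)
            (N′ , q′) = q n (ℕ.m⊔n≤o⇒n≤o M N le)
        in M′ ℕ.⊔ N′ , λ m le′ → f (n , m) (p′ m (ℕ.m⊔n≤o⇒m≤o M′ N′ le′)) (q′ m (ℕ.m⊔n≤o⇒n≤o M′ N′ le′)) }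

  record Finer {I J : Set} (F : Filter I) (G : Filter J) (π : J → I) : Set₁ where
    constructor mkFiner
    field pull : ∀ (P : I → Set) → Eventually F P → Eventually G (P ∘ π)

  open Finer

  module _ {I J : Set} {F : Filter I} {G : Filter J} {π : J → I} (f : Finer F G π) where

    pull-null : ∀ {u} → Null F u → Null G (u ∘ π)
    pull-null {u} (mkNull u→0) = mkNull λ ε 0<ε → pull f (λ i → ‖ u i ‖ < ε) (u→0 ε 0<ε)

    pull-≈ : ∀ {u v} → Approx F u v → Approx G (u ∘ π) (v ∘ π)
    pull-≈ (mkApprox u≈v) = mkApprox (pull-null u≈v)

    pull-bounded : ∀ {u} → Bounded F u → Bounded G (u ∘ π)
    pull-bounded {u} (mkBounded B 0<B u≤B) = mkBounded B 0<B (pull f (λ i → ‖ u i ‖ ≤ B) u≤B)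

  joint₁ : Finer Seq Joint proj₁
  joint₁ = mkFiner λ P (N , p) → N , λ (m , n) (le , _) → p m le

  joint₂ : Finer Seq Joint proj₂
  joint₂ = mkFiner λ P (N , p) → N , λ (m , n) (_ , le) → p n le

  iterated₁ : Finer Seq Iterated proj₁
  iterated₁ = mkFiner λ P (N , p) → N , λ n le → 0 , λ m _ → p n le

  iterated₂ : Finer Seq Iterated proj₂
  iterated₂ = mkFiner λ P (M , p) → 0 , λ n _ → M , p

  tends-id : Tends Seq (λ n → n)
  tends-id N = N , λ n le → le

  pull-tends : ∀ {J : Set} {G : Filter J} {π : J → ℕ} → Finer Seq G π → Tends G π
  pull-tends f N = pull f (N ℕ.≤_) (tends-id N)

  -- The first index does not occur in `u`, so one sufficiently large value of it is enough.
  null-iterated₂ : ∀ {u : ℕ → 𝔾} → Null Iterated (u ∘ proj₂) → Null Seq u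
  null-iterated₂ (mkNull u→0) = mkNull λ ε 0<ε → let N , p = u→0 ε 0<ε in p N ℕ.≤-refl

  ≈-iterated₂ : ∀ {u v : ℕ → 𝔾} → Approx Iterated (u ∘ proj₂) (v ∘ proj₂) → Approx Seq u v
  ≈-iterated₂ {u} {v} (mkApprox p) = mkApprox (null-iterated₂ {λ m → u m -ᵍ v m} p)

  at : ℂ → ℕ → 𝔾
  at z m = seq (re z) m ,ᵍ seq (im z) m

  at-≃⇒≈ : ∀ {z w} → z ≃ℂ w → Approx Seq (at z) (at w)
  at-≃⇒≈ {z} {w} (p , q) = mkApprox (mkNull λ ε 0<ε →
    let M , p′ = p (½ * ε) (0<½p 0<ε)
        N , q′ = q (½ * ε) (0<½p 0<ε)
    in M ℕ.⊔ N , λ n le → subst (_ <_) (½*p ε)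
        (+-mono-< (p′ n (ℕ.m⊔n≤o⇒m≤o M N le)) (q′ n (ℕ.m⊔n≤o⇒n≤o M N le))))

  ≈⇒at-≃ : ∀ {z w} → Approx Seq (at z) (at w) → z ≃ℂ w
  ≈⇒at-≃ {z} {w} (mkApprox (mkNull p)) =
    (λ ε 0<ε → let N , p′ = p ε 0<ε in N , λ n le → ≤-<-trans (∣Re∣≤‖‖ (at z n -ᵍ at w n)) (p′ n le)) ,
    (λ ε 0<ε → let N , p′ = p ε 0<ε in N , λ n le → ≤-<-trans (∣Im∣≤‖‖ (at z n -ᵍ at w n)) (p′ n le))

  real-bounded : ∀ x → Bounded Seq (λ m → real (seq x m))
  real-bounded x with bounded (cauchy x)
  ... | B , 0<B , N , ≤B = mkBounded B 0<B (N , λ n le → subst (_≤ B) (sym (‖real‖ (seq x n))) (≤B n le))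

  imag-bounded : ∀ x → Bounded Seq (λ m → imag (seq x m))
  imag-bounded x with bounded (cauchy x)
  ... | B , 0<B , N , ≤B = mkBounded B 0<B (N , λ n le → subst (_≤ B) (sym (‖imag‖ (seq x n))) (≤B n le))

  at-bounded : ∀ z → Bounded Seq (at z)
  at-bounded z with bounded {seq (re z)} (cauchy (re z)) | bounded {seq (im z)} (cauchy (im z))
  ... | B , 0<B , M , ≤B | B′ , 0<B′ , N , ≤B′ = mkBounded (B + B′) (+-mono-< {0ℚ} {B} {0ℚ} 0<B 0<B′)
    (M ℕ.⊔ N , λ n le → +-mono-≤ (≤B n (ℕ.m⊔n≤o⇒m≤o M N le)) (≤B′ n (ℕ.m⊔n≤o⇒n≤o M N le)))

  fromSeq : (u : ℕ → 𝔾) → Approx Joint (u ∘ proj₁) (u ∘ proj₂) → ℂ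
  fromSeq u (mkApprox (mkNull c)) =
    mkℝ (Re ∘ u) (λ ε 0<ε → let N , c′ = c ε 0<ε in N , λ m n N≤m N≤n →
      ≤-<-trans (subst (λ p → ∣ p ∣ ≤ ‖ u m -ᵍ u n ‖) (Re-- (u m) (u n)) (∣Re∣≤‖‖ (u m -ᵍ u n))) (c′ (m , n) (N≤m , N≤n))) +i
    mkℝ (Im ∘ u) (λ ε 0<ε → let N , c′ = c ε 0<ε in N , λ m n N≤m N≤n →
      ≤-<-trans (subst (λ p → ∣ p ∣ ≤ ‖ u m -ᵍ u n ‖) (Im-- (u m) (u n)) (∣Im∣≤‖‖ (u m -ᵍ u n))) (c′ (m , n) (N≤m , N≤n)))
    where
    Re-- : ∀ z w → Re (z -ᵍ w) ≡ Re z - Re w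
    Re-- (a ,ᵍ b) (c ,ᵍ d) = refl
    Im-- : ∀ z w → Im (z -ᵍ w) ≡ Im z - Im w
    Im-- (a ,ᵍ b) (c ,ᵍ d) = refl

  at-fromSeq : ∀ u c n → at (fromSeq u c) n ≡ u n
  at-fromSeq u (mkApprox (mkNull c)) n with u n
  ... | a ,ᵍ b = refl

  -- Each strict inequality between reals holds with a rational margin from some approximation index
  -- on, and that index depends on the term of the sequence; hence the iterated filter.
  ⟶ℝ⇒≈ : ∀ {s L} → s ⟶ℝ L → Approx Iterated (λ (n , m) → real (seq (s n) m)) (λ (n , m) → real (seq L m))
  ⟶ℝ⇒≈ {s} {L} s→L = mkApprox (mkNull λ ε 0<ε →
    let N , p = s→L ε 0<ε in N , λ n N≤n →
    let (δ , 0<δ , M , lo) , (δ′ , 0<δ′ , M′ , hi) = p n N≤n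
    in M ℕ.⊔ M′ , λ m le → subst (_< ε) (sym (‖real‖ (seq (s n) m - seq L m)))
      (estimate ε δ δ′ (seq L m) (seq (s n) m) 0<δ 0<δ′
        (lo m (ℕ.m⊔n≤o⇒m≤o M M′ le)) (hi m (ℕ.m⊔n≤o⇒n≤o M M′ le))))
    where
    open +-*-Solver
    estimate : ∀ ε δ δ′ l x → 0ℚ < δ → 0ℚ < δ′ → l - ε + δ ≤ x → x + δ′ ≤ l + ε → ∣ x - l ∣ < ε
    estimate ε δ δ′ l x 0<δ 0<δ′ lo hi with ∣p∣≡p∨∣p∣≡-p (x - l)
    ... | inj₁ eq = subst (_< ε) (sym eq) (<-by (+-mono-≤-< {0ℚ} {_} {0ℚ} (p≤q⇒0≤q-p hi) 0<δ′)
      (solve 4 (λ x l e d → (x :- l) :+ ((l :+ e) :- (x :+ d) :+ d) := e) refl x l ε δ′))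
    ... | inj₂ eq = subst (_< ε) (sym eq) (<-by (+-mono-≤-< {0ℚ} {_} {0ℚ} (p≤q⇒0≤q-p lo) 0<δ)
      (solve 4 (λ x l e d → :- (x :- l) :+ (x :- (l :- e :+ d) :+ d) := e) refl x l ε δ))

  ≈⇒⟶ℝ : ∀ {s L} → Approx Iterated (λ (n , m) → real (seq (s n) m)) (λ (n , m) → real (seq L m)) → s ⟶ℝ L
  ≈⇒⟶ℝ {s} {L} (mkApprox (mkNull p)) ε 0<ε =
    let N , p′ = p (½ * ε) (0<½p 0<ε) in N , λ n N≤n →
    let M , p″ = p′ n N≤n
        close m le = <⇒≤ (subst (_< ½ * ε) (‖real‖ (seq (s n) m - seq L m)) (p″ m le))
    -- One half of ε bounds the error, the other half is the margin demanded by `_<ℝ_`.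
    in (½ * ε , 0<½p 0<ε , M , λ m le → lower (seq L m) (seq (s n) m) (close m le))
     , (½ * ε , 0<½p 0<ε , M , λ m le → upper (seq L m) (seq (s n) m) (close m le))
    where
    open +-*-Solver
    lower : ∀ l x → ∣ x - l ∣ ≤ ½ * ε → l - ε + ½ * ε ≤ x
    lower l x le = ≤-by (p≤q⇒0≤q-p (≤-trans (-p≤∣p∣ (x - l)) le))
      (solve 3 (λ l x e → l :- e :+ con ½ :* e :+ (con ½ :* e :- :- (x :- l)) := x) refl l x ε)
    upper : ∀ l x → ∣ x - l ∣ ≤ ½ * ε → x + ½ * ε ≤ l + ε
    upper l x le = ≤-by (p≤q⇒0≤q-p (≤-trans (p≤∣p∣ (x - l)) le))
      (solve 3 (λ l x e → x :+ con ½ :* e :+ (con ½ :* e :- (x :- l)) := l :+ e) refl l x ε)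

  ⟶ℂ⇒≈ : ∀ {s L} → s ⟶ℂ L → Approx Iterated (λ (n , m) → at (s n) m) (λ (n , m) → at L m)
  ⟶ℂ⇒≈ {s} {L} (p , q) = ≈-trans (≈-reflexive (λ (n , m) → decompose (at (s n) m)))
    (≈-trans (≈-+ (⟶ℝ⇒≈ {λ n → re (s n)} {re L} p)
      (≈-* (bounded-const (imag 1ℚ)) (pull-bounded iterated₂ (real-bounded (im L))) ≈-refl (⟶ℝ⇒≈ {λ n → im (s n)} {im L} q)))
      (≈-reflexive (λ (n , m) → sym (decompose (at L m)))))
    where
    open +-*-Solver
    decompose : ∀ z → z ≡ real (Re z) +ᵍ imag 1ℚ *ᵍ real (Im z)
    decompose (a ,ᵍ b) = cong₂ _,ᵍ_
      (solve 2 (λ a b → a := a :+ (con 0ℚ :* b :- con 1ℚ :* con 0ℚ)) refl a b)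
      (solve 2 (λ a b → b := con 0ℚ :+ (con 0ℚ :* con 0ℚ :+ con 1ℚ :* b)) refl a b)

  ≈⇒⟶ℂ : ∀ {s L} → Approx Iterated (λ (n , m) → at (s n) m) (λ (n , m) → at L m) → s ⟶ℂ L
  ≈⇒⟶ℂ {s} {L} (mkApprox p) =
    ≈⇒⟶ℝ {λ n → re (s n)} {re L} (mkApprox (null-by (always Iterated (λ (n , m) →
      ≤-trans (≤-reflexive (‖real‖ (seq (re (s n)) m - seq (re L) m))) (∣Re∣≤‖‖ (at (s n) m -ᵍ at L m)))) p)) ,
    ≈⇒⟶ℝ {λ n → im (s n)} {im L} (mkApprox (null-by (always Iterated (λ (n , m) →
      ≤-trans (≤-reflexive (‖real‖ (seq (im (s n)) m - seq (im L) m))) (∣Im∣≤‖‖ (at (s n) m -ᵍ at L m)))) p))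

  -- The exponential on the imaginary axis

  -- The diagonal representative of e^{ix}: `m` is at once the number of terms and the index of the
  -- approximation to x.
  cis : (ℕ → ℚ) → ℕ → 𝔾
  cis x m = expo m (imag (x m))

  conj : 𝔾 → 𝔾
  conj (a ,ᵍ b) = a ,ᵍ - b

  imag-+ : ∀ p q → imag (p + q) ≡ imag p +ᵍ imag q
  imag-+ p q = refl

  module _ {x y : ℕ → ℚ} (bx : Bounded Seq (imag ∘ x)) (by : Bounded Seq (imag ∘ y)) where

    cis-+ : Approx Seq (cis (λ m → x m + y m)) (λ m → cis x m *ᵍ cis y m)
    cis-+ = ≈-trans (≈-reflexive λ m → cong (expo m) (imag-+ (x m) (y m))) (expo-+ tends-id bx by)

  cis-bounded : ∀ {x} → Bounded Seq (imag ∘ x) → Bounded Seq (cis x)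
  cis-bounded = expo-bounded {n = λ m → m}

  cis-null : ∀ {x} → Null Seq (imag ∘ x) → Approx Seq (cis x) (λ _ → 1ᵍ)
  cis-null = expo-0 tends-id

  conj-+ : ∀ z w → conj (z +ᵍ w) ≡ conj z +ᵍ conj w
  conj-+ (a ,ᵍ b) (c ,ᵍ d) = cong (a + c ,ᵍ_) (neg-distrib-+ b d)

  conj-* : ∀ z w → conj (z *ᵍ w) ≡ conj z *ᵍ conj w
  conj-* (a ,ᵍ b) (c ,ᵍ d) = cong₂ _,ᵍ_
    (solve 4 (λ a b c d → a :* c :- b :* d := a :* c :- (:- b) :* (:- d)) refl a b c d)
    (solve 4 (λ a b c d → :- (a :* d :+ b :* c) := a :* (:- d) :+ (:- b) :* c) refl a b c d)
    where open +-*-Solver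

  expo-conj : ∀ n q → expo n (imag (- q)) ≡ conj (expo n (imag q))
  expo-conj zero    q = refl
  expo-conj (suc n) q = trans (cong₂ _+ᵍ_ (expo-conj n q) (term-conj n)) (sym (conj-+ (expo n (imag q)) (term n (imag q))))
    where
    term-conj : ∀ n → term n (imag (- q)) ≡ conj (term n (imag q))
    term-conj zero    = refl
    term-conj (suc n) = trans (cong (λ t → real (inv (suc n)) *ᵍ (conj (imag q) *ᵍ t)) (term-conj n))
      (sym (trans (conj-* (real (inv (suc n))) (imag q *ᵍ term n (imag q)))
        (cong (real (inv (suc n)) *ᵍ_) (conj-* (imag q) (term n (imag q))))))

  imag-neg-bounded : ∀ {x : ℕ → ℚ} → Bounded Seq (imag ∘ x) → Bounded Seq (λ m → imag (- x m))
  imag-neg-bounded {x} (mkBounded B 0<B x≤B) =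
    mkBounded B 0<B (map Seq {λ m → ‖ imag (x m) ‖ ≤ B} (λ m → ≤-trans (≤-reflexive (‖-‖ (imag (x m))))) x≤B)

  cis-neg : ∀ {x} → Bounded Seq (imag ∘ x) → Approx Seq (λ m → cis x m *ᵍ cis (λ m → - x m) m) (λ _ → 1ᵍ)
  cis-neg {x} bx = ≈-trans (≈-sym (cis-+ bx (imag-neg-bounded bx)))
    (cis-null (null-≗ (λ m → cong imag (+-inverseʳ (x m))) null-0))

  -- cos² + sin² = 1, read off from e^{ix} e^(-ix) = 1 because the coefficients of the series are
  -- real.
  cis-conj : ∀ {x} → Bounded Seq (imag ∘ x) → Approx Seq (λ m → cis x m *ᵍ conj (cis x m)) (λ _ → 1ᵍ)
  cis-conj {x} bx = ≈-trans (≈-reflexive λ m → cong (cis x m *ᵍ_) (sym (expo-conj m (x m)))) (cis-neg bx)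

  -- The diagonal is handled by changing the order at a fixed argument, then the argument at a fixed
  -- order.
  cis-cauchy : ∀ x → Approx Joint (cis (seq x) ∘ proj₁) (cis (seq x) ∘ proj₂)
  cis-cauchy x = ≈-trans
    (expo-index (pull-tends joint₁) (pull-tends joint₂) (pull-bounded joint₁ (imag-bounded x)))
    (expo-cong (pull-tends joint₂) (pull-bounded joint₂ (imag-bounded x)) (mkApprox (mkNull λ ε 0<ε →
      let N , c = cauchy x ε 0<ε in N , λ (m , n) (N≤m , N≤n) →
        subst (_< ε) (sym (‖imag‖ (seq x m - seq x n))) (c m n N≤m N≤n))))

  cisℂ : ℝ → ℂ
  cisℂ x = fromSeq (cis (seq x)) (cis-cauchy x)

  at-cisℂ : ∀ x m → at (cisℂ x) m ≡ cis (seq x) m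
  at-cisℂ x m = at-fromSeq (cis (seq x)) (cis-cauchy x) m

  -- The sine series is the imaginary part of the exponential series.

  inv-* : ∀ m n .{{_ : ℕ.NonZero m}} .{{_ : ℕ.NonZero n}} .{{_ : ℕ.NonZero (m ℕ.* n)}} → inv (m ℕ.* n) ≡ inv m * inv n
  inv-* m n = begin
    inv (m ℕ.* n)  ≡⟨ *-identityʳ (inv (m ℕ.* n)) ⟨
    inv (m ℕ.* n) * (1ℚ * 1ℚ)  ≡⟨ cong₂ (λ p q → inv (m ℕ.* n) * (p * q)) (inv-inverse m) (inv-inverse n) ⟨
    inv (m ℕ.* n) * (inv m * fromℕ m * (inv n * fromℕ n))  ≡⟨ eq (inv (m ℕ.* n)) (inv m) (fromℕ m) (inv n) (fromℕ n) ⟩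
    inv (m ℕ.* n) * (fromℕ m * fromℕ n) * (inv m * inv n)
      ≡⟨ cong (λ p → inv (m ℕ.* n) * p * (inv m * inv n)) (trans (cong fromℤ (ℤ.pos-* m n)) (fromℤ-* (ℤ.+ m) (ℤ.+ n))) ⟨
    inv (m ℕ.* n) * fromℕ (m ℕ.* n) * (inv m * inv n)  ≡⟨ cong (_* (inv m * inv n)) (inv-inverse (m ℕ.* n)) ⟩
    1ℚ * (inv m * inv n)  ≡⟨ *-identityˡ (inv m * inv n) ⟩
    inv m * inv n  ∎
    where
    open ≡-Reasoning
    open +-*-Solver
    eq : ∀ k a b c d → k * (a * b * (c * d)) ≡ k * (b * d) * (a * c)
    eq = solve 5 (λ k a b c d → k :* (a :* b :* (c :* d)) := k :* (b :* d) :* (a :* c)) refl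

  inv! : ℕ → ℚ
  inv! k = inv (k !) {{k ℕ.!≢0}}

  inv!-suc : ∀ k → inv! (suc k) ≡ inv (suc k) * inv! k
  inv!-suc k = inv-* (suc k) (k !) {{_}} {{k ℕ.!≢0}} {{suc k ℕ.!≢0}}

  powᵍ : 𝔾 → ℕ → 𝔾
  powᵍ z zero    = 1ᵍ
  powᵍ z (suc k) = z *ᵍ powᵍ z k

  term-pow : ∀ k z → term k z ≡ real (inv! k) *ᵍ powᵍ z k
  term-pow zero    z = refl
  term-pow (suc k) z = begin
    real (inv (suc k)) *ᵍ (z *ᵍ term k z)  ≡⟨ cong (λ t → real (inv (suc k)) *ᵍ (z *ᵍ t)) (term-pow k z) ⟩
    real (inv (suc k)) *ᵍ (z *ᵍ (real (inv! k) *ᵍ powᵍ z k))  ≡⟨ eq (real (inv (suc k))) z (real (inv! k)) (powᵍ z k) ⟩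
    (real (inv (suc k)) *ᵍ real (inv! k)) *ᵍ (z *ᵍ powᵍ z k)
      ≡⟨ cong (_*ᵍ (z *ᵍ powᵍ z k)) (trans (cong real (inv!-suc k)) (real-* (inv (suc k)) (inv! k))) ⟨
    real (inv! (suc k)) *ᵍ (z *ᵍ powᵍ z k)  ∎
    where
    open ≡-Reasoning
    open 𝔾-Solver
    eq : ∀ a z b w → a *ᵍ (z *ᵍ (b *ᵍ w)) ≡ (a *ᵍ b) *ᵍ (z *ᵍ w)
    eq = solve 4 (λ a z b w → a :* (z :* (b :* w)) := (a :* b) :* (z :* w)) refl

  sinTerm : ℝ → ℕ → ℝ
  sinTerm x k = ((-ℝ 1ℝ) ^ℝ k) *ℝ (1/ suc (2 ℕ.* k) !) *ℝ (x ^ℝ suc (2 ℕ.* k))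

  -- Among the first 2n terms the n even ones are real and the n odd ones are purely imaginary, so
  -- the identity holds exactly at every index.
  Im-expo : ∀ x n m → Im (expo (2 ℕ.* n) (imag (seq x m))) ≡ seq (Real.partialSum (sinTerm x) n) m
  Im-expo x zero    m = refl
  Im-expo x (suc n) m = begin
    Im (expo (2 ℕ.* suc n) z)
      ≡⟨ cong (λ k → Im (expo k z)) (ℕ.*-suc 2 n) ⟩
    Im ((expo (2 ℕ.* n) z +ᵍ term (2 ℕ.* n) z) +ᵍ term (suc (2 ℕ.* n)) z)
      ≡⟨ trans (Im-+ (expo (2 ℕ.* n) z +ᵍ term (2 ℕ.* n) z) (term (suc (2 ℕ.* n)) z))
               (cong (_+ Im (term (suc (2 ℕ.* n)) z)) (Im-+ (expo (2 ℕ.* n) z) (term (2 ℕ.* n) z))) ⟩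
    Im (expo (2 ℕ.* n) z) + Im (term (2 ℕ.* n) z) + Im (term (suc (2 ℕ.* n)) z)
      ≡⟨ cong₂ _+_ (cong₂ _+_ (Im-expo x n m) even) odd ⟩
    seq (Real.partialSum (sinTerm x) n) m + 0ℚ + seq (sinTerm x n) m
      ≡⟨ cong (_+ seq (sinTerm x n) m) (+-identityʳ (seq (Real.partialSum (sinTerm x) n) m)) ⟩
    seq (Real.partialSum (sinTerm x) (suc n)) m ∎
    where
    open ≡-Reasoning
    q : ℚ
    q = seq x m
    z : 𝔾
    z = imag q
    Im-+ : ∀ z w → Im (z +ᵍ w) ≡ Im z + Im w
    Im-+ (a ,ᵍ b) (c ,ᵍ d) = refl
    sgn pow : ℕ → ℚ
    sgn k = seq ((-ℝ 1ℝ) ^ℝ k) m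
    pow k = seq (x ^ℝ k) m
    powᵍ-even : ∀ n → powᵍ z (2 ℕ.* n) ≡ real (sgn n * pow (2 ℕ.* n))
    powᵍ-even zero    = refl
    powᵍ-even (suc n) = trans (cong (powᵍ z) (ℕ.*-suc 2 n))
      (trans (cong (λ w → z *ᵍ (z *ᵍ w)) (powᵍ-even n))
      (trans (eq q (sgn n) (pow (2 ℕ.* n)))
        (cong (λ k → real (sgn (suc n) * pow k)) (sym (ℕ.*-suc 2 n)))))
      where
      open +-*-Solver
      eq : ∀ q s p → imag q *ᵍ (imag q *ᵍ real (s * p)) ≡ real ((- 1ℚ) * s * (q * (q * p)))
      eq q s p = cong₂ _,ᵍ_
        (solve 3 (λ q s p → con 0ℚ :* (con 0ℚ :* (s :* p) :- q :* con 0ℚ) :- q :* (con 0ℚ :* con 0ℚ :+ q :* (s :* p))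
                          := (con (- 1ℚ)) :* s :* (q :* (q :* p))) refl q s p)
        (solve 3 (λ q s p → con 0ℚ :* (con 0ℚ :* con 0ℚ :+ q :* (s :* p)) :+ q :* (con 0ℚ :* (s :* p) :- q :* con 0ℚ)
                          := con 0ℚ) refl q s p)
    even : Im (term (2 ℕ.* n) z) ≡ 0ℚ
    even = trans (cong Im (trans (term-pow (2 ℕ.* n) z) (cong (real (inv! (2 ℕ.* n)) *ᵍ_) (powᵍ-even n))))
      (solve 2 (λ a b → a :* con 0ℚ :+ con 0ℚ :* b := con 0ℚ) refl (inv! (2 ℕ.* n)) (sgn n * pow (2 ℕ.* n)))
      where open +-*-Solver
    odd : Im (term (suc (2 ℕ.* n)) z) ≡ seq (sinTerm x n) m
    odd = trans (cong Im (trans (term-pow (suc (2 ℕ.* n)) z) (cong (λ w → real (inv! (suc (2 ℕ.* n))) *ᵍ (z *ᵍ w)) (powᵍ-even n))))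
      (solve 4 (λ a q s p → a :* (con 0ℚ :* con 0ℚ :+ q :* (s :* p)) :+ con 0ℚ :* (con 0ℚ :* (s :* p) :- q :* con 0ℚ)
                          := s :* a :* (q :* p)) refl (inv! (suc (2 ℕ.* n))) q (sgn n) (pow (2 ℕ.* n)))
      where open +-*-Solver

  tends-double : Tends Iterated (λ (n , m) → 2 ℕ.* n)
  tends-double N = N , λ n N≤n → 0 , λ m _ → ℕ.≤-trans N≤n (ℕ.m≤n*m n 2)

  cis-double : ∀ x → Approx Iterated (λ (n , m) → expo (2 ℕ.* n) (imag (seq x m))) (cis (seq x) ∘ proj₂)
  cis-double x = expo-index tends-double (pull-tends iterated₂) (pull-bounded iterated₂ (imag-bounded x))

  real-Im : ∀ {I : Set} {F : Filter I} {u v : I → 𝔾} → Approx F u v → Approx F (real ∘ Im ∘ u) (real ∘ Im ∘ v)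
  real-Im {F = F} {u} {v} (mkApprox p) = mkApprox (null-by (always F (λ i → le (u i) (v i))) p)
    where
    le : ∀ z w → ‖ real (Im z) -ᵍ real (Im w) ‖ ≤ ‖ z -ᵍ w ‖
    le (a ,ᵍ b) (c ,ᵍ d) = ≤-trans (≤-reflexive (‖real‖ (b - d))) (∣Im∣≤‖‖ (a - c ,ᵍ b - d))

  isSin⇒ : ∀ x s → IsSin x s → Approx Seq (real ∘ Im ∘ cis (seq x)) (real ∘ seq s)
  isSin⇒ x s h = ≈-iterated₂ {u = real ∘ Im ∘ cis (seq x)} {v = real ∘ seq s} (≈-trans (≈-sym (real-Im (cis-double x)))
    (≈-trans (≈-reflexive (λ (n , m) → cong real (Im-expo x n m))) (⟶ℝ⇒≈ {Real.partialSum (sinTerm x)} {s} h)))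

  ⇒isSin : ∀ x s → Approx Seq (real ∘ Im ∘ cis (seq x)) (real ∘ seq s) → IsSin x s
  ⇒isSin x s h = ≈⇒⟶ℝ {Real.partialSum (sinTerm x)} {s}
    (≈-trans (≈-reflexive (λ (n , m) → cong real (sym (Im-expo x n m))))
    (≈-trans (real-Im (cis-double x)) (pull-≈ iterated₂ h)))

  -- Numerical bounds for partial sums of sine and cosine.

  cosₙ sinₙ : ℕ → ℚ → ℚ
  cosₙ n q = Re (expo n (imag q))
  sinₙ n q = Im (expo n (imag q))

  expo-cos-sin : ∀ n q → expo n (imag q) ≡ (cosₙ n q ,ᵍ sinₙ n q)
  expo-cos-sin n q with expo n (imag q)
  ... | a ,ᵍ b = refl

  sinₙ-neg : ∀ n q → sinₙ n (- q) ≡ - sinₙ n q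
  sinₙ-neg n q = trans (cong Im (expo-conj n q)) (Im-conj (expo n (imag q)))
    where
    Im-conj : ∀ z → Im (conj z) ≡ - Im z
    Im-conj (a ,ᵍ b) = refl

  private
    -- 1 - 4/6 - 16/60 = 1/15, the value at q = 2 of the lower estimate 1 - q²/6 - q⁴/60 for sin q /
    -- q.
    c₁₅ : ℚ
    c₁₅ = inv 15

    term-imag : ∀ n q {a b} → term n (imag q) ≡ (a ,ᵍ b) →
                term (suc n) (imag q) ≡ (- (inv (suc n) * (q * b)) ,ᵍ inv (suc n) * (q * a))
    term-imag n q {a} {b} eq = trans (cong (λ t → real (inv (suc n)) *ᵍ (imag q *ᵍ t)) eq) (cong₂ _,ᵍ_
      (solve 4 (λ i q a b → i :* (con 0ℚ :* a :- q :* b) :- con 0ℚ :* (con 0ℚ :* b :+ q :* a) := :- (i :* (q :* b))) refl (inv (suc n)) q a b)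
      (solve 4 (λ i q a b → i :* (con 0ℚ :* b :+ q :* a) :+ con 0ℚ :* (con 0ℚ :* a :- q :* b) := i :* (q :* a)) refl (inv (suc n)) q a b))
      where open +-*-Solver

  sinₙ-5 : ∀ q → sinₙ 5 q ≡ q - inv 6 * (q * (q * q))
  sinₙ-5 q = trans (cong Im (cong₂ _+ᵍ_ (cong₂ _+ᵍ_ (cong₂ _+ᵍ_ (cong (0ᵍ +ᵍ 1ᵍ +ᵍ_) t₁) t₂) t₃) t₄))
    (solve 1 (λ q →
        let b₁ = con (inv 1) :* (q :* con 1ℚ)
            a₁ = :- (con (inv 1) :* (q :* con 0ℚ))
            b₂ = con (inv 2) :* (q :* a₁)
            a₂ = :- (con (inv 2) :* (q :* b₁))
            b₃ = con (inv 3) :* (q :* a₂)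
            a₃ = :- (con (inv 3) :* (q :* b₂))
            b₄ = con (inv 4) :* (q :* a₃)
        in con 0ℚ :+ con 0ℚ :+ b₁ :+ b₂ :+ b₃ :+ b₄ := q :- con (inv 6) :* (q :* (q :* q))) refl q)
    where
    open +-*-Solver
    t₁ = term-imag 0 q refl
    t₂ = term-imag 1 q t₁
    t₃ = term-imag 2 q t₂
    t₄ = term-imag 3 q t₃

  Im≤ : ∀ z w → Im w - ‖ z -ᵍ w ‖ ≤ Im z
  Im≤ z@(a ,ᵍ b) w@(c ,ᵍ d) = ≤-by (p≤q⇒0≤q-p (≤-trans (-p≤∣p∣ (b - d)) (∣Im∣≤‖‖ (z -ᵍ w))))
    (solve 3 (λ b d n → d :- n :+ (n :- :- (b :- d)) := b) refl b d ‖ z -ᵍ w ‖)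
    where open +-*-Solver

  Re≤ : ∀ z w → Re w - ‖ z -ᵍ w ‖ ≤ Re z
  Re≤ z@(a ,ᵍ b) w@(c ,ᵍ d) = ≤-by (p≤q⇒0≤q-p (≤-trans (-p≤∣p∣ (a - c)) (∣Re∣≤‖‖ (z -ᵍ w))))
    (solve 3 (λ b d n → d :- n :+ (n :- :- (b :- d)) := b) refl a c ‖ z -ᵍ w ‖)
    where open +-*-Solver

  ≤Re : ∀ z w → Re z ≤ Re w + ‖ z -ᵍ w ‖
  ≤Re z@(a ,ᵍ b) w@(c ,ᵍ d) = ≤-by (p≤q⇒0≤q-p (≤-trans (p≤∣p∣ (a - c)) (∣Re∣≤‖‖ (z -ᵍ w))))
    (solve 3 (λ b d n → b :+ (n :- (b :- d)) := d :+ n) refl a c ‖ z -ᵍ w ‖)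
    where open +-*-Solver

  two : ℚ
  two = fromℕ 2

  -- From |sin q − (q − q³/6)| ≤ q⁵/60 and q² ≤ 4.
  sinₙ-lower : ∀ n q → 5 ℕ.≤ n → 0ℚ ≤ q → q ≤ two → c₁₅ * q ≤ sinₙ n q
  sinₙ-lower n q 5≤n 0≤q q≤2 = begin
    c₁₅ * q
      ≤⟨ ≤-by (0≤* 0≤q (0≤+ (0≤* {inv 6} (0≤inv 6) (p≤q⇒0≤q-p q²≤4)) (0≤* {inv 60} (0≤inv 60) (p≤q⇒0≤q-p q⁴≤16)))) (eq₁ q) ⟩
    (q - inv 6 * (q * (q * q))) - (majorant 5 q + majorant 5 q)
      ≡⟨ cong (_- (majorant 5 q + majorant 5 q)) (sinₙ-5 q) ⟨
    sinₙ 5 q - (majorant 5 q + majorant 5 q)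
      ≤⟨ +-monoʳ-≤ (sinₙ 5 q) (neg-antimono-≤ (expo-tail 5 n (imag q) 5≤n
           (≤-reflexive (trans (‖imag‖ q) (0≤p⇒∣p∣≡p 0≤q))) (≤-trans (+-mono-≤ q≤2 q≤2) (from-yes (two + two ℚ.≤? fromℕ 6))))) ⟩
    sinₙ 5 q - ‖ expo n (imag q) -ᵍ expo 5 (imag q) ‖
      ≤⟨ Im≤ (expo n (imag q)) (expo 5 (imag q)) ⟩
    sinₙ n q ∎
    where
    open ≤-Reasoning
    q²≤4 : q * q ≤ two * two
    q²≤4 = *-mono-≤ 0≤q q≤2 0≤q q≤2
    q⁴≤16 : (q * q) * (q * q) ≤ (two * two) * (two * two)
    q⁴≤16 = *-mono-≤ (0≤* 0≤q 0≤q) q²≤4 (0≤* 0≤q 0≤q) q²≤4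
    open +-*-Solver
    eq₁ : ∀ q → c₁₅ * q + q * (inv 6 * (two * two - q * q) + inv 60 * ((two * two) * (two * two) - (q * q) * (q * q)))
              ≡ (q - inv 6 * (q * (q * q))) - (majorant 5 q + majorant 5 q)
    eq₁ = solve 1 (λ q →
        let m = con (inv 5) :* (q :* (con (inv 4) :* (q :* (con (inv 3) :* (q :* (con (inv 2) :* (q :* (con (inv 1) :* (q :* con 1ℚ)))))))))
        in con c₁₅ :* q :+ q :* (con (inv 6) :* (con two :* con two :- q :* q)
             :+ con (inv 60) :* ((con two :* con two) :* (con two :* con two) :- (q :* q) :* (q :* q)))
           := (q :- con (inv 6) :* (q :* (q :* q))) :- (m :+ m)) refl

  ∣sinₙ∣-lower : ∀ n q → 5 ℕ.≤ n → ∣ q ∣ ≤ two → c₁₅ * ∣ q ∣ ≤ ∣ sinₙ n q ∣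
  ∣sinₙ∣-lower n q 5≤n ∣q∣≤2 with ∣p∣≡p∨∣p∣≡-p q
  ... | inj₁ eq = ≤-trans (sinₙ-lower n ∣ q ∣ 5≤n (0≤∣p∣ q) ∣q∣≤2)
                    (≤-trans (≤-reflexive (cong (sinₙ n) eq)) (p≤∣p∣ (sinₙ n q)))
  ... | inj₂ eq = ≤-trans (sinₙ-lower n ∣ q ∣ 5≤n (0≤∣p∣ q) ∣q∣≤2)
                    (≤-trans (≤-reflexive (trans (cong (sinₙ n) eq) (sinₙ-neg n q))) (-p≤∣p∣ (sinₙ n q)))

  -- The seven-term sum is 389/720, far above the remainder 2/7!.
  cosₙ-1 : ∀ n → 7 ℕ.≤ n → 0ℚ < cosₙ n 1ℚ
  cosₙ-1 n 7≤n = <-≤-trans (from-yes (0ℚ ℚ.<? cosₙ 7 1ℚ - (majorant 7 1ℚ + majorant 7 1ℚ)))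
    (≤-trans (+-monoʳ-≤ (cosₙ 7 1ℚ) (neg-antimono-≤ (expo-tail 7 n (imag 1ℚ) 7≤n ≤-refl (from-yes (1ℚ + 1ℚ ℚ.≤? fromℕ 8)))))
      (Re≤ (expo n (imag 1ℚ)) (expo 7 (imag 1ℚ))))

  -- The seven-term sum is -19/45, and the remainder 2 · 2⁷ / 7! = 16/315 cannot make it positive.
  cosₙ-2 : ∀ n → 7 ℕ.≤ n → cosₙ n two ≤ 0ℚ
  cosₙ-2 n 7≤n = ≤-trans (≤Re (expo n (imag two)) (expo 7 (imag two)))
    (≤-trans (+-monoʳ-≤ (cosₙ 7 two) (expo-tail 7 n (imag two) 7≤n ≤-refl (from-yes (two + two ℚ.≤? fromℕ 8))))
      (from-yes (cosₙ 7 two + (majorant 7 two + majorant 7 two) ℚ.≤? 0ℚ)))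

  -- Zeros of the cosine, and the number π.

  module _ {I : Set} {F : Filter I} where

    -- Used in place of division by a factor that stays away from 0.
    null-cancel : ∀ {u v : I → 𝔾} c → 0ℚ < c → Eventually F (λ i → c * ‖ v i ‖ ≤ ‖ u i ‖) → Null F u → Null F v
    null-cancel {u} {v} c 0<c cv≤u (mkNull u→0) = mkNull λ ε 0<ε →
      map₂ F {λ i → c * ‖ v i ‖ ≤ ‖ u i ‖} {λ i → ‖ u i ‖ < c * ε}
        (λ i le lt → *-cancelˡ-<-nonNeg c {{nonNegative (<⇒≤ 0<c)}} (≤-<-trans le lt))
        cv≤u (u→0 (c * ε) (0<p*q 0<c 0<ε))

    real-Re : ∀ {u v : I → 𝔾} → Approx F u v → Approx F (real ∘ Re ∘ u) (real ∘ Re ∘ v)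
    real-Re {u} {v} (mkApprox p) = mkApprox (null-by (always F (λ i → le (u i) (v i))) p)
      where
      le : ∀ z w → ‖ real (Re z) -ᵍ real (Re w) ‖ ≤ ‖ z -ᵍ w ‖
      le (a ,ᵍ b) (c ,ᵍ d) = ≤-trans (≤-reflexive (‖real‖ (a - c))) (∣Re∣≤‖‖ (a - c ,ᵍ b - d))

    null-≈ : ∀ {u v : I → 𝔾} → Approx F u v → Null F v → Null F u
    null-≈ {u} {v} u≈v v→0 = null-≗ (λ i → eq (u i) (v i)) (null-+ (null u≈v) v→0)
      where
      open 𝔾-Solver
      eq : ∀ x y → x ≡ (x -ᵍ y) +ᵍ y
      eq = solve 2 (λ x y → x := (x :- y) :+ y) refl

    null⇒≈0 : ∀ {u : I → 𝔾} → Null F u → Approx F u (λ _ → 0ᵍ)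
    null⇒≈0 {u} u→0 = mkApprox (null-≗ (λ i → eq (u i)) u→0)
      where
      open 𝔾-Solver
      eq : ∀ x → x -ᵍ 0ᵍ ≡ x
      eq = solve 1 (λ x → x :- con 0ᵍ := x) refl

    ≈0⇒null : ∀ {u : I → 𝔾} → Approx F u (λ _ → 0ᵍ) → Null F u
    ≈0⇒null u≈0 = null-≈ u≈0 null-0

    -- cos p − cos q = − 2 sin ((p + q) / 2) sin ((p − q) / 2), and the first sine is bounded away from 0.
    cos-null-separates : ∀ {k : I → ℕ} (p q : I → ℚ) → Tends F k →
      Eventually F (λ i → ∣ p i ∣ ≤ two) → Eventually F (λ i → ∣ q i ∣ ≤ two) → Eventually F (λ i → 1ℚ ≤ p i + q i) →
      Null F (λ i → real (cosₙ (k i) (p i))) → Null F (λ i → real (cosₙ (k i) (q i))) →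
      Null F (λ i → imag (p i - q i))
    cos-null-separates {k} p q k→∞ p≤2 q≤2 1≤p+q p→0 q→0 =
      null-cancel {u = λ i → real (S i * D i)} c (0<p*q (0<inv 30) (0<inv 30))
        (map₂ F {λ i → 1ℚ ≤ p i + q i × 5 ℕ.≤ k i} {λ i → ∣ p i ∣ ≤ two × ∣ q i ∣ ≤ two} lower
          (map₂ F {λ i → 1ℚ ≤ p i + q i} {λ i → 5 ℕ.≤ k i} (λ i → _,_) 1≤p+q (k→∞ 5))
          (map₂ F {λ i → ∣ p i ∣ ≤ two} {λ i → ∣ q i ∣ ≤ two} (λ i → _,_) p≤2 q≤2))
        (null-cancel {u = λ i → real (- (S i * D i + S i * D i))} 1ℚ (positive⁻¹ 1ℚ) (always F (λ i → double (S i * D i)))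
          (null-≈ (≈-sym diff) (null-+ p→0 (null-neg q→0))))
      where
      s d S D : I → ℚ
      s i = ½ * (p i + q i)
      d i = ½ * (p i - q i)
      S i = sinₙ (k i) (s i)
      D i = sinₙ (k i) (d i)
      -- Each sine is at least 1/15 of its argument in absolute value; the half sum is at least ½
      -- and the half difference contributes another ½.
      c : ℚ
      c = inv 30 * inv 30
      ∣½∣ : ∀ a b → ∣ a ∣ ≤ two → ∣ b ∣ ≤ two → ∣ ½ * (a + b) ∣ ≤ two
      ∣½∣ a b a≤ b≤ = begin
        ∣ ½ * (a + b) ∣  ≡⟨ ∣p*q∣≡∣p∣*∣q∣ ½ (a + b) ⟩
        ½ * ∣ a + b ∣  ≤⟨ *-monoˡ-≤-nonNeg ½ (≤-trans (∣p+q∣≤∣p∣+∣q∣ a b) (+-mono-≤ a≤ b≤)) ⟩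
        two  ∎
        where open ≤-Reasoning
      d≤2 : ∀ i → ∣ p i ∣ ≤ two → ∣ q i ∣ ≤ two → ∣ d i ∣ ≤ two
      d≤2 i p≤ q≤ = ∣½∣ (p i) (- q i) p≤ (≤-trans (≤-reflexive (∣-p∣≡∣p∣ (q i))) q≤)
      s≤2 : ∀ i → ∣ p i ∣ ≤ two → ∣ q i ∣ ≤ two → ∣ s i ∣ ≤ two
      s≤2 i = ∣½∣ (p i) (q i)
      eventually≤2 : ∀ {x : I → ℚ} → (∀ i → ∣ p i ∣ ≤ two → ∣ q i ∣ ≤ two → ∣ x i ∣ ≤ two) → Eventually F (λ i → ∣ x i ∣ ≤ two)
      eventually≤2 x≤ = map₂ F {λ i → ∣ p i ∣ ≤ two} {λ i → ∣ q i ∣ ≤ two} x≤ p≤2 q≤2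
      lower : ∀ i → 1ℚ ≤ p i + q i × 5 ℕ.≤ k i → ∣ p i ∣ ≤ two × ∣ q i ∣ ≤ two → c * ‖ imag (p i - q i) ‖ ≤ ‖ real (S i * D i) ‖
      lower i (1≤p+q , 5≤k) (p≤ , q≤) = begin
        inv 30 * inv 30 * ‖ imag (p i - q i) ‖  ≡⟨ cong (inv 30 * inv 30 *_) (‖imag‖ (p i - q i)) ⟩
        inv 30 * inv 30 * ∣ p i - q i ∣  ≡⟨ eq ∣ p i - q i ∣ ⟩
        inv 15 * ½ * (inv 15 * (½ * ∣ p i - q i ∣)) ≡⟨ cong (λ x → inv 15 * ½ * (inv 15 * x)) (∣p*q∣≡∣p∣*∣q∣ ½ (p i - q i)) ⟨
        inv 15 * ½ * (inv 15 * ∣ d i ∣)  ≤⟨ *-mono-≤ (from-yes (0ℚ ℚ.≤? inv 15 * ½))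
                                                       (≤-trans (*-monoˡ-≤-nonNeg (inv 15) (≤-trans (*-monoˡ-≤-nonNeg ½ 1≤p+q) (p≤∣p∣ (s i))))
                                                         (∣sinₙ∣-lower (k i) (s i) 5≤k (s≤2 i p≤ q≤)))
                                                       (0≤* (0≤inv 15) (0≤∣p∣ (d i)))
                                                       (∣sinₙ∣-lower (k i) (d i) 5≤k (d≤2 i p≤ q≤)) ⟩
        ∣ S i ∣ * ∣ D i ∣  ≡⟨ ∣p*q∣≡∣p∣*∣q∣ (S i) (D i) ⟨
        ∣ S i * D i ∣  ≡⟨ ‖real‖ (S i * D i) ⟨
        ‖ real (S i * D i) ‖  ∎
        where
        open ≤-Reasoning
        open +-*-Solver
        eq : ∀ x → inv 30 * inv 30 * x ≡ inv 15 * ½ * (inv 15 * (½ * x))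
        eq = solve 1 (λ x → con (inv 30) :* con (inv 30) :* x := con (inv 15) :* con ½ :* (con (inv 15) :* (con ½ :* x))) refl
      double : ∀ x → 1ℚ * ‖ real x ‖ ≤ ‖ real (- (x + x)) ‖
      double x = begin
        1ℚ * ‖ real x ‖  ≡⟨ trans (*-identityˡ ‖ real x ‖) (‖real‖ x) ⟩
        ∣ x ∣  ≤⟨ p≤p+q (0≤∣p∣ x) ⟩
        ∣ x ∣ + ∣ x ∣  ≡⟨ eq ∣ x ∣ ⟩
        two * ∣ x ∣  ≡⟨ ∣p*q∣≡∣p∣*∣q∣ two x ⟨
        ∣ two * x ∣  ≡⟨ cong ∣_∣ (eq x) ⟨
        ∣ x + x ∣  ≡⟨ ∣-p∣≡∣p∣ (x + x) ⟨
        ∣ - (x + x) ∣  ≡⟨ ‖real‖ (- (x + x)) ⟨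
        ‖ real (- (x + x)) ‖  ∎
        where
        open ≤-Reasoning
        open +-*-Solver
        eq : ∀ x → x + x ≡ two * x
        eq = solve 1 (λ x → x :+ x := con two :* x) refl
      imag-bd : ∀ {x : I → ℚ} → Eventually F (λ i → ∣ x i ∣ ≤ two) → Bounded F (imag ∘ x)
      imag-bd {x} x≤ = bounded-by two (map F {λ i → ∣ x i ∣ ≤ two} (λ i → ≤-trans (≤-reflexive (‖imag‖ (x i)))) x≤)
      split : ∀ (x y : I → ℚ) → (∀ i → ∣ p i ∣ ≤ two → ∣ q i ∣ ≤ two → ∣ x i ∣ ≤ two) →
              (∀ i → ∣ p i ∣ ≤ two → ∣ q i ∣ ≤ two → ∣ y i ∣ ≤ two) →
              Approx F (λ i → expo (k i) (imag (x i + y i))) (λ i → expo (k i) (imag (x i)) *ᵍ expo (k i) (imag (y i)))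
      split x y x≤ y≤ = expo-+ k→∞ (imag-bd (eventually≤2 x≤)) (imag-bd (eventually≤2 y≤))
      diff : Approx F (λ i → real (cosₙ (k i) (p i)) -ᵍ real (cosₙ (k i) (q i))) (λ i → real (- (S i * D i + S i * D i)))
      diff = ≈-trans
        (≈-reflexive (λ i → trans (Re-- (expo (k i) (imag (p i))) (expo (k i) (imag (q i))))
          (cong₂ (λ x y → real (Re (expo (k i) (imag x) -ᵍ expo (k i) (imag y)))) (eq₁ (p i) (q i)) (eq₂ (p i) (q i)))))
        (≈-trans (real-Re (≈-+ (split s d s≤2 d≤2) (≈-neg (split s (λ i → - d i) s≤2 (λ i p≤ q≤ → ≤-trans (≤-reflexive (∣-p∣≡∣p∣ (d i))) (d≤2 i p≤ q≤))))))
          (≈-reflexive (λ i → trans (cong (λ w → real (Re (expo (k i) (imag (s i)) *ᵍ expo (k i) (imag (d i)) -ᵍ expo (k i) (imag (s i)) *ᵍ w))) (expo-conj (k i) (d i)))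
             (eq₃ (expo (k i) (imag (s i))) (expo (k i) (imag (d i)))))))
        where
        Re-- : ∀ z w → real (Re z) -ᵍ real (Re w) ≡ real (Re (z -ᵍ w))
        Re-- (a ,ᵍ b) (c ,ᵍ d) = refl
        open +-*-Solver
        eq₁ : ∀ p q → p ≡ ½ * (p + q) + ½ * (p - q)
        eq₁ = solve 2 (λ p q → p := con ½ :* (p :+ q) :+ con ½ :* (p :- q)) refl
        eq₂ : ∀ p q → q ≡ ½ * (p + q) + - (½ * (p - q))
        eq₂ = solve 2 (λ p q → q := con ½ :* (p :+ q) :+ :- (con ½ :* (p :- q))) refl
        eq₃ : ∀ z w → real (Re (z *ᵍ w -ᵍ z *ᵍ conj w)) ≡ real (- (Im z * Im w + Im z * Im w))
        eq₃ (a ,ᵍ b) (c ,ᵍ d) = cong real (solve 4 (λ a b c d →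
          (a :* c :- b :* d) :- (a :* c :- b :* (:- d)) := :- (b :* d :+ b :* d)) refl a b c d)

  -- A discrete intermediate value theorem: the sign of a rational partial sum is decidable, so a
  -- search along a grid can replace bisection on reals.
  first-change : (P : ℕ → Set) → (∀ k → Dec (P k)) → ∀ n → ¬ P 0 → P n → ∃[ k ] k ℕ.< n × ¬ P k × P (suc k)
  first-change P P? zero    ¬p0 pn = ⊥-elim (¬p0 pn)
  first-change P P? (suc n) ¬p0 pn with P? n
  ... | no ¬p = n , ℕ.≤-refl , ¬p , pn
  ... | yes p with first-change P P? n ¬p0 p
  ...   | k , k<n , ¬pk , psk = k , ℕ.m≤n⇒m≤1+n k<n , ¬pk , psk

  abstract
    -- At least 7, so that the signs at 1 and at 2 are known, and unbounded in `N`, so that the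
    -- truncation disappears in the limit.
    gridOrder : ℕ → ℕ
    gridOrder N = 7 ℕ.+ N

    7≤gridOrder : ∀ N → 7 ℕ.≤ gridOrder N
    7≤gridOrder = ℕ.m≤m+n 7

    n≤gridOrder : ∀ N → N ℕ.≤ gridOrder N
    n≤gridOrder N = ℕ.m≤n+m N 7

  -- A zero of the cosine between 1 and 2: at precision N, the last point before a sign change
  -- of a partial sum of the cosine series on the grid 1 + k / (N + 1).
  module _ (N : ℕ) where

    gridStep : ℚ
    gridStep = inv (suc N)

    gridPoint : ℕ → ℚ
    gridPoint k = 1ℚ + fromℕ k * gridStep

    private
      order : ℕ
      order = gridOrder N

    abstract
      grid-end : gridPoint (suc N) ≡ two
      grid-end = cong (1ℚ +_) (trans (*-comm (fromℕ (suc N)) gridStep) (inv-inverse (suc N)))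

    private
      NonPositiveAt : ℕ → Set
      NonPositiveAt k = cosₙ order (gridPoint k) ≤ 0ℚ

    abstract
      root : ∃[ k ] k ℕ.< suc N × ¬ NonPositiveAt k × NonPositiveAt (suc k)
      root = first-change NonPositiveAt (λ k → cosₙ order (gridPoint k) ℚ.≤? 0ℚ) (suc N)
        (λ le → <-irrefl refl (<-≤-trans (cosₙ-1 order (7≤gridOrder N))
          (subst (λ q → cosₙ order q ≤ 0ℚ) (trans (cong (1ℚ +_) (*-zeroˡ gridStep)) (+-identityʳ 1ℚ)) le)))
        (subst (λ q → cosₙ order q ≤ 0ℚ) (sym grid-end) (cosₙ-2 order (7≤gridOrder N)))

    gridRoot : ℚ
    gridRoot = gridPoint (proj₁ root)

    abstract
      1≤gridRoot : 1ℚ ≤ gridRoot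
      1≤gridRoot = p≤p+q (0≤* (0≤fromℕ (proj₁ root)) (0≤inv (suc N)))

      gridRoot≤2 : gridRoot ≤ two
      gridRoot≤2 = ≤-trans (+-monoʳ-≤ 1ℚ (*-monoʳ-≤-nonNeg gridStep {{nonNegative (0≤inv (suc N))}}
        (fromℕ-mono-≤ (ℕ.<⇒≤ (proj₁ (proj₂ root)))))) (≤-reflexive grid-end)

      ∣gridRoot∣≤2 : ∣ gridRoot ∣ ≤ two
      ∣gridRoot∣≤2 = ≤-trans (≤-reflexive (0≤p⇒∣p∣≡p (≤-trans (<⇒≤ (positive⁻¹ 1ℚ)) 1≤gridRoot))) gridRoot≤2

      -- A positive value followed by a nonpositive one is at most the jump between them, and the
      -- jump across a single grid step tends to 0.
      cos-gridRoot : ‖ real (cosₙ order gridRoot) ‖ ≤ ‖ expo order (imag gridRoot) -ᵍ expo order (imag (gridRoot + gridStep)) ‖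
      cos-gridRoot = begin
        ‖ real (cosₙ order gridRoot) ‖
          ≡⟨ trans (‖real‖ (cosₙ order gridRoot)) (0≤p⇒∣p∣≡p (<⇒≤ (≰⇒> (proj₁ (proj₂ (proj₂ root)))))) ⟩
        cosₙ order gridRoot
          ≤⟨ ≤Re (expo order (imag gridRoot)) (expo order (imag (gridRoot + gridStep))) ⟩
        cosₙ order (gridRoot + gridStep) + n
          ≤⟨ +-monoˡ-≤ n (subst (λ q → cosₙ order q ≤ 0ℚ) next (proj₂ (proj₂ (proj₂ root)))) ⟩
        0ℚ + n
          ≡⟨ +-identityˡ n ⟩
        n ∎
        where
        open ≤-Reasoning
        n : ℚ
        n = ‖ expo order (imag gridRoot) -ᵍ expo order (imag (gridRoot + gridStep)) ‖
        open +-*-Solver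
        next : gridPoint (suc (proj₁ root)) ≡ gridRoot + gridStep
        next = trans (cong (λ c → 1ℚ + c * gridStep) (fromℕ-suc (proj₁ root)))
          (solve 2 (λ k g → con 1ℚ :+ (con 1ℚ :+ k) :* g := con 1ℚ :+ k :* g :+ g) refl (fromℕ (proj₁ root)) gridStep)

  gridRoot-bounded : Bounded Seq (imag ∘ gridRoot)
  gridRoot-bounded = bounded-by two (always Seq (λ N → ≤-trans (≤-reflexive (‖imag‖ (gridRoot N))) (∣gridRoot∣≤2 N)))

  cos-gridRoot-null : Null Seq (λ m → real (cosₙ m (gridRoot m)))
  cos-gridRoot-null = null-≈ (real-Re {u = cis gridRoot} {v = λ N → expo (gridOrder N) (imag (gridRoot N))}
      (expo-index tends-id tends-order gridRoot-bounded))
    (null-by (always Seq cos-gridRoot) (null (≈-sym (expo-cong tends-order gridRoot-bounded shift))))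
    where
    tends-order : Tends Seq gridOrder
    tends-order N = N , λ n N≤n → ℕ.≤-trans N≤n (n≤gridOrder n)
    step-null : Null Seq (imag ∘ gridStep)
    step-null = mkNull λ ε 0<ε → let N , small = inv-small 0<ε in N , λ n N≤n →
      ≤-<-trans (≤-reflexive (trans (‖imag‖ (gridStep n)) (0≤p⇒∣p∣≡p (0≤inv (suc n)))))
        (≤-<-trans (inv-anti (ℕ.s≤s N≤n)) small)
      where
      inv-anti : ∀ {m n} .{{_ : ℕ.NonZero m}} .{{_ : ℕ.NonZero n}} → m ℕ.≤ n → inv n ≤ inv m
      inv-anti {m} {n} m≤n = begin
        inv n  ≡⟨ *-identityʳ (inv n) ⟨
        inv n * 1ℚ  ≡⟨ cong (inv n *_) (inv-inverse m) ⟨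
        inv n * (inv m * fromℕ m)  ≤⟨ *-monoˡ-≤-nonNeg (inv n) {{nonNegative (0≤inv n)}}
                                              (*-monoˡ-≤-nonNeg (inv m) {{nonNegative (0≤inv m)}} (fromℕ-mono-≤ m≤n)) ⟩
        inv n * (inv m * fromℕ n)  ≡⟨ solve 3 (λ a b c → a :* (b :* c) := b :* (a :* c)) refl (inv n) (inv m) (fromℕ n) ⟩
        inv m * (inv n * fromℕ n)  ≡⟨ cong (inv m *_) (inv-inverse n) ⟩
        inv m * 1ℚ  ≡⟨ *-identityʳ (inv m) ⟩
        inv m  ∎
        where
        open ≤-Reasoning
        open +-*-Solver
    shift : Approx Seq (λ N → imag (gridRoot N + gridStep N)) (imag ∘ gridRoot)
    shift = mkApprox (null-≗ (λ N → cong imag (eq (gridRoot N) (gridStep N))) step-null)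
      where
      open +-*-Solver
      eq : ∀ a b → a + b - a ≡ b
      eq = solve 2 (λ a b → a :+ b :- a := b) refl

  -- The searches on different grids are independent, so nothing in the construction keeps their
  -- results close. But all of them nearly annihilate the cosine and are at least 1, and
  -- `cos-null-separates` then brings them together.
  gridRoot-cauchy : IsCauchy gridRoot
  gridRoot-cauchy ε 0<ε = let N , p = eventually-< diff ε 0<ε in N , λ m n N≤m N≤n →
      subst (_< ε) (‖imag‖ (gridRoot m - gridRoot n)) (p (m , n) (N≤m , N≤n))
    where
    diff : Null Joint (λ (m , n) → imag (gridRoot m - gridRoot n))
    diff = cos-null-separates {k = proj₁} (gridRoot ∘ proj₁) (gridRoot ∘ proj₂) (pull-tends joint₁)
      (always Joint (∣gridRoot∣≤2 ∘ proj₁)) (always Joint (∣gridRoot∣≤2 ∘ proj₂))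
      (always Joint (λ (m , n) → ≤-trans (1≤gridRoot m) (p≤p+q (≤-trans (<⇒≤ (positive⁻¹ 1ℚ)) (1≤gridRoot n)))))
      (pull-null joint₁ cos-gridRoot-null)
      (null-≈ (real-Re {u = λ (m , n) → expo m (imag (gridRoot n))} {v = λ (m , n) → expo n (imag (gridRoot n))}
        (expo-index (pull-tends joint₁) (pull-tends joint₂) (pull-bounded joint₂ gridRoot-bounded)))
        (pull-null joint₂ cos-gridRoot-null))

  halfπ : ℝ
  halfπ = mkℝ gridRoot gridRoot-cauchy

  abstract
    π : ℝ
    π = halfπ +ℝ halfπ

    seq-π : ∀ m → seq π m ≡ gridRoot m + gridRoot m
    seq-π m = refl

  0<π : 0ℝ <ℝ π
  0<π = 1ℚ , positive⁻¹ 1ℚ , 0 , λ n _ → ≤-trans (≤-reflexive (+-identityˡ 1ℚ))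
    (≤-trans (1≤gridRoot n) (≤-trans (p≤p+q (≤-trans (<⇒≤ (positive⁻¹ 1ℚ)) (1≤gridRoot n))) (≤-reflexive (sym (seq-π n)))))

  -1ᵍ : 𝔾
  -1ᵍ = -ᵍ 1ᵍ

  -- cos (π/2) = 0 and cos² + sin² = 1 give e^{iπ} = (i sin (π/2))² = −1.
  cis-π : Approx Seq (cis (seq π)) (λ _ → -1ᵍ)
  cis-π = ≈-trans (≈-reflexive λ m → cong (λ q → expo m (imag q)) (seq-π m))
    (≈-trans (cis-+ gridRoot-bounded gridRoot-bounded)
    (≈-trans (≈-reflexive (λ m → eq (cis gridRoot m)))
    (≈-trans (≈-+ (null⇒≈0 (null-* (bounded-by-2 {cis gridRoot} (cis-bounded gridRoot-bounded)) cos-gridRoot-null)) (≈-neg (cis-conj gridRoot-bounded)))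
      (≈-reflexive (λ _ → +ᵍ-identityˡ -1ᵍ)))))
    where
    bounded-by-2 : ∀ {u : ℕ → 𝔾} → Bounded Seq u → Bounded Seq (λ m → u m +ᵍ u m)
    bounded-by-2 {u} (mkBounded B 0<B u≤B) = mkBounded (B + B) (+-mono-< {0ℚ} {B} {0ℚ} 0<B 0<B)
      (map Seq {λ m → ‖ u m ‖ ≤ B} (λ m le → ≤-trans (‖+‖ (u m) (u m)) (+-mono-≤ le le)) u≤B)
    open +-*-Solver
    eq : ∀ z → z *ᵍ z ≡ (z +ᵍ z) *ᵍ real (Re z) -ᵍ z *ᵍ conj z
    eq (a ,ᵍ b) = cong₂ _,ᵍ_
      (solve 2 (λ a b → a :* a :- b :* b := ((a :+ a) :* a :- (b :+ b) :* con 0ℚ) :- (a :* a :- b :* (:- b))) refl a b)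
      (solve 2 (λ a b → a :* b :+ b :* a := ((a :+ a) :* con 0ℚ :+ (b :+ b) :* a) :- (a :* (:- b) :+ b :* a)) refl a b)

  sin-π : IsSin π 0ℝ
  sin-π = ⇒isSin π 0ℝ (real-Im cis-π)

  -- If sin x ≈ 0 and sin (x/2) is bounded away from 0 then cos (x/2) ≈ 0 ≈ cos (π/2), which forces x ≈ π.
  π-least : ∀ x → 0ℝ <ℝ x → IsSin x 0ℝ → π ≤ℝ x
  π-least x (δ , 0<δ , M , δ≤x) sin-x (δ′ , 0<δ′ , M′ , x+δ′≤π) =
    <-irrefl refl (<-≤-trans (small K (ℕ.m≤n⊔m (M ℕ.⊔ M′) N)) (large K (ℕ.m≤m⊔n (M ℕ.⊔ M′) N)))
    where
    y : ℕ → ℚ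
    y m = ½ * seq x m
    N₀ : ℕ
    N₀ = M ℕ.⊔ M′
    δ≤x′ : ∀ m → N₀ ℕ.≤ m → δ ≤ seq x m
    δ≤x′ m le = ≤-trans (≤-reflexive (sym (+-identityˡ δ))) (δ≤x m (ℕ.m⊔n≤o⇒m≤o M M′ le))
    0≤x : ∀ m → N₀ ℕ.≤ m → 0ℚ ≤ seq x m
    0≤x m le = ≤-trans (<⇒≤ 0<δ) (δ≤x′ m le)
    x+δ′≤ : ∀ m → N₀ ℕ.≤ m → seq x m + δ′ ≤ gridRoot m + gridRoot m
    x+δ′≤ m le = ≤-trans (x+δ′≤π m (ℕ.m⊔n≤o⇒n≤o M M′ le)) (≤-reflexive (seq-π m))
    0≤y : ∀ m → N₀ ℕ.≤ m → 0ℚ ≤ y m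
    0≤y m le = 0≤* (<⇒≤ (positive⁻¹ ½)) (0≤x m le)
    -- Here the assumption that x lies below π is used: it keeps x/2 in the range where the sine has
    -- its linear lower bound.
    y≤2 : ∀ m → N₀ ℕ.≤ m → y m ≤ two
    y≤2 m le = begin
      ½ * seq x m  ≤⟨ *-monoˡ-≤-nonNeg ½ (≤-trans (p≤p+q {seq x m} (<⇒≤ 0<δ′)) (x+δ′≤ m le)) ⟩
      ½ * (gridRoot m + gridRoot m)  ≡⟨ eq (gridRoot m) ⟩
      gridRoot m  ≤⟨ gridRoot≤2 m ⟩
      two  ∎
      where
      open ≤-Reasoning
      open +-*-Solver
      eq : ∀ h → ½ * (h + h) ≡ h
      eq = solve 1 (λ h → con ½ :* (h :+ h) := h) refl
    ∣y∣≤2 : ∀ m → N₀ ℕ.≤ m → ∣ y m ∣ ≤ two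
    ∣y∣≤2 m le = ≤-trans (≤-reflexive (0≤p⇒∣p∣≡p (0≤y m le))) (y≤2 m le)
    y-bounded : Bounded Seq (imag ∘ y)
    y-bounded = bounded-by two (N₀ , λ m le → ≤-trans (≤-reflexive (‖imag‖ (y m))) (∣y∣≤2 m le))
    square : Approx Seq (real ∘ Im ∘ cis (seq x)) (λ m → real (Im (cis y m *ᵍ cis y m)))
    square = real-Im (≈-trans (≈-reflexive (λ m → cong (λ q → expo m (imag q)) (sym (½*p (seq x m))))) (cis-+ y-bounded y-bounded))
    -- x is eventually at least δ, so sin (x/2) is at least 1/15 of δ/2.
    c : ℚ
    c = inv 15 * (½ * δ)
    0<c : 0ℚ < c
    0<c = 0<p*q (0<inv 15) (0<½p 0<δ)
    cos-y : Null Seq (λ m → real (cosₙ m (y m)))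
    cos-y = null-cancel c 0<c (N₀ ℕ.⊔ 5 , λ m le → lower m (ℕ.m⊔n≤o⇒m≤o N₀ 5 le) (ℕ.m⊔n≤o⇒n≤o N₀ 5 le))
      (null-≈ (≈-sym square) (≈0⇒null (isSin⇒ x 0ℝ sin-x)))
      where
      lower : ∀ m → N₀ ℕ.≤ m → 5 ℕ.≤ m → c * ‖ real (cosₙ m (y m)) ‖ ≤ ‖ real (Im (cis y m *ᵍ cis y m)) ‖
      lower m le 5≤m = begin
        c * ‖ real C ‖  ≤⟨ *-monoʳ-≤-nonNeg ‖ real C ‖ {{nonNegative (0≤‖‖ (real C))}} c≤S ⟩
        S * ‖ real C ‖  ≤⟨ p≤p+q (0≤* (≤-trans (<⇒≤ 0<c) c≤S) (0≤‖‖ (real C))) ⟩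
        S * ‖ real C ‖ + S * ‖ real C ‖  ≡⟨ cong (λ n → S * n + S * n) (‖real‖ C) ⟩
        S * ∣ C ∣ + S * ∣ C ∣  ≡⟨ solve 2 (λ s c → s :* c :+ s :* c := (s :+ s) :* c) refl S ∣ C ∣ ⟩
        (S + S) * ∣ C ∣  ≡⟨ cong (_* ∣ C ∣) (0≤p⇒∣p∣≡p (0≤+ (≤-trans (<⇒≤ 0<c) c≤S) (≤-trans (<⇒≤ 0<c) c≤S))) ⟨
        ∣ S + S ∣ * ∣ C ∣  ≡⟨ ∣p*q∣≡∣p∣*∣q∣ (S + S) C ⟨
        ∣ (S + S) * C ∣  ≡⟨ cong ∣_∣ (solve 2 (λ s c → (s :+ s) :* c := c :* s :+ s :* c) refl S C) ⟩
        ∣ C * S + S * C ∣  ≡⟨ ‖real‖ (C * S + S * C) ⟨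
        ‖ real (C * S + S * C) ‖  ≡⟨ cong (λ z → ‖ real (Im (z *ᵍ z)) ‖) (expo-cos-sin m (y m)) ⟨
        ‖ real (Im (cis y m *ᵍ cis y m)) ‖ ∎
        where
        open ≤-Reasoning
        open +-*-Solver
        C S : ℚ
        C = cosₙ m (y m)
        S = sinₙ m (y m)
        c≤S : c ≤ S
        c≤S = ≤-trans (*-monoˡ-≤-nonNeg (inv 15) (*-monoˡ-≤-nonNeg ½ (δ≤x′ m le)))
                (sinₙ-lower m (y m) 5≤m (0≤y m le) (y≤2 m le))
    y→halfπ : Null Seq (λ m → imag (gridRoot m - y m))
    y→halfπ = cos-null-separates {k = λ m → m} gridRoot y tends-id (always Seq ∣gridRoot∣≤2) (N₀ , ∣y∣≤2)
      (N₀ , λ m le → ≤-trans (1≤gridRoot m) (p≤p+q (0≤y m le))) cos-gridRoot-null cos-y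
    N K : ℕ
    N = proj₁ (eventually-< y→halfπ (½ * δ′) (0<½p 0<δ′))
    K = N₀ ℕ.⊔ N
    small : ∀ m → N ℕ.≤ m → ∣ gridRoot m - y m ∣ < ½ * δ′
    small m le = subst (_< ½ * δ′) (‖imag‖ (gridRoot m - y m)) (proj₂ (eventually-< y→halfπ (½ * δ′) (0<½p 0<δ′)) m le)
    large : ∀ m → N₀ ℕ.≤ m → ½ * δ′ ≤ ∣ gridRoot m - y m ∣
    large m le = ≤-trans (≤-by (0≤* (<⇒≤ (positive⁻¹ ½)) (p≤q⇒0≤q-p (x+δ′≤ m le)))
        (solve 3 (λ h x d → con ½ :* d :+ con ½ :* ((h :+ h) :- (x :+ d)) := h :- con ½ :* x) refl (gridRoot m) (seq x m) δ′))
      (p≤∣p∣ (gridRoot m - y m))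
      where open +-*-Solver

  π-isPi : IsPi π
  π-isPi = 0<π , sin-π , π-least

-- Homomorphisms, finite sums and eigenvectors of matrix powers.

module MatrixAlgebra where

  open import Data.List.Base using (map)

  module Hom (R S : RawSemiring 0ℓ 0ℓ) where

    private
      module R = RawSemiring R
      module S = RawSemiring S
      module LR = LinearAlgebra R
      module LS = LinearAlgebra S

    -- Stated for raw semirings because ℝ and ℂ obey the ring laws only up to `_≃ℝ_` and `_≃ℂ_`,
    -- whereas evaluation at an index preserves their operations up to `_≡_`.
    record Homomorphism (φ : R.Carrier → S.Carrier) : Set where
      field
        φ-+ : ∀ x y → φ (x R.+ y) ≡ φ x S.+ φ y
        φ-* : ∀ x y → φ (x R.* y) ≡ φ x S.* φ y
        φ-0 : φ R.0# ≡ S.0#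
        φ-1 : φ R.1# ≡ S.1#

      φ-sum : ∀ {A : Set} (u : A → R.Carrier) (v : A → S.Carrier) → (∀ x → φ (u x) ≡ v x) → ∀ xs →
              φ (foldr R._+_ R.0# (map u xs)) ≡ foldr S._+_ S.0# (map v xs)
      φ-sum u v eq []       = φ-0
      φ-sum u v eq (x ∷ xs) = trans (φ-+ (u x) _) (cong₂ S._+_ (eq x) (φ-sum u v eq xs))

      φ-partialSum : ∀ u n → φ (LR.partialSum u n) ≡ LS.partialSum (φ ∘ u) n
      φ-partialSum u zero    = φ-0
      φ-partialSum u (suc n) = trans (φ-+ _ (u n)) (cong (S._+ φ (u n)) (φ-partialSum u n))

      module _ (V : FiniteSet) where
        open FiniteSet V

        φ-basis : ∀ x y → φ (LR.basis V x y) ≡ LS.basis V x y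
        φ-basis x y with does (x ≟ y)
        ... | true  = φ-1
        ... | false = φ-0

        φ-matPow : ∀ {M N} → (∀ x y → φ (M x y) ≡ N x y) →
                   ∀ k x y → φ (LR.matPow V M k x y) ≡ LS.matPow V N k x y
        φ-matPow eq zero    x y = φ-basis x y
        φ-matPow eq (suc k) x y = φ-sum _ _
          (λ z → trans (φ-* _ _) (cong₂ S._*_ (eq x z) (φ-matPow eq k z y))) elements

  module Sums (R : CommutativeSemiring 0ℓ 0ℓ) where

    open CommutativeSemiring R renaming (refl to ≈-refl; sym to ≈-sym; trans to ≈-trans; reflexive to ≈-reflexive)
    open import Relation.Binary.Reasoning.Setoid (CommutativeSemiring.setoid R)

    sum : ∀ {A : Set} → (A → Carrier) → List A → Carrier
    sum u xs = foldr _+_ 0# (map u xs)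

    pow : Carrier → ℕ → Carrier
    pow c zero    = 1#
    pow c (suc k) = c * pow c k

    sum-cong : ∀ {A : Set} {u v : A → Carrier} → (∀ x → u x ≈ v x) → ∀ xs → sum u xs ≈ sum v xs
    sum-cong eq []       = ≈-refl
    sum-cong eq (x ∷ xs) = +-cong (eq x) (sum-cong eq xs)

    +-interchange : ∀ a b c d → (a + b) + (c + d) ≈ (a + c) + (b + d)
    +-interchange a b c d = begin
      (a + b) + (c + d)  ≈⟨ +-assoc a b (c + d) ⟩
      a + (b + (c + d))  ≈⟨ +-congˡ (≈-trans (≈-sym (+-assoc b c d)) (+-congʳ (+-comm b c))) ⟩
      a + ((c + b) + d)  ≈⟨ +-congˡ (+-assoc c b d) ⟩
      a + (c + (b + d))  ≈⟨ +-assoc a c (b + d) ⟨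
      (a + c) + (b + d)  ∎

    sum-+ : ∀ {A : Set} (u v : A → Carrier) xs → sum (λ x → u x + v x) xs ≈ sum u xs + sum v xs
    sum-+ u v []       = ≈-sym (+-identityˡ 0#)
    sum-+ u v (x ∷ xs) = ≈-trans (+-congˡ (sum-+ u v xs)) (+-interchange (u x) (v x) (sum u xs) (sum v xs))

    sum-0 : ∀ {A : Set} (xs : List A) → sum (λ _ → 0#) xs ≈ 0#
    sum-0 []       = ≈-refl
    sum-0 (x ∷ xs) = ≈-trans (+-identityˡ _) (sum-0 xs)

    *-sum : ∀ {A : Set} c (u : A → Carrier) xs → c * sum u xs ≈ sum (λ x → c * u x) xs
    *-sum c u []       = zeroʳ c
    *-sum c u (x ∷ xs) = ≈-trans (distribˡ c (u x) (sum u xs)) (+-congˡ (*-sum c u xs))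

    sum-* : ∀ {A : Set} c (u : A → Carrier) xs → sum u xs * c ≈ sum (λ x → u x * c) xs
    sum-* c u []       = zeroˡ c
    sum-* c u (x ∷ xs) = ≈-trans (distribʳ c (u x) (sum u xs)) (+-congˡ (sum-* c u xs))

    sum-swap : ∀ {A B : Set} (u : A → B → Carrier) xs ys →
               sum (λ x → sum (u x) ys) xs ≈ sum (λ y → sum (λ x → u x y) xs) ys
    sum-swap u []       ys = ≈-sym (sum-0 ys)
    sum-swap u (x ∷ xs) ys = ≈-trans (+-congˡ (sum-swap u xs ys)) (≈-sym (sum-+ (u x) (λ y → sum (λ x → u x y) xs) ys))

    module _ (V : FiniteSet) where

      open FiniteSet V renaming (Carrier to X)
      open LinearAlgebra rawSemiring

      basis-≡ : ∀ x → basis V x x ≡ 1#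
      basis-≡ x = cong (λ b → if b then 1# else 0#) (dec-true (x ≟ x) refl)

      basis-≢ : ∀ {x y} → x ≢ y → basis V x y ≡ 0#
      basis-≢ {x} {y} x≢y = cong (λ b → if b then 1# else 0#) (dec-false (x ≟ y) x≢y)

      basis-sym : ∀ x y → basis V x y ≡ basis V y x
      basis-sym x y with x ≟ y
      ... | yes refl = sym (basis-≡ x)
      ... | no x≢y   = sym (basis-≢ (x≢y ∘ sym))

      private
        sum-basis-∉ : ∀ (u : X → Carrier) a xs → All (a ≢_) xs → sum (λ y → u y * basis V a y) xs ≈ 0#
        sum-basis-∉ u a []       []           = ≈-refl
        sum-basis-∉ u a (y ∷ xs) (a≢y ∷ a∉xs) = begin
          u y * basis V a y + sum (λ y → u y * basis V a y) xs
            ≈⟨ +-cong (≈-trans (*-congˡ (≈-reflexive (basis-≢ a≢y))) (zeroʳ (u y))) (sum-basis-∉ u a xs a∉xs) ⟩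
          0# + 0# ≈⟨ +-identityˡ 0# ⟩
          0# ∎

        sum-basis-∈ : ∀ (u : X → Carrier) a xs → Unique xs → a ∈ xs → sum (λ y → u y * basis V a y) xs ≈ u a
        sum-basis-∈ u a (y ∷ xs) (a∉xs ∷ _) (here refl) = begin
          u a * basis V a a + sum (λ y → u y * basis V a y) xs
            ≈⟨ +-cong (≈-trans (*-congˡ (≈-reflexive (basis-≡ a))) (*-identityʳ (u a))) (sum-basis-∉ u a xs a∉xs) ⟩
          u a + 0# ≈⟨ +-identityʳ (u a) ⟩
          u a ∎
        sum-basis-∈ u a (y ∷ xs) (y∉xs ∷ uxs) (there a∈xs) = begin
          u y * basis V a y + sum (λ y → u y * basis V a y) xs
            ≈⟨ +-cong (≈-trans (*-congˡ (≈-reflexive (basis-≢ a≢y))) (zeroʳ (u y))) (sum-basis-∈ u a xs uxs a∈xs) ⟩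
          0# + u a ≈⟨ +-identityˡ (u a) ⟩
          u a ∎
          where
          a≢y : a ≢ y
          a≢y refl = All.All¬⇒¬Any y∉xs a∈xs

      sum-basis : ∀ (u : X → Carrier) a → sum (λ y → u y * basis V a y) elements ≈ u a
      sum-basis u a = sum-basis-∈ u a elements unique (complete a)

      -- Left eigenvectors are paired with a column of the exponential and yield necessary
      -- conditions; right eigenvectors are the columns of the spectral idempotents and serve to
      -- build the exponential.
      LeftEigenvector RightEigenvector : Matrix V → Carrier → (X → Carrier) → Set
      LeftEigenvector  N c f = ∀ y → sum (λ x → f x * N x y) elements ≈ c * f y
      RightEigenvector N c f = ∀ x → sum (λ y → N x y * f y) elements ≈ c * f x

      leftEigenvector-pow : ∀ {N c f} → LeftEigenvector N c f → ∀ k → LeftEigenvector (matPow V N k) (pow c k) f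
      leftEigenvector-pow {N} {c} {f} eig zero y = begin
        sum (λ x → f x * basis V x y) elements  ≈⟨ sum-cong (λ x → *-congˡ (≈-reflexive (basis-sym x y))) elements ⟩
        sum (λ x → f x * basis V y x) elements  ≈⟨ sum-basis f y ⟩
        f y  ≈⟨ *-identityˡ (f y) ⟨
        1# * f y  ∎
      leftEigenvector-pow {N} {c} {f} eig (suc k) y = begin
        sum (λ x → f x * sum (λ z → N x z * P z y) elements) elements
          ≈⟨ sum-cong (λ x → ≈-trans (*-sum (f x) (λ z → N x z * P z y) elements)
               (sum-cong (λ z → ≈-sym (*-assoc (f x) (N x z) (P z y))) elements)) elements ⟩
        sum (λ x → sum (λ z → (f x * N x z) * P z y) elements) elements
          ≈⟨ sum-swap (λ x z → (f x * N x z) * P z y) elements elements ⟩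
        sum (λ z → sum (λ x → (f x * N x z) * P z y) elements) elements
          ≈⟨ sum-cong (λ z → ≈-sym (sum-* (P z y) (λ x → f x * N x z) elements)) elements ⟩
        sum (λ z → sum (λ x → f x * N x z) elements * P z y) elements
          ≈⟨ sum-cong (λ z → ≈-trans (*-congʳ (eig z)) (*-assoc c (f z) (P z y))) elements ⟩
        sum (λ z → c * (f z * P z y)) elements
          ≈⟨ *-sum c (λ z → f z * P z y) elements ⟨
        c * sum (λ z → f z * P z y) elements
          ≈⟨ *-congˡ (leftEigenvector-pow eig k y) ⟩
        c * (pow c k * f y)
          ≈⟨ *-assoc c (pow c k) (f y) ⟨
        pow c (suc k) * f y ∎
        where
        P : Matrix V
        P = matPow V N k

      rightEigenvector-pow : ∀ {N c f} → RightEigenvector N c f → ∀ k → RightEigenvector (matPow V N k) (pow c k) f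
      rightEigenvector-pow {N} {c} {f} eig zero x = begin
        sum (λ y → basis V x y * f y) elements  ≈⟨ sum-cong (λ y → *-comm (basis V x y) (f y)) elements ⟩
        sum (λ y → f y * basis V x y) elements  ≈⟨ sum-basis f x ⟩
        f x  ≈⟨ *-identityˡ (f x) ⟨
        1# * f x  ∎
      rightEigenvector-pow {N} {c} {f} eig (suc k) x = begin
        sum (λ y → sum (λ z → N x z * P z y) elements * f y) elements
          ≈⟨ sum-cong (λ y → ≈-trans (sum-* (f y) (λ z → N x z * P z y) elements)
               (sum-cong (λ z → *-assoc (N x z) (P z y) (f y)) elements)) elements ⟩
        sum (λ y → sum (λ z → N x z * (P z y * f y)) elements) elements
          ≈⟨ sum-swap (λ y z → N x z * (P z y * f y)) elements elements ⟩
        sum (λ z → sum (λ y → N x z * (P z y * f y)) elements) elements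
          ≈⟨ sum-cong (λ z → ≈-trans (≈-sym (*-sum (N x z) (λ y → P z y * f y) elements))
               (*-congˡ (rightEigenvector-pow eig k z))) elements ⟩
        sum (λ z → N x z * (pow c k * f z)) elements
          ≈⟨ sum-cong (λ z → ≈-trans (*-comm (N x z) (pow c k * f z))
               (≈-trans (*-assoc (pow c k) (f z) (N x z)) (*-congˡ (*-comm (f z) (N x z))))) elements ⟩
        sum (λ z → pow c k * (N x z * f z)) elements
          ≈⟨ *-sum (pow c k) (λ z → N x z * f z) elements ⟨
        pow c k * sum (λ z → N x z * f z) elements
          ≈⟨ *-congˡ (eig x) ⟩
        pow c k * (c * f x)
          ≈⟨ *-assoc (pow c k) c (f x) ⟨
        (pow c k * c) * f x
          ≈⟨ *-congʳ (*-comm (pow c k) c) ⟩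
        pow c (suc k) * f x ∎
        where
        P : Matrix V
        P = matPow V N k

-- The exponential of an integer matrix on eigenvectors and spectral idempotents.

module Evolution where

  open import Data.Rational.Base
  open import Data.Rational.Properties as ℚ
  open Analysis
  open MatrixAlgebra

  ℤ-semiring ℚ-semiring 𝔾-semiring : CommutativeSemiring 0ℓ 0ℓ
  ℤ-semiring = ℤ.+-*-commutativeSemiring
  ℚ-semiring = CommutativeRing.commutativeSemiring ℚ.+-*-commutativeRing
  𝔾-semiring = CommutativeRing.commutativeSemiring 𝔾-commutativeRing

  module Sumsℤ = Sums ℤ-semiring
  module Sums𝔾 = Sums 𝔾-semiring
  module Linℤ = LinearAlgebra (CommutativeSemiring.rawSemiring ℤ-semiring)
  module Linℚ = LinearAlgebra (CommutativeSemiring.rawSemiring ℚ-semiring)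
  module Lin𝔾 = LinearAlgebra (CommutativeSemiring.rawSemiring 𝔾-semiring)
  module ℂ→𝔾 = Hom ℂ-rawSemiring (CommutativeSemiring.rawSemiring 𝔾-semiring)
  module ℝ→ℚ = Hom ℝ-rawSemiring (CommutativeSemiring.rawSemiring ℚ-semiring)
  module ℤ→ℚ = Hom (CommutativeSemiring.rawSemiring ℤ-semiring) (CommutativeSemiring.rawSemiring ℚ-semiring)
  module ℤ→𝔾 = Hom (CommutativeSemiring.rawSemiring ℤ-semiring) (CommutativeSemiring.rawSemiring 𝔾-semiring)

  emb : ℤ.ℤ → 𝔾
  emb i = real (fromℤ i)

  emb-+ : ∀ i j → emb (i ℤ.+ j) ≡ emb i +ᵍ emb j
  emb-+ i j = trans (cong real (fromℤ-+ i j)) (real-+ (fromℤ i) (fromℤ j))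

  emb-* : ∀ i j → emb (i ℤ.* j) ≡ emb i *ᵍ emb j
  emb-* i j = trans (cong real (fromℤ-* i j)) (real-* (fromℤ i) (fromℤ j))

  at-homomorphism : ∀ m → ℂ→𝔾.Homomorphism (λ z → at z m)
  at-homomorphism m = record { φ-+ = λ _ _ → refl ; φ-* = λ _ _ → refl ; φ-0 = refl ; φ-1 = refl }

  seq-homomorphism : ∀ m → ℝ→ℚ.Homomorphism (λ x → seq x m)
  seq-homomorphism m = record { φ-+ = λ _ _ → refl ; φ-* = λ _ _ → refl ; φ-0 = refl ; φ-1 = refl }

  fromℤ-homomorphism : ℤ→ℚ.Homomorphism fromℤ
  fromℤ-homomorphism = record { φ-+ = fromℤ-+ ; φ-* = fromℤ-* ; φ-0 = refl ; φ-1 = refl }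

  emb-homomorphism : ℤ→𝔾.Homomorphism emb
  emb-homomorphism = record { φ-+ = emb-+ ; φ-* = emb-* ; φ-0 = refl ; φ-1 = refl }

  sum-≈ : ∀ {I A : Set} {F : Filter I} {u v : A → I → 𝔾} → (∀ x → Approx F (u x) (v x)) → ∀ xs →
          Approx F (λ i → Sums𝔾.sum (λ x → u x i) xs) (λ i → Sums𝔾.sum (λ x → v x i) xs)
  sum-≈ eq []       = ≈-refl
  sum-≈ eq (x ∷ xs) = ≈-+ (eq x) (sum-≈ eq xs)

  -- e^{iτc}
  phase : ℝ → ℤ.ℤ → ℕ → 𝔾
  phase τ c = cis (λ m → seq τ m * fromℤ c)

  phase-exponent-bounded : ∀ τ c → Bounded Seq (λ m → imag (seq τ m * fromℤ c))
  phase-exponent-bounded τ c = imag-bounded (τ *ℝ fromℚ (fromℤ c))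

  module _ (V : FiniteSet) where

    open FiniteSet V renaming (Carrier to X)

    -- Equality at every index, stronger than `_≃ℝ_`: the adjacency matrix consists of constant
    -- sequences, and so do its powers.
    Represents : Real.Matrix V → Linℤ.Matrix V → Set
    Represents K k = ∀ m x y → seq (K x y) m ≡ fromℤ (k x y)

    represents-matPow : ∀ {A a} → Represents A a → ∀ r → Represents (Real.matPow V A r) (Linℤ.matPow V a r)
    represents-matPow {A} {a} rep r m x y =
      trans (ℝ→ℚ.Homomorphism.φ-matPow (seq-homomorphism m) V (rep m) r x y)
            (sym (ℤ→ℚ.Homomorphism.φ-matPow fromℤ-homomorphism V (λ _ _ → refl) r x y))

    module _ (K : Real.Matrix V) (k : Linℤ.Matrix V) (rep : Represents K k) (τ : ℝ) where

      generator : Complex.Matrix V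
      generator x y = (-ℂ (𝕚 *ℂ fromℝ τ)) *ℂ fromℝ (K x y)

      private
        t : ℕ → 𝔾
        t m = imag (- seq τ m)

        N : ℕ → Lin𝔾.Matrix V
        N m x y = t m *ᵍ emb (k x y)

        P : ℕ → ℕ → Lin𝔾.Matrix V
        P n m x y = Lin𝔾.partialSum (λ j → real (inv! j) *ᵍ Lin𝔾.matPow V (N m) j x y) n

        at-generator : ∀ m x y → at (generator x y) m ≡ N m x y
        at-generator m x y = trans (cong₂ _,ᵍ_
          (solve 2 (λ t κ → (:- (con 0ℚ :* t :- con 1ℚ :* con 0ℚ)) :* κ :- (:- (con 0ℚ :* con 0ℚ :+ con 1ℚ :* t)) :* con 0ℚ
                          := con 0ℚ :* κ :- (:- t) :* con 0ℚ) refl (seq τ m) (seq (K x y) m))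
          (solve 2 (λ t κ → (:- (con 0ℚ :* t :- con 1ℚ :* con 0ℚ)) :* con 0ℚ :+ (:- (con 0ℚ :* con 0ℚ :+ con 1ℚ :* t)) :* κ
                          := con 0ℚ :* con 0ℚ :+ (:- t) :* κ) refl (seq τ m) (seq (K x y) m)))
          (cong (λ κ → t m *ᵍ real κ) (rep m x y))
          where open +-*-Solver

        expSeries : X → X → ℕ → ℂ
        expSeries x y = Complex.partialSum (λ j → fromℝ (1/ j !) *ℂ Complex.matPow V generator j x y)

        partialSum-cong : ∀ {u v} → (∀ j → u j ≡ v j) → ∀ n → Lin𝔾.partialSum u n ≡ Lin𝔾.partialSum v n
        partialSum-cong eq zero    = refl
        partialSum-cong eq (suc n) = cong₂ _+ᵍ_ (partialSum-cong eq n) (eq n)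

        at-expSeries : ∀ n m x y → at (expSeries x y n) m ≡ P n m x y
        at-expSeries n m x y = trans
          (φ-partialSum (λ j → fromℝ (1/ j !) *ℂ Complex.matPow V generator j x y) n)
          (partialSum-cong (λ j → cong (real (inv! j) *ᵍ_) (φ-matPow V (at-generator m) j x y)) n)
          where open ℂ→𝔾.Homomorphism (at-homomorphism m)

        t*emb : ∀ m c → t m *ᵍ emb c ≡ imag (seq τ m * fromℤ (ℤ.- c))
        t*emb m c = trans (cong₂ _,ᵍ_
          (solve 2 (λ t c → con 0ℚ :* c :- (:- t) :* con 0ℚ := con 0ℚ) refl (seq τ m) (fromℤ c))
          (solve 2 (λ t c → con 0ℚ :* con 0ℚ :+ (:- t) :* c := t :* :- c) refl (seq τ m) (fromℤ c)))
          (cong (λ q → imag (seq τ m * q)) (sym (fromℤ-neg c)))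
          where open +-*-Solver

        mulVec-basis : ∀ E a x m → at (Complex.mulVec V E (Complex.basis V a) x) m ≡ at (E x a) m
        mulVec-basis E a x m = trans (φ-sum (λ y → E x y *ℂ Complex.basis V a y) _ (λ y → refl) elements)
          (trans (Sums𝔾.sum-cong (λ y → cong (at (E x y) m *ᵍ_) (φ-basis V a y)) elements)
            (Sums𝔾.sum-basis V (λ y → at (E x y) m) a))
          where open ℂ→𝔾.Homomorphism (at-homomorphism m)

        term-power : ∀ j z → real (inv! j) *ᵍ Sums𝔾.pow z j ≡ term j z
        term-power j z = trans (cong (real (inv! j) *ᵍ_) (pow-≡ j)) (sym (term-pow j z))
          where
          pow-≡ : ∀ j → Sums𝔾.pow z j ≡ powᵍ z j
          pow-≡ zero    = refl
          pow-≡ (suc j) = cong (z *ᵍ_) (pow-≡ j)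

      module _ {f : X → ℤ.ℤ} {c : ℤ.ℤ} (eig : Sumsℤ.LeftEigenvector V k c f) where

        private
          eigenvector : ∀ m → Sums𝔾.LeftEigenvector V (N m) (imag (seq τ m * fromℤ (ℤ.- c))) (emb ∘ f)
          eigenvector m y = begin
            Sums𝔾.sum (λ x → emb (f x) *ᵍ (t m *ᵍ emb (k x y))) elements
              ≡⟨ Sums𝔾.sum-cong (λ x → trans (*ᵍ-swap (emb (f x)) (t m) (emb (k x y))) (cong (t m *ᵍ_) (sym (emb-* (f x) (k x y))))) elements ⟩
            Sums𝔾.sum (λ x → t m *ᵍ emb (f x ℤ.* k x y)) elements
              ≡⟨ Sums𝔾.*-sum (t m) (λ x → emb (f x ℤ.* k x y)) elements ⟨
            t m *ᵍ Sums𝔾.sum (λ x → emb (f x ℤ.* k x y)) elements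
              ≡⟨ cong (t m *ᵍ_) (ℤ→𝔾.Homomorphism.φ-sum emb-homomorphism (λ x → f x ℤ.* k x y) _ (λ _ → refl) elements) ⟨
            t m *ᵍ emb (Sumsℤ.sum (λ x → f x ℤ.* k x y) elements)
              ≡⟨ cong (λ i → t m *ᵍ emb i) (eig y) ⟩
            t m *ᵍ emb (c ℤ.* f y)
              ≡⟨ cong (t m *ᵍ_) (emb-* c (f y)) ⟩
            t m *ᵍ (emb c *ᵍ emb (f y))
              ≡⟨ *ᵍ-assoc (t m) (emb c) (emb (f y)) ⟨
            (t m *ᵍ emb c) *ᵍ emb (f y)
              ≡⟨ cong (_*ᵍ emb (f y)) (t*emb m c) ⟩
            imag (seq τ m * fromℤ (ℤ.- c)) *ᵍ emb (f y) ∎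
            where
            open ≡-Reasoning

          -- Exact for every number of terms and every index, so that the passage to the limit
          -- concerns only scalars.
          series : ∀ n m y → Sums𝔾.sum (λ x → emb (f x) *ᵍ P n m x y) elements
                           ≡ expo n (imag (seq τ m * fromℤ (ℤ.- c))) *ᵍ emb (f y)
          series zero    m y = trans (Sums𝔾.sum-cong (λ x → *ᵍ-zeroʳ (emb (f x))) elements)
            (trans (Sums𝔾.sum-0 elements) (sym (*ᵍ-zeroˡ (emb (f y)))))
          series (suc n) m y = begin
            Sums𝔾.sum (λ x → emb (f x) *ᵍ (P n m x y +ᵍ real (inv! n) *ᵍ Q x)) elements
              ≡⟨ Sums𝔾.sum-cong (λ x → expand (emb (f x)) (P n m x y) (real (inv! n)) (Q x)) elements ⟩
            Sums𝔾.sum (λ x → emb (f x) *ᵍ P n m x y +ᵍ real (inv! n) *ᵍ (emb (f x) *ᵍ Q x)) elements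
              ≡⟨ Sums𝔾.sum-+ (λ x → emb (f x) *ᵍ P n m x y) (λ x → real (inv! n) *ᵍ (emb (f x) *ᵍ Q x)) elements ⟩
            Sums𝔾.sum (λ x → emb (f x) *ᵍ P n m x y) elements +ᵍ Sums𝔾.sum (λ x → real (inv! n) *ᵍ (emb (f x) *ᵍ Q x)) elements
              ≡⟨ cong₂ _+ᵍ_ (series n m y) (trans (sym (Sums𝔾.*-sum (real (inv! n)) (λ x → emb (f x) *ᵍ Q x) elements))
                   (trans (cong (real (inv! n) *ᵍ_) (Sums𝔾.leftEigenvector-pow V (eigenvector m) n y))
                   (trans (sym (*ᵍ-assoc (real (inv! n)) (Sums𝔾.pow z n) (emb (f y)))) (cong (_*ᵍ emb (f y)) (term-power n z))))) ⟩
            expo n z *ᵍ emb (f y) +ᵍ term n z *ᵍ emb (f y)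
              ≡⟨ *ᵍ-distribʳ-+ᵍ (emb (f y)) (expo n z) (term n z) ⟨
            expo (suc n) z *ᵍ emb (f y) ∎
            where
            open ≡-Reasoning
            z : 𝔾
            z = imag (seq τ m * fromℤ (ℤ.- c))
            Q : X → 𝔾
            Q x = Lin𝔾.matPow V (N m) n x y
            open 𝔾-Solver
            expand : ∀ a p i q → a *ᵍ (p +ᵍ i *ᵍ q) ≡ a *ᵍ p +ᵍ i *ᵍ (a *ᵍ q)
            expand = solve 4 (λ a p i q → a :* (p :+ i :* q) := a :* p :+ i :* (a :* q)) refl

        -- Applying an eigenvector to both sides of exp(-iτK) e_a = γ e_b.
        transfer-phase : ∀ {E : Complex.Matrix V} {γ a b} → IsExp V generator E →
          (∀ x → Complex.mulVec V E (Complex.basis V a) x ≃ℂ γ *ℂ Complex.basis V b x) →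
          Approx Seq (λ m → phase τ (ℤ.- c) m *ᵍ emb (f a)) (λ m → at γ m *ᵍ emb (f b))
        transfer-phase {E} {γ} {a} {b} isExp E-a =
          ≈-trans (≈-iterated₂ {u = λ m → phase τ (ℤ.- c) m *ᵍ emb (f a)} {v = λ m → Sums𝔾.sum (λ x → emb (f x) *ᵍ at (E x a) m) elements}
            (≈-trans (≈-sym (≈-* (pull-bounded iterated₂ (cis-bounded (phase-exponent-bounded τ (ℤ.- c)))) (bounded-const (emb (f a)))
                (expo-index (pull-tends iterated₁) (pull-tends iterated₂) (pull-bounded iterated₂ (phase-exponent-bounded τ (ℤ.- c)))) ≈-refl))
            (≈-trans (≈-reflexive (λ (n , m) → sym (series n m a)))
              (sum-≈ {u = λ x (n , m) → emb (f x) *ᵍ P n m x a} {v = λ x (n , m) → emb (f x) *ᵍ at (E x a) m}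
                (λ x → ≈-* (bounded-const (emb (f x))) (pull-bounded iterated₂ (at-bounded (E x a))) ≈-refl
                (≈-trans (≈-reflexive (λ (n , m) → sym (at-expSeries n m x a))) (⟶ℂ⇒≈ {expSeries x a} {E x a} (isExp x a)))) elements))))
          (≈-trans (sum-≈ {u = λ x m → emb (f x) *ᵍ at (E x a) m} {v = λ x m → emb (f x) *ᵍ at (γ *ℂ Complex.basis V b x) m}
              (λ x → ≈-* (bounded-const (emb (f x))) (at-bounded (γ *ℂ Complex.basis V b x)) ≈-refl
                (≈-trans (≈-reflexive (λ m → sym (mulVec-basis E a x m)))
                  (at-≃⇒≈ {Complex.mulVec V E (Complex.basis V a) x} {γ *ℂ Complex.basis V b x} (E-a x)))) elements)
            (≈-reflexive target))
          where
          open ≡-Reasoning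
          open 𝔾-Solver
          target : ∀ m → Sums𝔾.sum (λ x → emb (f x) *ᵍ at (γ *ℂ Complex.basis V b x) m) elements ≡ at γ m *ᵍ emb (f b)
          target m = begin
            Sums𝔾.sum (λ x → emb (f x) *ᵍ (at γ m *ᵍ at (Complex.basis V b x) m)) elements
              ≡⟨ Sums𝔾.sum-cong (λ x → trans (cong (λ w → emb (f x) *ᵍ (at γ m *ᵍ w)) (φ-basis V b x))
                   (swap (emb (f x)) (at γ m) (Lin𝔾.basis V b x))) elements ⟩
            Sums𝔾.sum (λ x → (at γ m *ᵍ emb (f x)) *ᵍ Lin𝔾.basis V b x) elements
              ≡⟨ Sums𝔾.sum-basis V (λ x → at γ m *ᵍ emb (f x)) b ⟩
            at γ m *ᵍ emb (f b) ∎
            where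
            open ℂ→𝔾.Homomorphism (at-homomorphism m)
            swap : ∀ a b c → a *ᵍ (b *ᵍ c) ≡ (b *ᵍ a) *ᵍ c
            swap = solve 3 (λ a b c → a :* (b :* c) := (b :* a) :* c) refl

      -- D is a common denominator of the spectral idempotents C j / D.
      module _ {A : Set} (js : List A) (C : A → X → X → ℤ.ℤ) (eigenvalue : A → ℤ.ℤ) (D : ℕ) .{{_ : ℕ.NonZero D}}
               (eig : ∀ j y → Sumsℤ.RightEigenvector V k (eigenvalue j) (λ x → C j x y))
               (resolution : ∀ x y → Sumsℤ.sum (λ j → C j x y) js ≡ ℤ.+ D ℤ.* Linℤ.basis V x y) where

        private
          z : ℕ → A → 𝔾
          z m j = imag (seq τ m * fromℤ (ℤ.- eigenvalue j))

          d : 𝔾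
          d = emb (ℤ.+ D)

          eigenvector : ∀ m j y → Sums𝔾.RightEigenvector V (N m) (z m j) (λ x → emb (C j x y))
          eigenvector m j y x = begin
            Sums𝔾.sum (λ w → (t m *ᵍ emb (k x w)) *ᵍ emb (C j w y)) elements
              ≡⟨ Sums𝔾.sum-cong (λ w → trans (*ᵍ-assoc (t m) (emb (k x w)) (emb (C j w y)))
                   (cong (t m *ᵍ_) (sym (emb-* (k x w) (C j w y))))) elements ⟩
            Sums𝔾.sum (λ w → t m *ᵍ emb (k x w ℤ.* C j w y)) elements
              ≡⟨ Sums𝔾.*-sum (t m) (λ w → emb (k x w ℤ.* C j w y)) elements ⟨
            t m *ᵍ Sums𝔾.sum (λ w → emb (k x w ℤ.* C j w y)) elements
              ≡⟨ cong (t m *ᵍ_) (ℤ→𝔾.Homomorphism.φ-sum emb-homomorphism (λ w → k x w ℤ.* C j w y) _ (λ _ → refl) elements) ⟨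
            t m *ᵍ emb (Sumsℤ.sum (λ w → k x w ℤ.* C j w y) elements)
              ≡⟨ cong (λ i → t m *ᵍ emb i) (eig j y x) ⟩
            t m *ᵍ emb (eigenvalue j ℤ.* C j x y)
              ≡⟨ cong (t m *ᵍ_) (emb-* (eigenvalue j) (C j x y)) ⟩
            t m *ᵍ (emb (eigenvalue j) *ᵍ emb (C j x y))
              ≡⟨ *ᵍ-assoc (t m) (emb (eigenvalue j)) (emb (C j x y)) ⟨
            (t m *ᵍ emb (eigenvalue j)) *ᵍ emb (C j x y)
              ≡⟨ cong (_*ᵍ emb (C j x y)) (t*emb m (eigenvalue j)) ⟩
            z m j *ᵍ emb (C j x y) ∎
            where open ≡-Reasoning

          -- The l-th power is applied to the resolution of the identity Σ C_j = D · I, whose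
          -- summands have eigenvectors as columns.
          power : ∀ m l x y → Sums𝔾.sum (λ j → Sums𝔾.pow (z m j) l *ᵍ emb (C j x y)) js ≡ d *ᵍ Lin𝔾.matPow V (N m) l x y
          power m l x y = begin
            Sums𝔾.sum (λ j → Sums𝔾.pow (z m j) l *ᵍ emb (C j x y)) js
              ≡⟨ Sums𝔾.sum-cong (λ j → sym (Sums𝔾.rightEigenvector-pow V (eigenvector m j y) l x)) js ⟩
            Sums𝔾.sum (λ j → Sums𝔾.sum (λ w → Q w *ᵍ emb (C j w y)) elements) js
              ≡⟨ Sums𝔾.sum-swap (λ j w → Q w *ᵍ emb (C j w y)) js elements ⟩
            Sums𝔾.sum (λ w → Sums𝔾.sum (λ j → Q w *ᵍ emb (C j w y)) js) elements
              ≡⟨ Sums𝔾.sum-cong (λ w → trans (sym (Sums𝔾.*-sum (Q w) (λ j → emb (C j w y)) js)) (cong (Q w *ᵍ_) (resolved w))) elements ⟩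
            Sums𝔾.sum (λ w → Q w *ᵍ (d *ᵍ Lin𝔾.basis V y w)) elements
              ≡⟨ Sums𝔾.sum-cong (λ w → sym (*ᵍ-assoc (Q w) d (Lin𝔾.basis V y w))) elements ⟩
            Sums𝔾.sum (λ w → (Q w *ᵍ d) *ᵍ Lin𝔾.basis V y w) elements
              ≡⟨ Sums𝔾.sum-basis V (λ w → Q w *ᵍ d) y ⟩
            Q y *ᵍ d
              ≡⟨ *ᵍ-comm (Q y) d ⟩
            d *ᵍ Q y ∎
            where
            open ≡-Reasoning
            Q : X → 𝔾
            Q w = Lin𝔾.matPow V (N m) l x w
            resolved : ∀ w → Sums𝔾.sum (λ j → emb (C j w y)) js ≡ d *ᵍ Lin𝔾.basis V y w
            resolved w = trans (sym (φ-sum (λ j → C j w y) _ (λ _ → refl) js)) (trans (cong emb (resolution w y))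
              (trans (emb-* (ℤ.+ D) (Linℤ.basis V w y)) (cong (d *ᵍ_) (trans (φ-basis V w y) (Sums𝔾.basis-sym V w y)))))
              where open ℤ→𝔾.Homomorphism emb-homomorphism

          spectral-series : ∀ n m x y → Sums𝔾.sum (λ j → expo n (z m j) *ᵍ emb (C j x y)) js ≡ d *ᵍ P n m x y
          spectral-series zero    m x y = trans (Sums𝔾.sum-cong (λ j → *ᵍ-zeroˡ (emb (C j x y))) js)
            (trans (Sums𝔾.sum-0 js) (sym (*ᵍ-zeroʳ d)))
          spectral-series (suc n) m x y = begin
            Sums𝔾.sum (λ j → (expo n (z m j) +ᵍ term n (z m j)) *ᵍ emb (C j x y)) js
              ≡⟨ Sums𝔾.sum-cong (λ j → trans (*ᵍ-distribʳ-+ᵍ (emb (C j x y)) (expo n (z m j)) (term n (z m j)))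
                   (cong (expo n (z m j) *ᵍ emb (C j x y) +ᵍ_) (trans (cong (_*ᵍ emb (C j x y)) (sym (term-power n (z m j))))
                     (*ᵍ-assoc i (Sums𝔾.pow (z m j) n) (emb (C j x y)))))) js ⟩
            Sums𝔾.sum (λ j → expo n (z m j) *ᵍ emb (C j x y) +ᵍ i *ᵍ (Sums𝔾.pow (z m j) n *ᵍ emb (C j x y))) js
              ≡⟨ Sums𝔾.sum-+ (λ j → expo n (z m j) *ᵍ emb (C j x y)) (λ j → i *ᵍ (Sums𝔾.pow (z m j) n *ᵍ emb (C j x y))) js ⟩
            Sums𝔾.sum (λ j → expo n (z m j) *ᵍ emb (C j x y)) js +ᵍ Sums𝔾.sum (λ j → i *ᵍ (Sums𝔾.pow (z m j) n *ᵍ emb (C j x y))) js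
              ≡⟨ cong₂ _+ᵍ_ (spectral-series n m x y) (trans (sym (Sums𝔾.*-sum i (λ j → Sums𝔾.pow (z m j) n *ᵍ emb (C j x y)) js))
                   (cong (i *ᵍ_) (power m n x y))) ⟩
            d *ᵍ P n m x y +ᵍ i *ᵍ (d *ᵍ Lin𝔾.matPow V (N m) n x y)
              ≡⟨ collect d (P n m x y) i (Lin𝔾.matPow V (N m) n x y) ⟩
            d *ᵍ P (suc n) m x y ∎
            where
            open ≡-Reasoning
            i : 𝔾
            i = real (inv! n)
            open 𝔾-Solver
            collect : ∀ d p i q → d *ᵍ p +ᵍ i *ᵍ (d *ᵍ q) ≡ d *ᵍ (p +ᵍ i *ᵍ q)
            collect = solve 4 (λ d p i q → d :* p :+ i :* (d :* q) := d :* (p :+ i :* q)) refl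

        -- Here exp(-iτK) = Σ_j e^{-iτλ_j} C_j / D = γ T.
        spectral-transfer : ∀ (γ : ℂ) (s : A → ℤ.ℤ) (T : X → X → ℤ.ℤ) {a b} → ∣ γ ∣² ≃ℝ 1ℝ →
          (∀ j → Approx Seq (phase τ (ℤ.- eigenvalue j)) (λ m → at γ m *ᵍ emb (s j))) →
          (∀ x y → Sumsℤ.sum (λ j → s j ℤ.* C j x y) js ≡ ℤ.+ D ℤ.* T x y) →
          (∀ x → T x a ≡ Linℤ.basis V b x) → TransferAt V K a b τ
        spectral-transfer γ s T {a} {b} γ-unit phases sum-T T-a = E , isExp , γ , γ-unit , column
          where
          open ≡-Reasoning
          E : Complex.Matrix V
          E x y = γ *ℂ fromℝ (fromℚ (fromℤ (T x y)))
          d⁻¹ : 𝔾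
          d⁻¹ = real (inv D)
          cancel : ∀ w → d⁻¹ *ᵍ (d *ᵍ w) ≡ w
          cancel w = trans (sym (*ᵍ-assoc d⁻¹ d w)) (trans (cong (_*ᵍ w) (trans (sym (real-* (inv D) (fromℕ D))) (cong real (inv-inverse D))))
            (*ᵍ-identityˡ w))
          sum-T𝔾 : ∀ g x y → Sums𝔾.sum (λ j → (g *ᵍ emb (s j)) *ᵍ emb (C j x y)) js ≡ d *ᵍ (g *ᵍ emb (T x y))
          sum-T𝔾 g x y = begin
            Sums𝔾.sum (λ j → (g *ᵍ emb (s j)) *ᵍ emb (C j x y)) js
              ≡⟨ Sums𝔾.sum-cong (λ j → trans (*ᵍ-assoc g (emb (s j)) (emb (C j x y))) (cong (g *ᵍ_) (sym (emb-* (s j) (C j x y))))) js ⟩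
            Sums𝔾.sum (λ j → g *ᵍ emb (s j ℤ.* C j x y)) js
              ≡⟨ Sums𝔾.*-sum g (λ j → emb (s j ℤ.* C j x y)) js ⟨
            g *ᵍ Sums𝔾.sum (λ j → emb (s j ℤ.* C j x y)) js
              ≡⟨ cong (g *ᵍ_) (ℤ→𝔾.Homomorphism.φ-sum emb-homomorphism (λ j → s j ℤ.* C j x y) _ (λ _ → refl) js) ⟨
            g *ᵍ emb (Sumsℤ.sum (λ j → s j ℤ.* C j x y) js)
              ≡⟨ cong (λ i → g *ᵍ emb i) (sum-T x y) ⟩
            g *ᵍ emb (ℤ.+ D ℤ.* T x y)
              ≡⟨ cong (g *ᵍ_) (emb-* (ℤ.+ D) (T x y)) ⟩
            g *ᵍ (d *ᵍ emb (T x y))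
              ≡⟨ *ᵍ-swap g d (emb (T x y)) ⟩
            d *ᵍ (g *ᵍ emb (T x y)) ∎
          isExp : IsExp V generator E
          isExp x y = ≈⇒⟶ℂ {expSeries x y} {E x y}
            (≈-trans (≈-reflexive (λ (n , m) → trans (at-expSeries n m x y)
              (trans (sym (cancel (P n m x y))) (cong (d⁻¹ *ᵍ_) (sym (spectral-series n m x y))))))
            (≈-trans (≈-* (bounded-const d⁻¹) (pull-bounded iterated₂ target-bounded) ≈-refl
              (≈-trans (sum-≈ {u = λ j (n , m) → expo n (z m j) *ᵍ emb (C j x y)} {v = λ j (n , m) → (at γ m *ᵍ emb (s j)) *ᵍ emb (C j x y)}
                  (λ j → ≈-* (pull-bounded iterated₂ (bounded-≈ (≈-sym (phases j)) (cis-bounded (phase-exponent-bounded τ (ℤ.- eigenvalue j)))))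
                    (bounded-const (emb (C j x y)))
                    (≈-trans (expo-index (pull-tends iterated₁) (pull-tends iterated₂) (pull-bounded iterated₂ (phase-exponent-bounded τ (ℤ.- eigenvalue j))))
                      (pull-≈ iterated₂ (phases j))) ≈-refl) js)
                (≈-reflexive (λ (n , m) → sum-T𝔾 (at γ m) x y))))
              (≈-reflexive (λ (n , m) → cancel (at (E x y) m)))))
            where
            target-bounded : Bounded Seq (λ m → d *ᵍ (at γ m *ᵍ emb (T x y)))
            target-bounded = at-bounded (fromℝ (fromℚ (fromℕ D)) *ℂ E x y)
          column : ∀ x → Complex.mulVec V E (Complex.basis V a) x ≃ℂ γ *ℂ Complex.basis V b x
          column x = ≈⇒at-≃ {Complex.mulVec V E (Complex.basis V a) x} {γ *ℂ Complex.basis V b x} (≈-reflexive λ m →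
            trans (mulVec-basis E a x m) (cong (at γ m *ᵍ_) (trans (cong emb (T-a x))
              (trans (ℤ→𝔾.Homomorphism.φ-basis emb-homomorphism V b x) (sym (ℂ→𝔾.Homomorphism.φ-basis (at-homomorphism m) V b x))))))

-- Eigenvectors of Johnson graphs as products of coordinate differences.

module JohnsonEigenvectors where

  open import Data.Fin.Subset using (inside; outside; ∣_∣; _∩_; ∁)
  open import Data.Integer.Base using (+_)
  open import Data.List.Base using (map)
  open Evolution using (module Sumsℤ; module Linℤ)

  -1ℤ : ℤ
  -1ℤ = ℤ.- 1ℤ

  ⟦_≡_⟧ : ℕ → ℕ → ℤ
  ⟦ m ≡ n ⟧ = if does (m ℕ.≟ n) then 1ℤ else 0ℤ

  ⟦≡⟧-≢ : ∀ {m n} → m ≢ n → ⟦ m ≡ n ⟧ ≡ 0ℤ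
  ⟦≡⟧-≢ {m} {n} m≢n = cong (λ b → if b then 1ℤ else 0ℤ) (dec-false (m ℕ.≟ n) m≢n)

  Weight : Set
  Weight = ℕ → ℕ → ℤ

  -- The weight that remains for the other coordinates once one coordinate has been put into x; the
  -- Boolean tells whether it also lies in y.
  shift : Bool → Weight → Weight
  shift false G s t = G (suc s) t
  shift true  G s t = G (suc s) (suc t)

  -- The sum of F x · G ∣ x ∣ ∣ x ∩ y ∣ over all subsets x.
  weighted : ∀ {v} → Weight → (Subset v → ℤ) → Subset v → ℤ
  weighted G F []      = F [] ℤ.* G 0 0
  weighted G F (β ∷ y) = weighted G (F ∘ (outside ∷_)) y ℤ.+ weighted (shift β G) (F ∘ (inside ∷_)) y

  weighted-cong : ∀ {v} {G H : Weight} {F F′ : Subset v → ℤ} → (∀ s t → G s t ≡ H s t) → (∀ x → F x ≡ F′ x) →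
                  ∀ y → weighted G F y ≡ weighted H F′ y
  weighted-cong p q []          = cong₂ ℤ._*_ (q []) (p 0 0)
  weighted-cong p q (false ∷ y) =
    cong₂ ℤ._+_ (weighted-cong p (q ∘ (outside ∷_)) y) (weighted-cong (p ∘ suc) (q ∘ (inside ∷_)) y)
  weighted-cong p q (true ∷ y)  =
    cong₂ ℤ._+_ (weighted-cong p (q ∘ (outside ∷_)) y) (weighted-cong (λ s t → p (suc s) (suc t)) (q ∘ (inside ∷_)) y)

  -- The weight is constrained only at pairs that can be the sizes of x and of x ∩ y; several of the
  -- weights below vanish only there.
  weighted-0 : ∀ {v} G (F : Subset v → ℤ) y → (∀ s t → t ℕ.≤ s → t ℕ.≤ ∣ y ∣ → G s t ≡ 0ℤ) → weighted G F y ≡ 0ℤ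
  weighted-0 G F []          h = trans (cong (F [] ℤ.*_) (h 0 0 ℕ.z≤n ℕ.z≤n)) (ℤ.*-zeroʳ (F []))
  weighted-0 G F (false ∷ y) h =
    cong₂ ℤ._+_ (weighted-0 G _ y h) (weighted-0 _ _ y (λ s t t≤s → h (suc s) t (ℕ.m≤n⇒m≤1+n t≤s)))
  weighted-0 G F (true ∷ y)  h =
    cong₂ ℤ._+_ (weighted-0 G _ y (λ s t t≤s t≤y → h s t t≤s (ℕ.m≤n⇒m≤1+n t≤y)))
                (weighted-0 _ _ y (λ s t t≤s t≤y → h (suc s) (suc t) (ℕ.s≤s t≤s) (ℕ.s≤s t≤y)))

  weighted-F0 : ∀ {v} G (F : Subset v → ℤ) → (∀ x → F x ≡ 0ℤ) → ∀ y → weighted G F y ≡ 0ℤ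
  weighted-F0 G F h []      = cong (ℤ._* G 0 0) (h [])
  weighted-F0 G F h (β ∷ y) = cong₂ ℤ._+_ (weighted-F0 G _ (h ∘ (outside ∷_)) y) (weighted-F0 (shift β G) _ (h ∘ (inside ∷_)) y)

  weighted-neg : ∀ {v} G (F : Subset v → ℤ) y → weighted G (λ x → ℤ.- F x) y ≡ ℤ.- weighted G F y
  weighted-neg G F []      = sym (ℤ.neg-distribˡ-* (F []) (G 0 0))
  weighted-neg G F (β ∷ y) = trans (cong₂ ℤ._+_ (weighted-neg G _ y) (weighted-neg (shift β G) _ y))
    (sym (ℤ.neg-distrib-+ (weighted G (F ∘ (outside ∷_)) y) (weighted (shift β G) (F ∘ (inside ∷_)) y)))

  -- `weighted` unfolds along the first coordinate; this is the expansion along an arbitrary one,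
  -- which is what a pair of coordinates calls for.
  weighted-split : ∀ {v} G (F : Subset (suc v) → ℤ) y k → weighted G F y ≡
    weighted G (λ x → F (insertAt x k outside)) (removeAt y k) ℤ.+
    weighted (shift (lookup y k) G) (λ x → F (insertAt x k inside)) (removeAt y k)
  weighted-split G F (β ∷ y) zero = refl
  weighted-split {suc v} G F (β ∷ y@(_ ∷ _)) (suc k) = begin
    weighted G (F ∘ (outside ∷_)) y ℤ.+ weighted (shift β G) (F ∘ (inside ∷_)) y
      ≡⟨ cong₂ ℤ._+_ (weighted-split G (F ∘ (outside ∷_)) y k) (weighted-split (shift β G) (F ∘ (inside ∷_)) y k) ⟩
    (oo ℤ.+ oi) ℤ.+ (io ℤ.+ weighted (shift β′ (shift β G)) (λ x → F (inside ∷ insertAt x k inside)) y′)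
      ≡⟨ cong (λ w → (oo ℤ.+ oi) ℤ.+ (io ℤ.+ w)) (weighted-cong (shift-comm β′ β) (λ _ → refl) y′) ⟩
    (oo ℤ.+ oi) ℤ.+ (io ℤ.+ ii)
      ≡⟨ interchange oo oi io ii ⟩
    (oo ℤ.+ io) ℤ.+ (oi ℤ.+ ii) ∎
    where
    open ≡-Reasoning
    β′ : Bool
    β′ = lookup y k
    y′ : Subset v
    y′ = removeAt y k
    oo oi io ii : ℤ
    oo = weighted G (λ x → F (outside ∷ insertAt x k outside)) y′
    oi = weighted (shift β′ G) (λ x → F (outside ∷ insertAt x k inside)) y′
    io = weighted (shift β G) (λ x → F (inside ∷ insertAt x k outside)) y′
    ii = weighted (shift β (shift β′ G)) (λ x → F (inside ∷ insertAt x k inside)) y′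
    shift-comm : ∀ β β′ s t → shift β (shift β′ G) s t ≡ shift β′ (shift β G) s t
    shift-comm false false s t = refl
    shift-comm false true  s t = refl
    shift-comm true  false s t = refl
    shift-comm true  true  s t = refl
    interchange : ∀ a b c d → (a ℤ.+ b) ℤ.+ (c ℤ.+ d) ≡ (a ℤ.+ c) ℤ.+ (b ℤ.+ d)
    interchange = solve-∀

  -- What `Near` becomes when a coordinate is split off. For a set y of size n, `Equal n` selects y
  -- itself and `Above n` the sets y with one point added; for y of size n + 1, `Equal n` selects
  -- the sets y with one point removed.
  Equal Above : ℕ → Weight
  Equal n s t = ⟦ s ≡ n ⟧ ℤ.* ⟦ t ≡ n ⟧
  Above n s t = ⟦ s ≡ suc n ⟧ ℤ.* ⟦ t ≡ n ⟧

  -- Near m weighs the neighbours in J(v, m) of a set of size m.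
  Near : ℕ → Weight
  Near m s t = ⟦ s ≡ m ⟧ ℤ.* ⟦ suc t ≡ m ⟧

  ⟦≡⟧*-≢ˡ : ∀ {m n} p → m ≢ n → ⟦ m ≡ n ⟧ ℤ.* p ≡ 0ℤ
  ⟦≡⟧*-≢ˡ p m≢n = cong (ℤ._* p) (⟦≡⟧-≢ m≢n)

  ⟦≡⟧*-≢ʳ : ∀ {m n} p → m ≢ n → p ℤ.* ⟦ m ≡ n ⟧ ≡ 0ℤ
  ⟦≡⟧*-≢ʳ p m≢n = trans (cong (p ℤ.*_) (⟦≡⟧-≢ m≢n)) (ℤ.*-zeroʳ p)

  both≡0 : ∀ n {s t} → t ℕ.≤ s → ⟦ suc s ≡ n ⟧ ℤ.* ⟦ t ≡ n ⟧ ≡ 0ℤ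
  both≡0 n {s} {t} t≤s with t ℕ.≟ n
  ... | yes refl = ⟦≡⟧*-≢ˡ ⟦ n ≡ n ⟧ λ eq → ℕ.<⇒≢ (ℕ.s≤s t≤s) (sym eq)
  ... | no t≢n   = ⟦≡⟧*-≢ʳ ⟦ suc s ≡ n ⟧ t≢n

  weighted-equal : ∀ {v} (F : Subset v → ℤ) y → weighted (Equal ∣ y ∣) F y ≡ F y
  weighted-equal F []          = ℤ.*-identityʳ (F [])
  weighted-equal F (false ∷ y) = trans (cong₂ ℤ._+_ (weighted-equal (F ∘ (outside ∷_)) y)
    (weighted-0 _ _ y (λ s t t≤s _ → both≡0 ∣ y ∣ t≤s))) (ℤ.+-identityʳ _)
  weighted-equal F (true ∷ y)  = trans (cong₂ ℤ._+_
    (weighted-0 _ _ y (λ s t _ t≤y → ⟦≡⟧*-≢ʳ ⟦ s ≡ suc ∣ y ∣ ⟧ (ℕ.<⇒≢ (ℕ.s≤s t≤y))))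
    (weighted-equal (F ∘ (inside ∷_)) y)) (ℤ.+-identityˡ _)

  one : ∀ {v} → Subset v → ℤ
  one _ = 1ℤ

  weighted-below : ∀ {v} n (y : Subset v) → ∣ y ∣ ≡ suc n → weighted (Equal n) one y ≡ + suc n
  weighted-below n (false ∷ y) h = trans (cong₂ ℤ._+_ (weighted-below n y h)
    (weighted-0 _ _ y (λ s t t≤s _ → both≡0 n t≤s))) (ℤ.+-identityʳ (+ suc n))
  weighted-below zero (true ∷ y) h = cong₂ ℤ._+_
    (subst (λ n → weighted (Equal n) one y ≡ 1ℤ) (ℕ.suc-injective h) (weighted-equal one y))
    (weighted-0 _ _ y (λ _ _ _ _ → refl))
  weighted-below (suc n) (true ∷ y) h = cong₂ ℤ._+_
    (subst (λ n → weighted (Equal n) one y ≡ 1ℤ) (ℕ.suc-injective h) (weighted-equal one y))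
    (weighted-below n y (ℕ.suc-injective h))

  outsides : ∀ {v} → Subset v → ℕ
  outsides []          = 0
  outsides (false ∷ y) = suc (outsides y)
  outsides (true ∷ y)  = outsides y

  ∣∣+outsides : ∀ {v} (y : Subset v) → ∣ y ∣ ℕ.+ outsides y ≡ v
  ∣∣+outsides []          = refl
  ∣∣+outsides (false ∷ y) = trans (ℕ.+-suc ∣ y ∣ (outsides y)) (cong suc (∣∣+outsides y))
  ∣∣+outsides (true ∷ y)  = cong suc (∣∣+outsides y)

  weighted-above : ∀ {v} (y : Subset v) → weighted (Above ∣ y ∣) one y ≡ + outsides y
  weighted-above []          = refl
  weighted-above (false ∷ y) = trans (ℤ.+-comm _ (weighted (Equal ∣ y ∣) one y))
    (cong₂ ℤ._+_ (weighted-equal one y) (weighted-above y))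
  weighted-above (true ∷ y)  = trans (cong₂ ℤ._+_
    (weighted-0 _ _ y (λ s t _ t≤y → ⟦≡⟧*-≢ʳ ⟦ s ≡ suc (suc ∣ y ∣) ⟧ (ℕ.<⇒≢ (ℕ.s≤s t≤y)))) (weighted-above y)) (ℤ.+-identityˡ _)

  -- The valency. A neighbour that agrees with y at the first coordinate is a neighbour of the rest
  -- of y; one that differs there is the rest of y with a point removed or added.
  weighted-near : ∀ {v} (y : Subset v) → weighted (Near ∣ y ∣) one y ≡ + ∣ y ∣ ℤ.* + outsides y
  weighted-near []          = refl
  weighted-near (false ∷ y) = trans (cong₂ ℤ._+_ (weighted-near y) (below ∣ y ∣ refl)) (eq (+ ∣ y ∣) (+ outsides y))
    where
    eq : ∀ m n → m ℤ.* n ℤ.+ m ≡ m ℤ.* (1ℤ ℤ.+ n)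
    eq = solve-∀
    below : ∀ n → ∣ y ∣ ≡ n → weighted (shift false (Near n)) one y ≡ + n
    below zero    h = weighted-0 _ _ y (λ _ _ _ _ → refl)
    below (suc n) h = weighted-below n y h
  weighted-near (true ∷ y)  = trans (cong₂ ℤ._+_ (weighted-above y) (weighted-near y)) (eq (+ ∣ y ∣) (+ outsides y))
    where
    eq : ∀ m n → n ℤ.+ m ℤ.* n ≡ (1ℤ ℤ.+ m) ℤ.* n
    eq = solve-∀

  ⟦_⟧ᵇ : Bool → ℤ
  ⟦ b ⟧ᵇ = if b then 1ℤ else 0ℤ

  -- j disjoint pairs of coordinates; after a coordinate is named it is deleted.
  data Pairs : ℕ → ℕ → Set where
    none : ∀ {v} → Pairs v 0
    pair : ∀ {v j} → Fin (suc (suc v)) → Fin (suc v) → Pairs v j → Pairs (suc (suc v)) (suc j)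

  -- The product of (x k − x l) over the pairs (k , l), for x read as a 0-1 vector.
  pairing : ∀ {v j} → Pairs v j → Subset v → ℤ
  pairing none         x = 1ℤ
  pairing (pair k l p) x =
    (⟦ lookup x k ⟧ᵇ ℤ.- ⟦ lookup (removeAt x k) l ⟧ᵇ) ℤ.* pairing p (removeAt (removeAt x k) l)

  -- θ j m n is the j-th eigenvalue (m − j)(n − j) − j of J(m + n, m) for j ≤ m and j ≤ n, and 0 otherwise.
  θ : ℕ → ℕ → ℕ → ℤ
  θ zero    m       n       = + m ℤ.* + n
  θ (suc j) (suc m) (suc n) = θ j m n ℤ.- 1ℤ
  θ (suc j) _       _       = 0ℤ

  ∣∣-removeAt : ∀ {v} (y : Subset (suc v)) k {b} → lookup y k ≡ b → ∣ y ∣ ≡ (if b then suc else (λ n → n)) ∣ removeAt y k ∣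
  ∣∣-removeAt (false ∷ y) zero refl = refl
  ∣∣-removeAt (true ∷ y)  zero refl = refl
  ∣∣-removeAt {suc v} (false ∷ y@(_ ∷ _)) (suc k) eq = ∣∣-removeAt y k eq
  ∣∣-removeAt {suc v} (true ∷ y@(_ ∷ _)) (suc k) {false} eq = cong suc (∣∣-removeAt y k eq)
  ∣∣-removeAt {suc v} (true ∷ y@(_ ∷ _)) (suc k) {true}  eq = cong suc (∣∣-removeAt y k eq)

  outsides-removeAt : ∀ {v} (y : Subset (suc v)) k {b} → lookup y k ≡ b → outsides y ≡ (if b then (λ n → n) else suc) (outsides (removeAt y k))
  outsides-removeAt (false ∷ y) zero refl = refl
  outsides-removeAt (true ∷ y)  zero refl = refl
  outsides-removeAt {suc v} (true ∷ y@(_ ∷ _)) (suc k) eq = outsides-removeAt y k eq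
  outsides-removeAt {suc v} (false ∷ y@(_ ∷ _)) (suc k) {false} eq = cong suc (outsides-removeAt y k eq)
  outsides-removeAt {suc v} (false ∷ y@(_ ∷ _)) (suc k) {true}  eq = cong suc (outsides-removeAt y k eq)

  -- The factor x k - x l removes the sets that agree at k and l. Those containing exactly one of
  -- the two points lose both coordinates and retain only a sign and a shifted weight.
  weighted-pair : ∀ {v j} G k l (p : Pairs v j) y → let y′ = removeAt (removeAt y k) l in
    weighted G (pairing (pair k l p)) y ≡
    weighted (shift (lookup y k) G) (pairing p) y′ ℤ.- weighted (shift (lookup (removeAt y k) l) G) (pairing p) y′
  weighted-pair G k l p y = begin
    weighted G (pairing (pair k l p)) y
      ≡⟨ weighted-split G _ y k ⟩
    weighted G (λ x → pairing (pair k l p) (insertAt x k outside)) (removeAt y k) ℤ.+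
    weighted (shift (lookup y k) G) (λ x → pairing (pair k l p) (insertAt x k inside)) (removeAt y k)
      ≡⟨ cong₂ ℤ._+_ (weighted-split G _ (removeAt y k) l) (weighted-split (shift (lookup y k) G) _ (removeAt y k) l) ⟩
    (weighted G (at₂ false false) y′ ℤ.+ weighted (shift (lookup (removeAt y k) l) G) (at₂ false true) y′) ℤ.+
    (weighted (shift (lookup y k) G) (at₂ true false) y′ ℤ.+ weighted (shift (lookup (removeAt y k) l) (shift (lookup y k) G)) (at₂ true true) y′)
      ≡⟨ cong₂ ℤ._+_
          (cong₂ ℤ._+_ (weighted-F0 G _ (at₂-≡ false false) y′)
            (trans (weighted-cong (λ _ _ → refl) (λ x → trans (at₂-≡ false true x) (ℤ.-1*i≡-i (pairing p x))) y′)
                   (weighted-neg (shift (lookup (removeAt y k) l) G) (pairing p) y′)))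
          (cong₂ ℤ._+_ (weighted-cong (λ _ _ → refl) (λ x → trans (at₂-≡ true false x) (ℤ.*-identityˡ (pairing p x))) y′)
            (weighted-F0 _ _ (at₂-≡ true true) y′)) ⟩
    (0ℤ ℤ.+ ℤ.- W₂) ℤ.+ (W₁ ℤ.+ 0ℤ)
      ≡⟨ eq W₁ W₂ ⟩
    W₁ ℤ.- W₂ ∎
    where
    open ≡-Reasoning
    y′ = removeAt (removeAt y k) l
    W₁ = weighted (shift (lookup y k) G) (pairing p) y′
    W₂ = weighted (shift (lookup (removeAt y k) l) G) (pairing p) y′
    eq : ∀ a b → (0ℤ ℤ.+ ℤ.- b) ℤ.+ (a ℤ.+ 0ℤ) ≡ a ℤ.- b
    eq = solve-∀
    at₂ : Bool → Bool → Subset _ → ℤ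
    at₂ b b′ x = pairing (pair k l p) (insertAt (insertAt x l b′) k b)
    at₂-≡ : ∀ b b′ x → at₂ b b′ x ≡ (⟦ b ⟧ᵇ ℤ.- ⟦ b′ ⟧ᵇ) ℤ.* pairing p x
    at₂-≡ b b′ x = trans (cong₂ (λ c z → (⟦ c ⟧ᵇ ℤ.- ⟦ lookup z l ⟧ᵇ) ℤ.* pairing p (removeAt z l))
        (insertAt-lookup (insertAt x l b′) k b) (removeAt-insertAt (insertAt x l b′) k b))
      (cong₂ (λ c z → (⟦ b ⟧ᵇ ℤ.- ⟦ c ⟧ᵇ) ℤ.* pairing p z) (insertAt-lookup x l b′) (removeAt-insertAt x l b′))

  -- If y agrees at k and l, the two shifted weights coincide and both sides are 0. If it differs,
  -- one weight is `Near` of the rest and the other selects the rest of y alone: the latter is the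
  -- neighbour obtained by swapping k and l, and it lowers the eigenvalue by 1.
  near-eigenvector : ∀ {v j} (p : Pairs v j) y → weighted (Near ∣ y ∣) (pairing p) y ≡ θ j ∣ y ∣ (outsides y) ℤ.* pairing p y
  near-eigenvector none y = trans (weighted-near y) (sym (ℤ.*-identityʳ _))
  near-eigenvector {j = suc j} (pair k l p) y = trans (weighted-pair (Near ∣ y ∣) k l p y)
    (cases (lookup y k) (lookup (removeAt y k) l) refl refl)
    where
    y′ = removeAt (removeAt y k) l
    flipped : ∀ {m n} → m ≡ suc ∣ y′ ∣ → n ≡ suc (outsides y′) →
      weighted (shift true (Near m)) (pairing p) y′ ℤ.- weighted (shift false (Near m)) (pairing p) y′
        ≡ θ (suc j) m n ℤ.* pairing p y′
    flipped refl refl = trans (cong₂ ℤ._-_ (near-eigenvector p y′) (weighted-equal (pairing p) y′))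
      (eq (θ j ∣ y′ ∣ (outsides y′)) (pairing p y′))
      where
      eq : ∀ t w → t ℤ.* w ℤ.- w ≡ (t ℤ.- 1ℤ) ℤ.* w
      eq = solve-∀
    same : ∀ w t → w ℤ.- w ≡ t ℤ.* (0ℤ ℤ.* pairing p y′)
    same w t = trans (ℤ.+-inverseʳ w) (sym (ℤ.*-zeroʳ t))
    cases : ∀ b b′ → lookup y k ≡ b → lookup (removeAt y k) l ≡ b′ →
      weighted (shift b (Near ∣ y ∣)) (pairing p) y′ ℤ.- weighted (shift b′ (Near ∣ y ∣)) (pairing p) y′
        ≡ θ (suc j) ∣ y ∣ (outsides y) ℤ.* ((⟦ b ⟧ᵇ ℤ.- ⟦ b′ ⟧ᵇ) ℤ.* pairing p y′)
    cases false false h h′ = same (weighted (shift false (Near ∣ y ∣)) (pairing p) y′) (θ (suc j) ∣ y ∣ (outsides y))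
    cases true  true  h h′ = same (weighted (shift true (Near ∣ y ∣)) (pairing p) y′) (θ (suc j) ∣ y ∣ (outsides y))
    cases true  false h h′ = trans (flipped
        (trans (∣∣-removeAt y k h) (cong suc (∣∣-removeAt (removeAt y k) l h′)))
        (trans (outsides-removeAt y k h) (outsides-removeAt (removeAt y k) l h′)))
      (cong (θ (suc j) ∣ y ∣ (outsides y) ℤ.*_) (sym (ℤ.*-identityˡ (pairing p y′))))
    cases false true  h h′ = trans (trans (eq₁ (weighted (shift false (Near ∣ y ∣)) (pairing p) y′) _) (cong ℤ.-_ (flipped
        (trans (∣∣-removeAt y k h) (∣∣-removeAt (removeAt y k) l h′))
        (trans (outsides-removeAt y k h) (cong suc (outsides-removeAt (removeAt y k) l h′))))))
      (eq₂ (θ (suc j) ∣ y ∣ (outsides y)) (pairing p y′))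
      where
      eq₁ : ∀ a b → a ℤ.- b ≡ ℤ.- (b ℤ.- a)
      eq₁ = solve-∀
      eq₂ : ∀ t w → ℤ.- (t ℤ.* w) ≡ t ℤ.* ((0ℤ ℤ.- 1ℤ) ℤ.* w)
      eq₂ = solve-∀

  adjacencyℤ : ∀ v m → Linℤ.Matrix (Johnson v m)
  adjacencyℤ v m x y = if does (adjacent? x y) then 1ℤ else 0ℤ

  sum-map : ∀ {A B : Set} (u : B → ℤ) (f : A → B) xs → Sumsℤ.sum u (map f xs) ≡ Sumsℤ.sum (u ∘ f) xs
  sum-map u f []       = refl
  sum-map u f (x ∷ xs) = cong (λ s → u (f x) ℤ.+ s) (sum-map u f xs)

  sum-++ : ∀ {A : Set} (u : A → ℤ) xs ys → Sumsℤ.sum u (xs ++ ys) ≡ Sumsℤ.sum u xs ℤ.+ Sumsℤ.sum u ys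
  sum-++ u []       ys = sym (ℤ.+-identityˡ _)
  sum-++ u (x ∷ xs) ys = trans (cong (λ s → u x ℤ.+ s) (sum-++ u xs ys)) (sym (ℤ.+-assoc (u x) _ _))

  -- The condition on the size of x passes into the weight, so that inductions can run over all
  -- subsets with the size varying.
  sum-vertices : ∀ v m (F : Subset v → ℤ) (g : ℕ → ℤ) y →
    Sumsℤ.sum (λ x → F (proj₁ x) ℤ.* g ∣ proj₁ x ∩ y ∣) (vertices v m) ≡ weighted (λ s t → ⟦ s ≡ m ⟧ ℤ.* g t) F y
  sum-vertices zero zero F g [] = trans (ℤ.+-identityʳ _) (cong (F [] ℤ.*_) (sym (ℤ.*-identityˡ (g 0))))
  sum-vertices zero (suc m) F g [] = sym (ℤ.*-zeroʳ (F []))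
  sum-vertices (suc v) zero F g (β ∷ y) = trans (trans (sum-map _ without (vertices v 0)) (sum-vertices v 0 (F ∘ (outside ∷_)) g y))
    (trans (sym (ℤ.+-identityʳ _)) (cong (λ s → weighted (λ s t → ⟦ s ≡ 0 ⟧ ℤ.* g t) (F ∘ (outside ∷_)) y ℤ.+ s)
      (sym (weighted-0 _ (F ∘ (inside ∷_)) y (λ s t _ _ → zero-weight β s t)))))
    where
    zero-weight : ∀ β s t → shift β (λ s t → ⟦ s ≡ 0 ⟧ ℤ.* g t) s t ≡ 0ℤ
    zero-weight false s t = refl
    zero-weight true  s t = refl
  sum-vertices (suc v) (suc m) F g (β ∷ y) = trans (sum-++ _ (map without (vertices v (suc m))) (map withZero (vertices v m)))
    (cong₂ ℤ._+_ (trans (sum-map _ without (vertices v (suc m))) (sum-vertices v (suc m) (F ∘ (outside ∷_)) g y))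
      (trans (sum-map _ withZero (vertices v m)) (with-zero β)))
    where
    with-zero : ∀ β → Sumsℤ.sum (λ x → F (inside ∷ proj₁ x) ℤ.* g ∣ β ∷ (proj₁ x ∩ y) ∣) (vertices v m)
      ≡ weighted (shift β (λ s t → ⟦ s ≡ suc m ⟧ ℤ.* g t)) (F ∘ (inside ∷_)) y
    with-zero false = sum-vertices v m (F ∘ (inside ∷_)) g y
    with-zero true  = sum-vertices v m (F ∘ (inside ∷_)) (g ∘ suc) y

  pairing-eigenvector : ∀ {v m n j} (p : Pairs v j) → m ℕ.+ n ≡ v →
    Sumsℤ.LeftEigenvector (Johnson v m) (adjacencyℤ v m) (θ j m n) (λ x → pairing p (proj₁ x))
  pairing-eigenvector {v} {m} {n} {j} p m+n≡v (y , h) = trans (sum-vertices v m (pairing p) (λ t → ⟦ suc t ≡ m ⟧) y)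
    (trans (cong (λ m → weighted (Near m) (pairing p) y) (sym h))
    (trans (near-eigenvector p y) (cong₂ (λ m n → θ j m n ℤ.* pairing p y) h
      (ℕ.+-cancelˡ-≡ m (outsides y) n (trans (cong (ℕ._+ outsides y) (sym h)) (trans (∣∣+outsides y) (sym m+n≡v)))))))

  find-inside : ∀ {v} (y : Subset v) → 1 ℕ.≤ ∣ y ∣ → ∃[ k ] lookup y k ≡ inside
  find-inside (true ∷ y)  h = zero , refl
  find-inside (false ∷ y) h = let k , eq = find-inside y h in suc k , eq

  find-outside : ∀ {v} (y : Subset v) → 1 ℕ.≤ outsides y → ∃[ k ] lookup y k ≡ outside
  find-outside (false ∷ y) h = zero , refl
  find-outside (true ∷ y)  h = let k , eq = find-outside y h in suc k , eq

  ∣∁∣ : ∀ {v} (y : Subset v) → ∣ ∁ y ∣ ≡ outsides y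
  ∣∁∣ []          = refl
  ∣∁∣ (false ∷ y) = cong suc (∣∁∣ y)
  ∣∁∣ (true ∷ y)  = ∣∁∣ y

  removeAt-∁ : ∀ {v} (y : Subset (suc v)) k → removeAt (∁ y) k ≡ ∁ (removeAt y k)
  removeAt-∁ (β ∷ y)             zero    = refl
  removeAt-∁ (β ∷ y@(_ ∷ _)) (suc k) = cong (not β ∷_) (removeAt-∁ y k)

  alternating : ℕ → ℤ
  alternating zero    = 1ℤ
  alternating (suc j) = ℤ.- alternating j

  -- Pairs each joining a point of y to a point outside y.
  adapted-pairs : ∀ {v} j (y : Subset v) → j ℕ.≤ ∣ y ∣ → j ℕ.≤ outsides y →
                  ∃[ p ] pairing {v} {j} p y ≡ 1ℤ × pairing {v} {j} p (∁ y) ≡ alternating j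
  adapted-pairs zero    y _ _ = none , refl , refl
  adapted-pairs {zero}         (suc j) []          () _
  adapted-pairs {suc zero}     (suc j) (false ∷ []) () _
  adapted-pairs {suc zero}     (suc j) (true ∷ []) _ ()
  adapted-pairs {suc (suc v)} (suc j) y j<∣y∣ j<out = pair k l p , on-y , on-∁y
    where
    K = find-inside y (ℕ.≤-trans (ℕ.s≤s ℕ.z≤n) j<∣y∣)
    k = proj₁ K
    y₁ = removeAt y k
    out₁ : outsides y ≡ outsides y₁
    out₁ = outsides-removeAt y k (proj₂ K)
    L = find-outside y₁ (ℕ.≤-trans (ℕ.s≤s ℕ.z≤n) (subst (suc j ℕ.≤_) out₁ j<out))
    l = proj₁ L
    y₂ = removeAt y₁ l
    IH = adapted-pairs j y₂
      (ℕ.≤-pred (subst (suc j ℕ.≤_) (trans (∣∣-removeAt y k (proj₂ K)) (cong suc (∣∣-removeAt y₁ l (proj₂ L)))) j<∣y∣))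
      (ℕ.≤-pred (subst (suc j ℕ.≤_) (trans out₁ (outsides-removeAt y₁ l (proj₂ L))) j<out))
    p = proj₁ IH
    on-y : (⟦ lookup y k ⟧ᵇ ℤ.- ⟦ lookup y₁ l ⟧ᵇ) ℤ.* pairing p y₂ ≡ 1ℤ
    on-y = cong₂ ℤ._*_ (cong₂ (λ b b′ → ⟦ b ⟧ᵇ ℤ.- ⟦ b′ ⟧ᵇ) (proj₂ K) (proj₂ L)) (proj₁ (proj₂ IH))
    on-∁y : pairing (pair k l p) (∁ y) ≡ ℤ.- alternating j
    on-∁y = trans (cong₂ ℤ._*_
        (cong₂ (λ b b′ → ⟦ b ⟧ᵇ ℤ.- ⟦ b′ ⟧ᵇ)
          (trans (lookup-map k not y) (cong not (proj₂ K)))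
          (trans (cong (λ z → lookup z l) (removeAt-∁ y k)) (trans (lookup-map l not y₁) (cong not (proj₂ L)))))
        (trans (cong (pairing p) (trans (cong (λ z → removeAt z l) (removeAt-∁ y k)) (removeAt-∁ y₁ l))) (proj₂ (proj₂ IH))))
      (ℤ.-1*i≡-i (alternating j))

  lookup-injective : ∀ {v} {x y : Subset v} → (∀ i → lookup x i ≡ lookup y i) → x ≡ y
  lookup-injective {x = x} {y} eq = trans (sym (tabulate∘lookup x)) (trans (tabulate-cong eq) (tabulate∘lookup y))

  -- A set of the same size that is a union of blocks of the partition {y, ∁ y} is y or ∁ y.
  complementary : ∀ {v m} (a b : Vertex v m) → 1 ℕ.≤ m → suc m ℕ.≤ v → a ≢ b →
    (∀ i i′ → i ≢ i′ → lookup (proj₁ a) i ≡ lookup (proj₁ a) i′ → lookup (proj₁ b) i ≡ lookup (proj₁ b) i′) →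
    Complementary a b
  complementary {v} {m} a@(x , ∣x∣) b@(y , ∣y∣) 1≤m m<v a≢b const = cases (lookup y i₀) (lookup y j₀) refl refl
    where
    1≤outsides : (z : Subset v) → ∣ z ∣ ≡ m → 1 ℕ.≤ outsides z
    1≤outsides z ∣z∣ = ℕ.+-cancelˡ-≤ m 1 (outsides z) (ℕ.≤-trans (ℕ.≤-reflexive (ℕ.+-comm m 1))
      (ℕ.≤-trans m<v (ℕ.≤-reflexive (sym (trans (cong (ℕ._+ outsides z) (sym ∣z∣)) (∣∣+outsides z))))))
    1≤∣∣ : (z : Subset v) → ∣ z ∣ ≡ m → 1 ℕ.≤ ∣ z ∣
    1≤∣∣ z ∣z∣ = subst (1 ℕ.≤_) (sym ∣z∣) 1≤m
    i₀ = proj₁ (find-inside x (1≤∣∣ x ∣x∣))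
    j₀ = proj₁ (find-outside x (1≤outsides x ∣x∣))
    const′ : ∀ i i′ → lookup x i ≡ lookup x i′ → lookup y i ≡ lookup y i′
    const′ i i′ eq with i Fin.≟ i′
    ... | yes refl = refl
    ... | no i≢i′  = const i i′ i≢i′ eq
    on-x : ∀ i → lookup x i ≡ inside → lookup y i ≡ lookup y i₀
    on-x i h = const′ i i₀ (trans h (sym (proj₂ (find-inside x (1≤∣∣ x ∣x∣)))))
    off-x : ∀ i → lookup x i ≡ outside → lookup y i ≡ lookup y j₀
    off-x i h = const′ i j₀ (trans h (sym (proj₂ (find-outside x (1≤outsides x ∣x∣)))))
    image : ∀ {b b′} → lookup y i₀ ≡ b → lookup y j₀ ≡ b′ → ∀ i → lookup y i ≡ (if lookup x i then b else b′)
    image h h′ i with lookup x i in eq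
    ... | true  = trans (on-x i eq) h
    ... | false = trans (off-x i eq) h′
    if-const : ∀ b {c : Bool} → (if b then c else c) ≡ c
    if-const true  = refl
    if-const false = refl
    if-id : ∀ b → (if b then true else false) ≡ b
    if-id true  = refl
    if-id false = refl
    if-not : ∀ b → (if b then false else true) ≡ not b
    if-not true  = refl
    if-not false = refl
    true≢false : true ≢ false
    true≢false ()
    cases : ∀ b b′ → lookup y i₀ ≡ b → lookup y j₀ ≡ b′ → y ≡ ∁ x
    cases true  true  h h′ = let k , eq = find-outside y (1≤outsides y ∣y∣) in
      ⊥-elim (true≢false (trans (sym (trans (image h h′ k) (if-const (lookup x k)))) eq))
    cases false false h h′ = let k , eq = find-inside y (1≤∣∣ y ∣y∣) in
      ⊥-elim (true≢false (trans (sym eq) (trans (image h h′ k) (if-const (lookup x k)))))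
    cases true  false h h′ = ⊥-elim (a≢b (vertex-≡ (lookup-injective (λ i → sym (trans (image h h′ i) (if-id (lookup x i)))))))
    cases false true  h h′ = lookup-injective (λ i → trans (image h h′ i)
      (trans (if-not (lookup x i)) (sym (lookup-map i not x))))

  complementary-size : ∀ {v m} (a b : Vertex v m) → Complementary a b → m ℕ.+ m ≡ v
  complementary-size {v} {m} (x , ∣x∣) (y , ∣y∣) y≡∁x =
    trans (cong₂ ℕ._+_ (sym ∣x∣) (trans (sym ∣y∣) (trans (cong ∣_∣ y≡∁x) (∣∁∣ x)))) (∣∣+outsides x)

  -- The pair (i , i′) of coordinates, with i′ renumbered after the deletion of i.
  single-pair : ∀ {v} (i i′ : Fin v) → i ≢ i′ → ∃[ p ] (∀ x → pairing {v} {1} p x ≡ ⟦ lookup x i ⟧ᵇ ℤ.- ⟦ lookup x i′ ⟧ᵇ)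
  single-pair {suc zero}    zero zero i≢i′ = ⊥-elim (i≢i′ refl)
  single-pair {suc (suc v)} i i′ i≢i′ = pair i (punchOut i≢i′) none , λ x →
    trans (ℤ.*-identityʳ _) (cong (λ b → ⟦ lookup x i ⟧ᵇ ℤ.- ⟦ b ⟧ᵇ) (removeAt-punchOut x i≢i′))

  θ-diagonal : ∀ j k → θ j (j ℕ.+ k) (j ℕ.+ k) ≡ + k ℤ.* + k ℤ.- + j
  θ-diagonal zero    k = sym (ℤ.+-identityʳ _)
  θ-diagonal (suc j) k = trans (cong (ℤ._- 1ℤ) (θ-diagonal j k)) (eq (+ k ℤ.* + k) (+ j))
    where
    eq : ∀ a b → (a ℤ.- b) ℤ.- 1ℤ ≡ a ℤ.- (1ℤ ℤ.+ b)
    eq = solve-∀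

-- 2-adic valuations of differences of eigenvalue powers.

module EigenvalueParity where

  open import Data.Integer.Base using (+_; _+_; _-_; _*_; -_)
  open Evolution using (module Sumsℤ)

  open Sumsℤ using (pow)

  2ℤ : ℤ
  2ℤ = + 2

  Even Odd : ℤ → Set
  Even x = ∃[ y ] x ≡ 2ℤ ℤ.* y
  Odd  x = ∃[ y ] x ≡ 2ℤ ℤ.* y ℤ.+ 1ℤ

  parity : ∀ n → ∃[ k ] (n ≡ k ℕ.+ k ⊎ n ≡ suc (k ℕ.+ k))
  parity zero    = 0 , inj₁ refl
  parity (suc n) with parity n
  ... | k , inj₁ refl = k , inj₂ refl
  ... | k , inj₂ refl = suc k , inj₁ (cong suc (sym (ℕ.+-suc k k)))

  module _ where
    odd*odd : ∀ {x y} → Odd x → Odd y → Odd (x * y)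
    odd*odd (a , refl) (b , refl) = 2ℤ * a * b + a + b , eq a b
      where
      eq : ∀ a b → (2ℤ * a + 1ℤ) * (2ℤ * b + 1ℤ) ≡ 2ℤ * (2ℤ * a * b + a + b) + 1ℤ
      eq = solve-∀

    odd-pow : ∀ {x} → Odd x → ∀ n → Odd (pow x n)
    odd-pow ox zero    = 0ℤ , refl
    odd-pow ox (suc n) = odd*odd ox (odd-pow ox n)

    even-pow : ∀ {x} → Even x → ∀ n → Even (pow x (suc n))
    even-pow {x} (a , refl) n = a * pow x n , ℤ.*-assoc 2ℤ a (pow x n)

    odd-odd : ∀ {x y} → Odd x → Odd y → Even (x - y)
    odd-odd (a , refl) (b , refl) = a - b , eq a b
      where
      eq : ∀ a b → (2ℤ * a + 1ℤ) - (2ℤ * b + 1ℤ) ≡ 2ℤ * (a - b)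
      eq = solve-∀

    even-even : ∀ {x y} → Even x → Even y → Even (x - y)
    even-even (a , refl) (b , refl) = a - b , eq a b
      where
      eq : ∀ a b → 2ℤ * a - 2ℤ * b ≡ 2ℤ * (a - b)
      eq = solve-∀

    even-odd : ∀ {x y} → Even x → Odd y → Odd (x - y)
    even-odd (a , refl) (b , refl) = a - b - 1ℤ , eq a b
      where
      eq : ∀ a b → 2ℤ * a - (2ℤ * b + 1ℤ) ≡ 2ℤ * (a - b - 1ℤ) + 1ℤ
      eq = solve-∀

    odd-even : ∀ {x y} → Odd x → Even y → Odd (x - y)
    odd-even (a , refl) (b , refl) = a - b , eq a b
      where
      eq : ∀ a b → (2ℤ * a + 1ℤ) - 2ℤ * b ≡ 2ℤ * (a - b) + 1ℤ
      eq = solve-∀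

    pow-* : ∀ x y n → pow (x * y) n ≡ pow x n * pow y n
    pow-* x y zero    = refl
    pow-* x y (suc n) = trans (cong ((x * y) *_) (pow-* x y n)) (eq x y (pow x n) (pow y n))
      where
      eq : ∀ x y a b → (x * y) * (a * b) ≡ (x * a) * (y * b)
      eq = solve-∀

    pow-double : ∀ x n → pow x (n ℕ.+ n) ≡ pow (x * x) n
    pow-double x zero    = refl
    pow-double x (suc n) = trans (cong (λ k → x * pow x k) (ℕ.+-suc n n))
      (trans (sym (ℤ.*-assoc x x (pow x (n ℕ.+ n)))) (cong ((x * x) *_) (pow-double x n)))

    -- (xⁿ − yⁿ) / (x − y)
    quotient : ℤ → ℤ → ℕ → ℤ
    quotient x y zero    = 0ℤ
    quotient x y (suc n) = x * quotient x y n + pow y n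

    pow-difference : ∀ x y n → pow x n - pow y n ≡ (x - y) * quotient x y n
    pow-difference x y zero    = sym (ℤ.*-zeroʳ (x - y))
    pow-difference x y (suc n) = trans (eq₁ x y (pow x n) (pow y n))
      (trans (cong (λ d → x * d + (x - y) * pow y n) (pow-difference x y n)) (eq₂ x y (quotient x y n) (pow y n)))
      where
      eq₁ : ∀ x y a b → x * a - y * b ≡ x * (a - b) + (x - y) * b
      eq₁ = solve-∀
      eq₂ : ∀ x y q b → x * ((x - y) * q) + (x - y) * b ≡ (x - y) * (x * q + b)
      eq₂ = solve-∀

    -- The quotient is a sum of products of powers of x and y, all odd, so its parity is that of the
    -- number of summands.
    quotient-odd : ∀ {x y} → Odd x → Odd y → ∀ k → Odd (quotient x y (suc (k ℕ.+ k)))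
    quotient-even : ∀ {x y} → Odd x → Odd y → ∀ k → Even (quotient x y (k ℕ.+ k))
    quotient-odd {x} {y} ox oy k with quotient-even ox oy k | odd-pow oy (k ℕ.+ k)
    ... | q , eq | p , eq′ = x * q + p , trans (cong₂ (λ a b → x * a + b) eq eq′) (rearrange x q p)
      where
      rearrange : ∀ x q p → x * (2ℤ * q) + (2ℤ * p + 1ℤ) ≡ 2ℤ * (x * q + p) + 1ℤ
      rearrange = solve-∀
    quotient-even ox oy zero    = 0ℤ , refl
    quotient-even {x} {y} ox oy (suc k) with odd*odd ox (quotient-odd ox oy k) | odd-pow oy (suc (k ℕ.+ k))
    ... | q , eq | p , eq′ = q + p + 1ℤ , trans (cong (quotient x y) (cong suc (ℕ.+-suc k k)))
        (trans (cong₂ _+_ eq eq′) (rearrange q p))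
      where
      rearrange : ∀ q p → (2ℤ * q + 1ℤ) + (2ℤ * p + 1ℤ) ≡ 2ℤ * (q + p + 1ℤ)
      rearrange = solve-∀

    -- For two such numbers x + y is twice an odd number, so doubling the exponent adds exactly 1 to
    -- the valuation. Squares of odd numbers qualify.
    OneMod4 : ℤ → Set
    OneMod4 x = ∃[ y ] x ≡ + 4 * y + 1ℤ

    odd-square : ∀ {x} → Odd x → OneMod4 (x * x)
    odd-square (a , refl) = a * a + a , eq a
      where
      eq : ∀ a → (2ℤ * a + 1ℤ) * (2ℤ * a + 1ℤ) ≡ + 4 * (a * a + a) + 1ℤ
      eq = solve-∀

    oneMod4-odd : ∀ {x} → OneMod4 x → Odd x
    oneMod4-odd (a , refl) = 2ℤ * a , eq a
      where
      eq : ∀ a → + 4 * a + 1ℤ ≡ 2ℤ * (2ℤ * a) + 1ℤ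
      eq = solve-∀

    -- For x, y ≡ 1 mod 4 the 2-adic valuation of (xᵘ − yᵘ) / (x − y) depends on u only.
    lifting : ∀ u → 1 ℕ.≤ u → ∃[ p ] (∀ {x y} → OneMod4 x → OneMod4 y → ∃[ q ] Odd q × pow x u - pow y u ≡ (x - y) * (p * q))
    lifting = <-rec _ step
      where
      step : ∀ u → (∀ {w} → w ℕ.< u → 1 ℕ.≤ w → ∃[ p ] (∀ {x y} → OneMod4 x → OneMod4 y → ∃[ q ] Odd q × pow x w - pow y w ≡ (x - y) * (p * q))) →
             1 ℕ.≤ u → ∃[ p ] (∀ {x y} → OneMod4 x → OneMod4 y → ∃[ q ] Odd q × pow x u - pow y u ≡ (x - y) * (p * q))
      step u rec 1≤u with parity u
      ... | k , inj₂ refl = 1ℤ , λ {x} {y} ox oy → quotient x y u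
          , quotient-odd (oneMod4-odd ox) (oneMod4-odd oy) k
          , trans (pow-difference x y u) (cong ((x - y) *_) (sym (ℤ.*-identityˡ (quotient x y u))))
      ... | zero , inj₁ refl = ⊥-elim (ℕ.1+n≰n 1≤u)
      ... | suc w , inj₁ refl with rec {suc w} (ℕ.m<m+n (suc w) (ℕ.s≤s ℕ.z≤n)) (ℕ.s≤s ℕ.z≤n)
      ...   | p , lift = 2ℤ * p , double
        where
        double : ∀ {x y} → OneMod4 x → OneMod4 y → ∃[ q ] Odd q × pow x (suc w ℕ.+ suc w) - pow y (suc w ℕ.+ suc w) ≡ (x - y) * (2ℤ * p * q)
        double {x} {y} ox@(a , refl) oy@(b , refl) with lift (odd-square (oneMod4-odd ox)) (odd-square (oneMod4-odd oy))
        -- The new odd factor is (x + y) / 2 for x = 4a + 1 and y = 4b + 1.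
        ... | q , odd-q , eq = (2ℤ * (a + b) + 1ℤ) * q , odd*odd (a + b , refl) odd-q
          , trans (cong₂ _-_ (pow-double x (suc w)) (pow-double y (suc w))) (trans eq (rearrange a b p q))
          where
          rearrange : ∀ a b p q → ((+ 4 * a + 1ℤ) * (+ 4 * a + 1ℤ) - (+ 4 * b + 1ℤ) * (+ 4 * b + 1ℤ)) * (p * q)
                    ≡ ((+ 4 * a + 1ℤ) - (+ 4 * b + 1ℤ)) * (2ℤ * p * ((2ℤ * (a + b) + 1ℤ) * q))
          rearrange = solve-∀

    -- μ m k is the eigenvalue θ (m − k) of J(2m, m).
    μ : ℕ → ℕ → ℤ
    μ m k = + k * + k + + k - + m

    -- Minus (d) stands for e^{iτd} = −1.
    module _ (Minus : ℤ → Set)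
             (clash : ∀ {x y b c} → Minus x → Minus y → Odd c → x * (2ℤ * b) ≡ y * c → ⊥) where

      module _ {m r : ℕ} (minus : ∀ k → suc k ℕ.≤ m → Minus (pow (μ m k) r - pow (μ m (suc k)) r)) where

        -- All eigenvalues are even. After halving, the first three are x₀, x₀ + 1 and x₀ + 3, so
        -- the gap of the powers is 2ʳ times an odd number for k = 0 and 2ʳ times an even number for
        -- k = 1; `clash` excludes a larger valuation in the second gap.
        clash-even : ∀ {t s} → m ≡ suc t ℕ.+ suc t → r ≡ suc s → ⊥
        clash-even {t} {s} refl refl = clash-with (parity t)
          where
          x₀ x₁ x₂ : ℤ
          x₀ = - + suc t
          x₁ = 1ℤ - + suc t
          x₂ = + 3 - + suc t
          p : ℤ
          p = pow 2ℤ r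
          difference : ∀ {a b} {x y} → a ≡ 2ℤ * x → b ≡ 2ℤ * y → pow a r - pow b r ≡ p * (pow x r - pow y r)
          difference {x = x} {y} refl refl = trans (cong₂ _-_ (pow-* 2ℤ x r) (pow-* 2ℤ y r))
            (eq p (pow x r) (pow y r))
            where
            eq : ∀ p a b → p * a - p * b ≡ p * (a - b)
            eq = solve-∀
          μ₀ : ∀ t → 0ℤ * 0ℤ + 0ℤ - (t + t) ≡ 2ℤ * (- t)
          μ₀ = solve-∀
          μ₁ : ∀ t → 1ℤ * 1ℤ + 1ℤ - (t + t) ≡ 2ℤ * (1ℤ - t)
          μ₁ = solve-∀
          μ₂ : ∀ t → 2ℤ * 2ℤ + 2ℤ - (t + t) ≡ 2ℤ * (+ 3 - t)
          μ₂ = solve-∀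
          conclude : Odd (pow x₀ r - pow x₁ r) → Even (pow x₁ r - pow x₂ r) → ⊥
          conclude odd₀ (q , eq₁) = clash {b = q} (minus 0 (ℕ.s≤s ℕ.z≤n))
              (minus 1 (ℕ.s≤s (ℕ.≤-trans (ℕ.s≤s ℕ.z≤n) (ℕ.m≤n+m (suc t) t)))) odd₀
            (trans (cong (_* (2ℤ * q)) (difference (μ₀ (+ suc t)) (μ₁ (+ suc t))))
            (trans (rearrange p (pow x₀ r - pow x₁ r) (2ℤ * q))
            (cong (_* (pow x₀ r - pow x₁ r)) (sym (trans (difference (μ₁ (+ suc t)) (μ₂ (+ suc t))) (cong (p *_) eq₁))))))
            where
            rearrange : ∀ p a b → p * a * b ≡ p * b * a
            rearrange = solve-∀
          clash-with : ∃[ k ] (t ≡ k ℕ.+ k ⊎ t ≡ suc (k ℕ.+ k)) → ⊥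
          clash-with (k , inj₁ refl) = conclude
            (odd-even (odd-pow (- + k - 1ℤ , e₀ (+ k)) r) (even-pow (- + k , e₁ (+ k)) s))
            (even-even (even-pow (- + k , e₁ (+ k)) s) (even-pow (1ℤ - + k , e₂ (+ k)) s))
            where
            e₀ : ∀ k → - (1ℤ + (k + k)) ≡ 2ℤ * (- k - 1ℤ) + 1ℤ
            e₀ = solve-∀
            e₁ : ∀ k → 1ℤ - (1ℤ + (k + k)) ≡ 2ℤ * (- k)
            e₁ = solve-∀
            e₂ : ∀ k → + 3 - (1ℤ + (k + k)) ≡ 2ℤ * (1ℤ - k)
            e₂ = solve-∀
          clash-with (k , inj₂ refl) = conclude
            (even-odd (even-pow (- + k - 1ℤ , e₀ (+ k)) s) (odd-pow (- + k - 1ℤ , e₁ (+ k)) r))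
            (odd-odd (odd-pow (- + k - 1ℤ , e₁ (+ k)) r) (odd-pow (- + k , e₂ (+ k)) r))
            where
            e₀ : ∀ k → - (1ℤ + (1ℤ + (k + k))) ≡ 2ℤ * (- k - 1ℤ)
            e₀ = solve-∀
            e₁ : ∀ k → 1ℤ - (1ℤ + (1ℤ + (k + k))) ≡ 2ℤ * (- k - 1ℤ) + 1ℤ
            e₁ = solve-∀
            e₂ : ∀ k → + 3 - (1ℤ + (1ℤ + (k + k))) ≡ 2ℤ * (- k) + 1ℤ
            e₂ = solve-∀

        -- The eigenvalues are odd and an odd exponent makes the quotients (xʳ - yʳ) / (x - y) odd,
        -- so the gaps -2 and -4 of the first three eigenvalues keep their valuations 1 and 2.
        clash-odd-odd : ∀ {t s} → m ≡ suc (suc t ℕ.+ suc t) → r ≡ suc (s ℕ.+ s) → ⊥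
        clash-odd-odd {t} {s} refl refl = clash {b = quotient x₁ x₂ r} (minus 0 (ℕ.s≤s ℕ.z≤n)) (minus 1 (ℕ.s≤s (ℕ.s≤s ℕ.z≤n)))
          (quotient-odd (- + suc t - 1ℤ , e₀ (+ suc t)) (- + suc t , e₁ (+ suc t)) s)
          (trans (cong (_* (2ℤ * quotient x₁ x₂ r)) (pow-difference x₀ x₁ r))
          (trans (rearrange (+ suc t) (quotient x₀ x₁ r) (quotient x₁ x₂ r))
          (cong (_* quotient x₀ x₁ r) (sym (pow-difference x₁ x₂ r)))))
          where
          x₀ x₁ x₂ : ℤ
          x₀ = μ m 0
          x₁ = μ m 1
          x₂ = μ m 2
          e₀ : ∀ t → 0ℤ * 0ℤ + 0ℤ - (1ℤ + (t + t)) ≡ 2ℤ * (- t - 1ℤ) + 1ℤ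
          e₀ = solve-∀
          e₁ : ∀ t → 1ℤ * 1ℤ + 1ℤ - (1ℤ + (t + t)) ≡ 2ℤ * (- t) + 1ℤ
          e₁ = solve-∀
          rearrange : ∀ t a b → ((0ℤ * 0ℤ + 0ℤ - (1ℤ + (t + t))) - (1ℤ * 1ℤ + 1ℤ - (1ℤ + (t + t)))) * a * (2ℤ * b)
                              ≡ ((1ℤ * 1ℤ + 1ℤ - (1ℤ + (t + t))) - (2ℤ * 2ℤ + 2ℤ - (1ℤ + (t + t)))) * b * a
          rearrange = solve-∀

        -- With r = 2u the squares of the odd eigenvalues satisfy μ₁² − μ₂² = −8·odd and μ₃² − μ₄² = −16·odd.
        clash-odd-even : ∀ {t s} → m ≡ suc (suc (suc t) ℕ.+ suc (suc t)) → r ≡ suc s ℕ.+ suc s → ⊥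
        clash-odd-even {t} {s} refl refl with lifting (suc s) (ℕ.s≤s ℕ.z≤n)
        ... | p , lift with lift (odd-square (odd-μ 1 e₁)) (odd-square (odd-μ 2 e₂)) | lift (odd-square (odd-μ 3 e₃)) (odd-square (odd-μ 4 e₄))
          where
          odd-μ : ∀ k → (∀ t → ∃[ y ] + k * + k + + k - (1ℤ + (t + t)) ≡ 2ℤ * y + 1ℤ) → Odd (μ m k)
          odd-μ k e = e (+ suc (suc t))
          e₁ : ∀ t → ∃[ y ] 1ℤ * 1ℤ + 1ℤ - (1ℤ + (t + t)) ≡ 2ℤ * y + 1ℤ
          e₁ t = - t , eq t
            where
            eq : ∀ t → 1ℤ * 1ℤ + 1ℤ - (1ℤ + (t + t)) ≡ 2ℤ * (- t) + 1ℤ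
            eq = solve-∀
          e₂ : ∀ t → ∃[ y ] 2ℤ * 2ℤ + 2ℤ - (1ℤ + (t + t)) ≡ 2ℤ * y + 1ℤ
          e₂ t = 2ℤ - t , eq t
            where
            eq : ∀ t → 2ℤ * 2ℤ + 2ℤ - (1ℤ + (t + t)) ≡ 2ℤ * (2ℤ - t) + 1ℤ
            eq = solve-∀
          e₃ : ∀ t → ∃[ y ] + 3 * + 3 + + 3 - (1ℤ + (t + t)) ≡ 2ℤ * y + 1ℤ
          e₃ t = + 5 - t , eq t
            where
            eq : ∀ t → + 3 * + 3 + + 3 - (1ℤ + (t + t)) ≡ 2ℤ * (+ 5 - t) + 1ℤ
            eq = solve-∀
          e₄ : ∀ t → ∃[ y ] + 4 * + 4 + + 4 - (1ℤ + (t + t)) ≡ 2ℤ * y + 1ℤ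
          e₄ t = + 9 - t , eq t
            where
            eq : ∀ t → + 4 * + 4 + + 4 - (1ℤ + (t + t)) ≡ 2ℤ * (+ 9 - t) + 1ℤ
            eq = solve-∀
        ...   | q , odd-q , eq | q′ , odd-q′ , eq′ =
          -- With m = 2T + 1 the gaps of the powers are -8(3 - 2T) p q and -16(15 - 2T) p q′;
          -- cross-multiplying by the odd parts leaves a single factor 2 on the left.
          clash {b = (+ 15 - 2ℤ * T) * q′} (minus 1 1<m) (minus 3 3<m)
            (odd*odd (1ℤ - T , three T) odd-q)
            (trans (cong (_* (2ℤ * ((+ 15 - 2ℤ * T) * q′)))
                     (trans (cong₂ _-_ (pow-double (μ m 1) (suc s)) (pow-double (μ m 2) (suc s))) eq))
            (trans (rearrange T p q q′)
            (cong (_* ((+ 3 - 2ℤ * T) * q))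
               (sym (trans (cong₂ _-_ (pow-double (μ m 3) (suc s)) (pow-double (μ m 4) (suc s))) eq′)))))
          where
          T : ℤ
          T = + suc (suc t)
          4<m : 5 ℕ.≤ m
          4<m = ℕ.s≤s (ℕ.+-mono-≤ {2} {suc (suc t)} {2} (ℕ.s≤s (ℕ.s≤s ℕ.z≤n)) (ℕ.s≤s (ℕ.s≤s ℕ.z≤n)))
          1<m : 2 ℕ.≤ m
          1<m = ℕ.≤-trans (ℕ.s≤s (ℕ.s≤s ℕ.z≤n)) 4<m
          3<m : 4 ℕ.≤ m
          3<m = ℕ.≤-trans (ℕ.n≤1+n 4) 4<m
          three : ∀ t → + 3 - 2ℤ * t ≡ 2ℤ * (1ℤ - t) + 1ℤ
          three = solve-∀
          rearrange : ∀ t p q q′ →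
            ((1ℤ * 1ℤ + 1ℤ - (1ℤ + (t + t))) * (1ℤ * 1ℤ + 1ℤ - (1ℤ + (t + t)))
            - (2ℤ * 2ℤ + 2ℤ - (1ℤ + (t + t))) * (2ℤ * 2ℤ + 2ℤ - (1ℤ + (t + t))))
            * (p * q) * (2ℤ * ((+ 15 - 2ℤ * t) * q′))
            ≡ ((+ 3 * + 3 + + 3 - (1ℤ + (t + t))) * (+ 3 * + 3 + + 3 - (1ℤ + (t + t)))
            - (+ 4 * + 4 + + 4 - (1ℤ + (t + t))) * (+ 4 * + 4 + + 4 - (1ℤ + (t + t)))) * (p * q′) * ((+ 3 - 2ℤ * t) * q)
          rearrange = solve-∀

        -- The eigenvalues -1 and 1 have the same even powers, so the gap is 0 and its phase would
        -- be both 1 and -1; hence the factors 0 and 1 in `clash`.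
        clash-1-even : ∀ {s} → m ≡ 1 → r ≡ s ℕ.+ s → ⊥
        clash-1-even {s} refl refl = clash {b = 0ℤ} d d (0ℤ , refl)
          (trans (ℤ.*-zeroʳ (pow (μ 1 0) r - pow (μ 1 1) r)) (sym (cong (_* 1ℤ) zero-difference)))
          where
          d = minus 0 (ℕ.s≤s ℕ.z≤n)
          zero-difference : pow (μ 1 0) r - pow (μ 1 1) r ≡ 0ℤ
          zero-difference = trans (cong₂ _-_ (pow-double (μ 1 0) s) (pow-double (μ 1 1) s)) (ℤ.+-inverseʳ (pow 1ℤ s))

        only-cases : 1 ℕ.≤ m → 1 ℕ.≤ r →
          (m ≡ 1 × ∃[ s ] r ≡ suc (s ℕ.+ s)) ⊎ (m ≡ 3 × ∃[ s ] r ≡ s ℕ.+ s)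
        only-cases 1≤m 1≤r with parity m | parity r
        ... | zero , inj₁ refl | _ = ⊥-elim (ℕ.1+n≰n 1≤m)
        ... | suc t , inj₁ eq | _ = ⊥-elim (clash-even eq (sym (ℕ.suc-pred r {{ℕ.>-nonZero 1≤r}})))
        ... | zero , inj₂ eq | s , inj₁ eq′ = ⊥-elim (clash-1-even {s} eq eq′)
        ... | zero , inj₂ eq | s , inj₂ eq′ = inj₁ (eq , s , eq′)
        ... | suc t , inj₂ eq | s , inj₂ eq′ = ⊥-elim (clash-odd-odd {t} {s} eq eq′)
        -- For m = 3 the powers are 3ʳ, 1, 3ʳ and 9ʳ; all consecutive differences have the valuation
        -- of 3ʳ - 1, so no contradiction arises.
        ... | suc zero , inj₂ eq | s , inj₁ eq′ = inj₂ (eq , s , eq′)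
        ... | suc (suc t) , inj₂ eq | zero , inj₁ refl = ⊥-elim (ℕ.1+n≰n 1≤r)
        ... | suc (suc t) , inj₂ eq | suc s , inj₁ eq′ = ⊥-elim (clash-odd-even {t} {s} eq eq′)

-- Spectral data of J(6, 3) and J(2, 1).

module AntipodalSpectra where

  open import Data.Fin.Subset using (∣_∣; _∩_; ∁)
  open Evolution using (module Sumsℤ; module Linℤ)
  open JohnsonEigenvectors

  all-equal? : ∀ {v m} (f g : Vertex v m → Vertex v m → ℤ) →
               Dec (All (λ x → All (λ y → f x y ≡ g x y) (vertices v m)) (vertices v m))
  all-equal? {v} {m} f g = all? (λ x → all? (λ y → f x y ℤ.≟ g x y) (vertices v m)) (vertices v m)

  abstract
    -- J(6, 3) has 400 pairs of vertices, few enough for integer identities between matrices to be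
    -- decided entry by entry.
    by-enumeration : ∀ {v m} (f g : Vertex v m → Vertex v m → ℤ) → True (all-equal? f g) → ∀ x y → f x y ≡ g x y
    by-enumeration {v} {m} f g all x y =
      All-lookup (All-lookup (toWitness all) (vertices-complete v m x)) (vertices-complete v m y)

  meet : ∀ {v m} → Vertex v m → Vertex v m → ℕ
  meet x y = ∣ proj₁ x ∩ proj₁ y ∣

  disjointness : ∀ {v m} → Vertex v m → Vertex v m → ℤ
  disjointness x y = ⟦ meet x y ≡ 0 ⟧

  -- The idempotents are C j / D, and complementation is their combination with coefficients sign j.
  record AntipodalSpectrum (v m : ℕ) : Set where
    field
      size       : ℕ
      idempotent : Fin size → ℕ → ℤ
      eigenvalue : Fin size → ℤ
      sign       : Fin size → ℤ
      D          : ℕ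
      D-nonZero  : ℕ.NonZero D

    C : Fin size → Vertex v m → Vertex v m → ℤ
    C j x y = idempotent j (meet x y)

    field
      eigenvectors : ∀ j x y → Sumsℤ.sum (λ z → adjacencyℤ v m x z ℤ.* C j z y) (vertices v m) ≡ eigenvalue j ℤ.* C j x y
      resolution   : ∀ x y → Sumsℤ.sum (λ j → C j x y) (allFin size) ≡ ℤ.+ D ℤ.* Linℤ.basis (Johnson v m) x y
      antipodal    : ∀ x y → Sumsℤ.sum (λ j → sign j ℤ.* C j x y) (allFin size) ≡ ℤ.+ D ℤ.* disjointness x y
      disjoint     : ∀ (x y : Vertex v m) →
                     disjointness x y ≡ (if does (≡-dec Bool._≟_ (∁ (proj₁ y)) (proj₁ x)) then 1ℤ else 0ℤ)

  module _ {v m n : ℕ} (c : Fin n → ℕ → ℤ) (eigenvalue sign : Fin n → ℤ) (D : ℕ) .{{_ : ℕ.NonZero D}} where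

    private
      C : Fin n → Vertex v m → Vertex v m → ℤ
      C j x y = c j (meet x y)

      A·C θC : Fin n → Vertex v m → Vertex v m → ℤ
      A·C j x y = Sumsℤ.sum (λ z → adjacencyℤ v m x z ℤ.* C j z y) (vertices v m)
      θC j x y = eigenvalue j ℤ.* C j x y

      ΣC D·I ΣsC D·T T : Vertex v m → Vertex v m → ℤ
      ΣC x y = Sumsℤ.sum (λ j → C j x y) (allFin n)
      D·I x y = ℤ.+ D ℤ.* Linℤ.basis (Johnson v m) x y
      ΣsC x y = Sumsℤ.sum (λ j → sign j ℤ.* C j x y) (allFin n)
      D·T x y = ℤ.+ D ℤ.* disjointness x y
      T x y = if does (≡-dec Bool._≟_ (∁ (proj₁ y)) (proj₁ x)) then 1ℤ else 0ℤ

    spectrum-by-enumeration : (∀ j → True (all-equal? (A·C j) (θC j))) → True (all-equal? ΣC D·I) →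
      True (all-equal? ΣsC D·T) → True (all-equal? disjointness T) → AntipodalSpectrum v m
    spectrum-by-enumeration p q r s = record
      { size = n ; idempotent = c ; eigenvalue = eigenvalue ; sign = sign ; D = D ; D-nonZero = ℕ.>-nonZero (ℕ.>-nonZero⁻¹ D)
      ; eigenvectors = λ j → by-enumeration (A·C j) (θC j) (p j)
      ; resolution = by-enumeration ΣC D·I q
      ; antipodal = by-enumeration ΣsC D·T r
      ; disjoint = by-enumeration disjointness T s }

  -- The spectral idempotents of J(6, 3), times 60, as functions of ∣ x ∩ y ∣.
  idempotent₆ : Fin 4 → ℕ → ℤ
  idempotent₆ 0F _ = ℤ.+ 3
  idempotent₆ 1F 3 = ℤ.+ 15
  idempotent₆ 1F 2 = ℤ.+ 5
  idempotent₆ 1F 1 = ℤ.- ℤ.+ 5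
  idempotent₆ 1F _ = ℤ.- ℤ.+ 15
  idempotent₆ 2F 3 = ℤ.+ 27
  idempotent₆ 2F 2 = ℤ.- ℤ.+ 3
  idempotent₆ 2F 1 = ℤ.- ℤ.+ 3
  idempotent₆ 2F _ = ℤ.+ 27
  idempotent₆ 3F 3 = ℤ.+ 15
  idempotent₆ 3F 2 = ℤ.- ℤ.+ 5
  idempotent₆ 3F 1 = ℤ.+ 5
  idempotent₆ 3F _ = ℤ.- ℤ.+ 15

  eigenvalue₆ : Fin 4 → ℤ
  eigenvalue₆ 0F = ℤ.+ 9
  eigenvalue₆ 1F = ℤ.+ 3
  eigenvalue₆ 2F = -1ℤ
  eigenvalue₆ 3F = ℤ.- ℤ.+ 3

  sign₆ : Fin 4 → ℤ
  sign₆ 0F = 1ℤ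
  sign₆ 1F = -1ℤ
  sign₆ 2F = 1ℤ
  sign₆ 3F = -1ℤ

  spectrum₆ : AntipodalSpectrum 6 3
  -- The eigenvalues have multiplicities 1, 5, 9 and 5 on 20 vertices; over the denominator 60 the
  -- diagonal entries are three times these.
  spectrum₆ = spectrum-by-enumeration idempotent₆ eigenvalue₆ sign₆ 60 (λ { 0F → _ ; 1F → _ ; 2F → _ ; 3F → _ }) _ _ _

  idempotent₂ : Fin 2 → ℕ → ℤ
  idempotent₂ 0F _ = 1ℤ
  idempotent₂ 1F 1 = 1ℤ
  idempotent₂ 1F _ = -1ℤ

  eigenvalue₂ : Fin 2 → ℤ
  eigenvalue₂ 0F = 1ℤ
  eigenvalue₂ 1F = -1ℤ

  spectrum₂ : AntipodalSpectrum 2 1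
  -- The adjacency matrix of K₂ is itself complementation, so the signs are the eigenvalues.
  spectrum₂ = spectrum-by-enumeration idempotent₂ eigenvalue₂ eigenvalue₂ 2 (λ { 0F → _ ; 1F → _ }) _ _ _

-- Phases, transfer times and the two cases.

module StateTransfer where

  open import Data.Rational.Base
  open import Data.Rational.Properties as ℚ
  open Analysis
  open MatrixAlgebra
  open Evolution
  open JohnsonEigenvectors
  open EigenvalueParity
  open AntipodalSpectra

  open Sumsℤ using (pow)

  -- e^{iτc} = s; in the applications s is 1 or -1.
  Phase : ℝ → ℤ → ℤ → Set
  Phase τ c s = Approx Seq (phase τ c) (λ _ → emb s)

  -- A nonzero integer has norm at least 1. Limit statements become integer equations through this
  -- discreteness.
  emb-null : ∀ {s} → Null Seq (λ _ → emb s) → s ≡ 0ℤ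
  emb-null {s} (mkNull h) with s ℤ.≟ 0ℤ
  ... | yes s≡0 = s≡0
  ... | no s≢0 = ⊥-elim (<-irrefl refl (<-≤-trans (proj₂ (h 1ℚ (positive⁻¹ 1ℚ)) _ ℕ.≤-refl) (large s s≢0)))
    where
    large : ∀ s → s ≢ 0ℤ → 1ℚ ≤ ‖ emb s ‖
    large (ℤ.+ zero)    s≢0 = ⊥-elim (s≢0 refl)
    large (ℤ.+ suc n)   _   = ≤-trans (fromℕ-mono-≤ {1} {suc n} (ℕ.s≤s ℕ.z≤n)) (≤-reflexive (sym (‖real‖ (fromℤ (ℤ.+ suc n)))))
    large (ℤ.-[1+ n ])  _   = ≤-trans (fromℕ-mono-≤ {1} {suc n} (ℕ.s≤s ℕ.z≤n)) (≤-reflexive (sym (‖real‖ (fromℤ (ℤ.-[1+ n ])))))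

  module _ {τ : ℝ} where

    phase-0 : Phase τ 0ℤ 1ℤ
    phase-0 = cis-null (null-≗ (λ m → cong imag (*-zeroʳ (seq τ m))) null-0)

    phase-+≈ : ∀ c d → Approx Seq (phase τ (c ℤ.+ d)) (λ m → phase τ c m *ᵍ phase τ d m)
    phase-+≈ c d = ≈-trans
      (≈-reflexive λ m → cong (λ q → expo m (imag q)) (trans (cong (seq τ m *_) (fromℤ-+ c d)) (*-distribˡ-+ (seq τ m) (fromℤ c) (fromℤ d))))
      (cis-+ (phase-exponent-bounded τ c) (phase-exponent-bounded τ d))

    phase-+ : ∀ {c d s t} → Phase τ c s → Phase τ d t → Phase τ (c ℤ.+ d) (s ℤ.* t)
    phase-+ {c} {d} {s} {t} p q = ≈-trans (phase-+≈ c d)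
      (≈-trans (≈-* (bounded-const (emb s)) (bounded-const (emb t)) p q)
        (≈-reflexive (λ _ → sym (emb-* s t))))

    phase-unique : ∀ {c s t} → Phase τ c s → Phase τ c t → s ≡ t
    phase-unique {c} {s} {t} p q = ℤ.i-j≡0⇒i≡j s t (emb-null (null-≗ (λ _ → emb-- s t) (null (≈-trans (≈-sym p) q))))
      where
      emb-- : ∀ s t → emb (s ℤ.- t) ≡ emb s -ᵍ emb t
      emb-- s t = trans (emb-+ s (ℤ.- t)) (cong (λ q → emb s +ᵍ real q) (fromℤ-neg t))

    phase-neg≈ : ∀ c → Approx Seq (λ m → phase τ c m *ᵍ phase τ (ℤ.- c) m) (λ _ → 1ᵍ)
    phase-neg≈ c = ≈-trans (≈-sym (phase-+≈ c (ℤ.- c)))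
      (≈-trans (≈-reflexive λ m → cong (λ i → phase τ i m) (ℤ.+-inverseʳ c)) phase-0)

    phase-neg : ∀ {c} → Phase τ c 1ℤ → Phase τ (ℤ.- c) 1ℤ
    phase-neg {c} p = ≈-trans (≈-reflexive λ m → sym (*ᵍ-identityˡ (phase τ (ℤ.- c) m)))
      (≈-trans (≈-* (cis-bounded (phase-exponent-bounded τ c)) (cis-bounded (phase-exponent-bounded τ (ℤ.- c))) (≈-sym p) ≈-refl)
        (phase-neg≈ c))

    phase-*ℕ : ∀ {c} n → Phase τ c 1ℤ → Phase τ (c ℤ.* ℤ.+ n) 1ℤ
    phase-*ℕ {c} zero    p = subst (λ i → Phase τ i 1ℤ) (sym (ℤ.*-zeroʳ c)) phase-0
    phase-*ℕ {c} (suc n) p = subst (λ i → Phase τ i 1ℤ) (sym (ℤ.*-suc c (ℤ.+ n))) (phase-+ {c} {c ℤ.* ℤ.+ n} p (phase-*ℕ {c} n p))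

    phase-* : ∀ {c} i → Phase τ c 1ℤ → Phase τ (c ℤ.* i) 1ℤ
    phase-* {c} (ℤ.+ n)    p = phase-*ℕ {c} n p
    phase-* {c} ℤ.-[1+ n ] p = subst (λ i → Phase τ i 1ℤ) (ℤ.neg-distribʳ-* c (ℤ.+ suc n))
      (phase-neg {c ℤ.* ℤ.+ suc n} (phase-*ℕ {c} (suc n) p))

    phase-even : ∀ {c} b → Phase τ c -1ℤ → Phase τ (c ℤ.* (2ℤ ℤ.* b)) 1ℤ
    phase-even {c} b p = subst (λ i → Phase τ i 1ℤ) (eq c b) (phase-* {c ℤ.+ c} b (phase-+ {c} {c} p p))
      where
      eq : ∀ c b → (c ℤ.+ c) ℤ.* b ≡ c ℤ.* (2ℤ ℤ.* b)
      eq = solve-∀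

    phase-odd : ∀ {c d} → Odd d → Phase τ c -1ℤ → Phase τ (c ℤ.* d) -1ℤ
    phase-odd {c} (b , refl) p = subst (λ i → Phase τ i -1ℤ) (eq c b) (phase-+ {c ℤ.* (2ℤ ℤ.* b)} {c} (phase-even {c} b p) p)
      where
      eq : ∀ c b → c ℤ.* (2ℤ ℤ.* b) ℤ.+ c ≡ c ℤ.* (2ℤ ℤ.* b ℤ.+ 1ℤ)
      eq = solve-∀

    -- The common value of the two products would have phase (-1)^{2b} = 1 and phase (-1)^c = -1.
    phase-clash : ∀ {x y b c} → Phase τ x -1ℤ → Phase τ y -1ℤ → Odd c → x ℤ.* (2ℤ ℤ.* b) ≡ y ℤ.* c → ⊥
    phase-clash {x} {y} {b} {c} px py oc eq = 1≢-1 (phase-unique {x ℤ.* (2ℤ ℤ.* b)} {1ℤ} {ℤ.- 1ℤ} (phase-even {x} b px)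
      (subst (λ i → Phase τ i -1ℤ) (sym eq) (phase-odd {y} oc py)))
      where
      1≢-1 : 1ℤ ≢ -1ℤ
      1≢-1 ()

    -- The unknown factor γ cancels in the quotient of the two phases.
    phase-ratio : ∀ {c d γ s} → Bounded Seq γ → Approx Seq (phase τ c) (λ m → γ m *ᵍ emb s) →
      Approx Seq (phase τ d) (λ m → γ m *ᵍ emb (ℤ.- s)) → Phase τ (c ℤ.- d) -1ℤ
    phase-ratio {c} {d} {γ} {s} bγ p q =
      ≈-trans (phase-+≈ c (ℤ.- d))
      (≈-trans (≈-* (bounded-neg (cis-bounded (phase-exponent-bounded τ d))) b-d opposite ≈-refl)
      (≈-trans (≈-reflexive λ m → move (phase τ d m) (phase τ (ℤ.- d) m))
      (≈-trans (≈-* (bounded-const -1ᵍ) (bounded-const 1ᵍ) ≈-refl (phase-neg≈ d))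
        (≈-reflexive λ _ → refl))))
      where
      b-d : Bounded Seq (phase τ (ℤ.- d))
      b-d = cis-bounded (phase-exponent-bounded τ (ℤ.- d))
      bounded-neg : ∀ {u : ℕ → 𝔾} → Bounded Seq u → Bounded Seq (λ m → -1ᵍ *ᵍ u m)
      bounded-neg {u} (mkBounded B 0<B (N , u≤B)) = mkBounded B 0<B
        (N , λ m le → ≤-trans (≤-reflexive (trans (cong ‖_‖ (minus (u m))) (‖-‖ (u m)))) (u≤B m le))
        where
        open 𝔾-Solver
        minus : ∀ z → -1ᵍ *ᵍ z ≡ -ᵍ z
        minus = solve 1 (λ z → con -1ᵍ :* z := :- z) refl
      opposite : Approx Seq (phase τ c) (λ m → -1ᵍ *ᵍ phase τ d m)
      opposite = ≈-trans p (≈-trans (≈-reflexive λ m → eq₁ (γ m))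
        (≈-* (bounded-const -1ᵍ) (cis-bounded (phase-exponent-bounded τ d)) ≈-refl (≈-sym q)))
        where
        open 𝔾-Solver
        eq₂ : ∀ z w → z *ᵍ w ≡ -1ᵍ *ᵍ (z *ᵍ (-ᵍ w))
        eq₂ = solve 2 (λ z w → z :* w := con -1ᵍ :* (z :* (:- w))) refl
        eq₁ : ∀ z → z *ᵍ emb s ≡ -1ᵍ *ᵍ (z *ᵍ emb (ℤ.- s))
        eq₁ z = trans (eq₂ z (emb s)) (cong (λ w → -1ᵍ *ᵍ (z *ᵍ real w)) (sym (fromℤ-neg s)))
      open 𝔾-Solver
      move : ∀ z w → (-1ᵍ *ᵍ z) *ᵍ w ≡ -1ᵍ *ᵍ (z *ᵍ w)
      move = solve 2 (λ z w → (con -1ᵍ :* z) :* w := con -1ᵍ :* (z :* w)) refl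

  -- Consequences of a transfer for the vertices and the phases.

  module _ {v m : ℕ} where

    adjacency-represents : Represents (Johnson v m) (adjacency v m) (adjacencyℤ v m)
    adjacency-represents _ x y with does (adjacent? x y)
    ... | true  = refl
    ... | false = refl

  bit-injective : ∀ {b b′} → ⟦ b ⟧ᵇ ℤ.- ⟦ b′ ⟧ᵇ ≡ 0ℤ → b ≡ b′
  bit-injective {true}  {true}  _ = refl
  bit-injective {false} {false} _ = refl

  θ-μ : ∀ {m} j k → j ℕ.+ k ≡ m → θ j m m ≡ μ m k
  θ-μ j k refl = trans (θ-diagonal j k) (eq (ℤ.+ k) (ℤ.+ j))
    where
    eq : ∀ k j → k ℤ.* k ℤ.- j ≡ k ℤ.* k ℤ.+ k ℤ.- (j ℤ.+ k)
    eq = solve-∀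

  -- Multiplication by the conjugate of γ undoes the factor γ, after which discreteness of the
  -- integers applies.
  unit-* : ∀ {γ} → ∣ γ ∣² ≃ℝ 1ℝ → ∀ {i} → Null Seq (λ m → at γ m *ᵍ emb i) → i ≡ 0ℤ
  unit-* {γ} γ-unit {i} γi→0 = emb-null (null-≈ (≈-sym i≈) (null-* (bounded-conj (at-bounded γ)) γi→0))
    where
    bounded-conj : ∀ {u} → Bounded Seq u → Bounded Seq (conj ∘ u)
    bounded-conj {u} (mkBounded B 0<B (N , u≤B)) = mkBounded B 0<B (N , λ m le → ≤-trans (≤-reflexive (‖conj‖ (u m))) (u≤B m le))
      where
      ‖conj‖ : ∀ z → ‖ conj z ‖ ≡ ‖ z ‖
      ‖conj‖ (a ,ᵍ b) = cong (∣ a ∣ +_) (∣-p∣≡∣p∣ b)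
    norm≈1 : Approx Seq (λ m → real (seq ∣ γ ∣² m)) (λ _ → 1ᵍ)
    norm≈1 = mkApprox (mkNull λ ε 0<ε → let N , p = γ-unit ε 0<ε in N , λ m le →
      ≤-<-trans (≤-reflexive (‖real‖ (seq ∣ γ ∣² m - 1ℚ))) (p m le))
    i≈ : Approx Seq (λ m → conj (at γ m) *ᵍ (at γ m *ᵍ emb i)) (λ _ → emb i)
    i≈ = ≈-trans (≈-reflexive λ m → trans (sym (*ᵍ-assoc (conj (at γ m)) (at γ m) (emb i))) (cong (_*ᵍ emb i) (norm (at γ m))))
      (≈-trans (≈-* (bounded-const 1ᵍ) (bounded-const (emb i)) norm≈1 ≈-refl) (≈-reflexive λ _ → *ᵍ-identityˡ (emb i)))
      where
      open +-*-Solver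
      norm : ∀ z → conj z *ᵍ z ≡ real (Re z * Re z + Im z * Im z)
      norm (a ,ᵍ b) = cong₂ _,ᵍ_
        (solve 2 (λ a b → a :* a :- (:- b) :* b := a :* a :+ b :* b) refl a b)
        (solve 2 (λ a b → a :* b :+ (:- b) :* a := con 0ℚ) refl a b)

  module _ {v m r : ℕ} (1≤m : 1 ℕ.≤ m) (2m≤v : 2 ℕ.* m ℕ.≤ v) {a b : Vertex v m} (a≢b : a ≢ b) {τ : ℝ}
           (transfer : TransferAt (Johnson v m) (Real.matPow (Johnson v m) (adjacency v m) r) a b τ) where

    private
      J : FiniteSet
      J = Johnson v m

      n : ℕ
      n = v ℕ.∸ m

      m≤v : m ℕ.≤ v
      m≤v = ℕ.≤-trans (ℕ.m≤m+n m (m ℕ.+ 0)) 2m≤v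

      m<v : suc m ℕ.≤ v
      m<v = ℕ.≤-trans (ℕ.≤-trans (ℕ.+-monoˡ-≤ m 1≤m) (ℕ.≤-reflexive (cong (m ℕ.+_) (sym (ℕ.+-identityʳ m))))) 2m≤v

      E = proj₁ transfer
      γ = proj₁ (proj₂ (proj₂ transfer))

      pairing-phase : ∀ {j} (p : Pairs v j) →
        Approx Seq (λ k → phase τ (ℤ.- pow (θ j m n) r) k *ᵍ emb (pairing p (proj₁ a))) (λ k → at γ k *ᵍ emb (pairing p (proj₁ b)))
      pairing-phase {j} p = transfer-phase J (Real.matPow J (adjacency v m) r) (Linℤ.matPow J (adjacencyℤ v m) r)
        (represents-matPow J adjacency-represents r) τ
        (Sumsℤ.leftEigenvector-pow J (pairing-eigenvector p (ℕ.m+[n∸m]≡n m≤v)) r)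
        {E} {γ} {a} {b} (proj₁ (proj₂ transfer)) (proj₂ (proj₂ (proj₂ (proj₂ transfer))))

      blocks : ∀ i i′ → i ≢ i′ → lookup (proj₁ a) i ≡ lookup (proj₁ a) i′ → lookup (proj₁ b) i ≡ lookup (proj₁ b) i′
      blocks i i′ i≢i′ a-eq = bit-injective (trans (sym (single-eq (proj₁ b))) (unit-* {γ} (proj₁ (proj₂ (proj₂ (proj₂ transfer))))
        (null-≈ (≈-sym (pairing-phase single)) (null-≗ (λ k → trans (cong (λ i → phase τ (ℤ.- pow (θ 1 m n) r) k *ᵍ emb i) a-zero)
          (*ᵍ-zeroʳ (phase τ (ℤ.- pow (θ 1 m n) r) k))) null-0))))
        where
        single : Pairs v 1
        single = proj₁ (single-pair i i′ i≢i′)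
        single-eq : ∀ x → pairing single x ≡ ⟦ lookup x i ⟧ᵇ ℤ.- ⟦ lookup x i′ ⟧ᵇ
        single-eq = proj₂ (single-pair i i′ i≢i′)
        a-zero : pairing single (proj₁ a) ≡ 0ℤ
        a-zero = trans (single-eq (proj₁ a)) (trans (cong (λ c → ⟦ c ⟧ᵇ ℤ.- ⟦ lookup (proj₁ a) i′ ⟧ᵇ) a-eq) (ℤ.+-inverseʳ ⟦ lookup (proj₁ a) i′ ⟧ᵇ))

    transfer-complementary : Complementary a b
    transfer-complementary = complementary a b 1≤m m<v a≢b blocks

    transfer-size : m ℕ.+ m ≡ v
    transfer-size = complementary-size a b transfer-complementary

    private
      n≡m : n ≡ m
      n≡m = trans (cong (ℕ._∸ m) (sym transfer-size)) (ℕ.m+n∸n≡m m m)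

      level : ∀ j k → j ℕ.+ k ≡ m → Approx Seq (phase τ (ℤ.- pow (μ m k) r)) (λ i → at γ i *ᵍ emb (alternating j))
      level j k j+k≡m = ≈-trans (≈-reflexive λ i → trans (sym (*ᵍ-identityʳ (phase τ (ℤ.- pow (μ m k) r) i)))
          (cong₂ (λ t z → phase τ (ℤ.- pow t r) i *ᵍ emb z) (sym (trans (cong (θ j m) n≡m) (θ-μ j k j+k≡m))) (sym on-a)))
        (≈-trans (pairing-phase p) (≈-reflexive λ i → cong (λ z → at γ i *ᵍ emb z) on-b))
        where
        j≤m : j ℕ.≤ m
        j≤m = subst (j ℕ.≤_) j+k≡m (ℕ.m≤m+n j k)
        outsides-a : outsides (proj₁ a) ≡ m
        outsides-a = ℕ.+-cancelˡ-≡ m (outsides (proj₁ a)) m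
          (trans (cong (ℕ._+ outsides (proj₁ a)) (sym (proj₂ a))) (trans (∣∣+outsides (proj₁ a)) (sym transfer-size)))
        adapted = adapted-pairs j (proj₁ a) (subst (j ℕ.≤_) (sym (proj₂ a)) j≤m) (subst (j ℕ.≤_) (sym outsides-a) j≤m)
        p = proj₁ adapted
        on-a : pairing p (proj₁ a) ≡ 1ℤ
        on-a = proj₁ (proj₂ adapted)
        on-b : pairing p (proj₁ b) ≡ alternating j
        on-b = trans (cong (pairing p) transfer-complementary) (proj₂ (proj₂ adapted))

    transfer-minus : ∀ k → suc k ℕ.≤ m → Phase τ (pow (μ m k) r ℤ.- pow (μ m (suc k)) r) -1ℤ
    transfer-minus k k<m = subst (λ i → Phase τ i -1ℤ) (eq (pow (μ m (suc k)) r) (pow (μ m k) r))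
      (phase-ratio {τ} {c = ℤ.- pow (μ m (suc k)) r} {d = ℤ.- pow (μ m k) r} {s = alternating j} (at-bounded γ)
        (level j (suc k) j+k+1≡m) (level (suc j) k (trans (sym (ℕ.+-suc j k)) j+k+1≡m)))
      where
      j : ℕ
      j = m ℕ.∸ suc k
      j+k+1≡m : j ℕ.+ suc k ≡ m
      j+k+1≡m = ℕ.m∸n+n≡m k<m
      eq : ∀ x y → (ℤ.- x) ℤ.- (ℤ.- y) ≡ y ℤ.- x
      eq = solve-∀

    transfer-cases : 1 ℕ.≤ r → (m ≡ 1 × ∃[ s ] r ≡ suc (s ℕ.+ s)) ⊎ (m ≡ 3 × ∃[ s ] r ≡ s ℕ.+ s)
    transfer-cases = only-cases (λ c → Phase τ c -1ℤ) (λ {x} {y} {b} {c} → phase-clash {τ} {x} {y} {b} {c}) transfer-minus 1≤m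

  -- e^{-iτD} = −1 forces sin (τD) = 0.
  phase-minimal : ∀ {τ} D .{{_ : ℕ.NonZero D}} → 0ℝ <ℝ τ → Phase τ (ℤ.- ℤ.+ D) -1ℤ → (π /ℝ D) ≤ℝ τ
  phase-minimal {τ} D (δ , 0<δ , N , δ≤τ) p (ε , 0<ε , M , τ+ε≤π/D) = π-least x 0<x sin-x
      -- `_≤ℝ_` is a negation: a gap ε between τ and π / D becomes a gap Dε between τD and π,
      -- against the minimality of π.
      (fromℕ D * ε , 0<p*q 0<D 0<ε , M , λ m le → x+Dε≤π m (τ+ε≤π/D m le))
    where
    x : ℝ
    x = τ *ℝ fromℚ (fromℕ D)
    0<D : 0ℚ < fromℕ D
    0<D = <-≤-trans (positive⁻¹ 1ℚ) (fromℕ-mono-≤ {1} {D} (ℕ.>-nonZero⁻¹ D))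
    0<x : 0ℝ <ℝ x
    0<x = δ * fromℕ D , 0<p*q 0<δ 0<D , N , λ m le → ≤-trans (≤-reflexive (+-identityˡ (δ * fromℕ D)))
      (*-monoʳ-≤-nonNeg (fromℕ D) {{nonNegative (<⇒≤ 0<D)}} (≤-trans (≤-reflexive (sym (+-identityˡ δ))) (δ≤τ m le)))
    x+Dε≤π : ∀ m → seq τ m + ε ≤ seq π m * inv D → seq τ m * fromℕ D + fromℕ D * ε ≤ seq π m
    x+Dε≤π m le = begin
      seq τ m * fromℕ D + fromℕ D * ε  ≡⟨ solve 3 (λ t d e → t :* d :+ d :* e := (t :+ e) :* d) refl (seq τ m) (fromℕ D) ε ⟩
      (seq τ m + ε) * fromℕ D  ≤⟨ *-monoʳ-≤-nonNeg (fromℕ D) {{nonNegative (<⇒≤ 0<D)}} le ⟩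
      seq π m * inv D * fromℕ D  ≡⟨ *-assoc (seq π m) (inv D) (fromℕ D) ⟩
      seq π m * (inv D * fromℕ D)  ≡⟨ cong (seq π m *_) (inv-inverse D) ⟩
      seq π m * 1ℚ  ≡⟨ *-identityʳ (seq π m) ⟩
      seq π m  ∎
      where
      open ≤-Reasoning
      open +-*-Solver
    sin-x : IsSin x 0ℝ
    sin-x = ⇒isSin x 0ℝ (≈-trans (≈-reflexive λ m → cong real (Im-conj m)) (real-Im (≈-trans (≈-reflexive λ m → refl) conj-phase)))
      where
      conj-phase : Approx Seq (λ m → conj (phase τ (ℤ.- ℤ.+ D) m)) (λ _ → conj (emb -1ℤ))
      conj-phase = mkApprox (null-by (always Seq λ m → ≤-reflexive (‖conj-‖ (phase τ (ℤ.- ℤ.+ D) m) (emb -1ℤ))) (null p))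
        where
        open Filter
        ‖conj-‖ : ∀ z w → ‖ conj z -ᵍ conj w ‖ ≡ ‖ z -ᵍ w ‖
        ‖conj-‖ (a ,ᵍ b) (c ,ᵍ d) = cong (∣ a - c ∣ +_) (trans (cong ∣_∣ (sym (neg-distrib-+ b (- d)))) (∣-p∣≡∣p∣ (b - d)))
      Im-conj : ∀ m → Im (cis (seq x) m) ≡ Im (conj (phase τ (ℤ.- ℤ.+ D) m))
      Im-conj m = cong Im (trans (cong (λ q → expo m (imag q)) (sym (trans (cong (λ q → - (seq τ m * q)) (fromℤ-neg (ℤ.+ D)))
          (solve 2 (λ t d → :- (t :* :- d) := t :* d) refl (seq τ m) (fromℕ D)))))
        (expo-conj m (seq τ m * fromℤ (ℤ.- ℤ.+ D))))
        where open +-*-Solver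

  cisℂ-unit : ∀ x → ∣ cisℂ x ∣² ≃ℝ 1ℝ
  cisℂ-unit x ε 0<ε = let N , p = eventually-< (null (cis-conj (imag-bounded x))) ε 0<ε in N , λ m le →
    ≤-<-trans (≤-trans (≤-reflexive (cong (λ q → ∣ q - 1ℚ ∣) (norm (cis (seq x) m)))) (Re-le (cis (seq x) m *ᵍ conj (cis (seq x) m)))) (p m le)
    where
    open +-*-Solver
    norm : ∀ z → Re z * Re z + Im z * Im z ≡ Re (z *ᵍ conj z)
    norm (a ,ᵍ b) = solve 2 (λ a b → a :* a :+ b :* b := a :* a :- b :* (:- b)) refl a b
    Re-le : ∀ z → ∣ Re z - 1ℚ ∣ ≤ ‖ z -ᵍ 1ᵍ ‖
    Re-le (a ,ᵍ b) = ∣Re∣≤‖‖ (a - 1ℚ ,ᵍ b - 0ℚ)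

  module _ {v m} (S : AntipodalSpectrum v m) (r : ℕ) {τ : ℝ} {a b : Vertex v m} (a-b : Complementary a b) where

    open AntipodalSpectrum S

    -- Only phases relative to a reference exponent matter: γ = e^(-iτc) is factored out, and the
    -- uses take for c the r-th power of the valency.
    antipodal-transfer : ∀ c → (∀ j → Phase τ (c ℤ.- pow (eigenvalue j) r) (sign j)) →
                         TransferAt (Johnson v m) (Real.matPow (Johnson v m) (adjacency v m) r) a b τ
    antipodal-transfer c phases = spectral-transfer J (Real.matPow J (adjacency v m) r) (Linℤ.matPow J (adjacencyℤ v m) r)
        (represents-matPow J adjacency-represents r) τ (allFin size) C (λ j → pow (eigenvalue j) r) D {{D-nonZero}}
        (λ j y → Sumsℤ.rightEigenvector-pow J (λ x → eigenvectors j x y) r) resolution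
        γ sign disjointness {a} {b} (cisℂ-unit (τ *ℝ fromℚ (fromℤ (ℤ.- c)))) eigenphase antipodal
        (λ x → trans (disjoint x a) (cong (λ z → if does (≡-dec Bool._≟_ z (proj₁ x)) then 1ℤ else 0ℤ) (sym a-b)))
      where
      J : FiniteSet
      J = Johnson v m
      γ : ℂ
      γ = cisℂ (τ *ℝ fromℚ (fromℤ (ℤ.- c)))
      eigenphase : ∀ j → Approx Seq (phase τ (ℤ.- pow (eigenvalue j) r)) (λ k → at γ k *ᵍ emb (sign j))
      eigenphase j = ≈-trans (≈-reflexive λ k → cong (λ i → phase τ i k) (eq c (pow (eigenvalue j) r)))
        (≈-trans (phase-+≈ {τ} (ℤ.- c) (c ℤ.- pow (eigenvalue j) r))
          (≈-* (at-bounded γ) (bounded-const (emb (sign j)))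
            (≈-reflexive λ k → sym (at-cisℂ (τ *ℝ fromℚ (fromℤ (ℤ.- c))) k)) (phases j)))
        where
        eq : ∀ c d → ℤ.- d ≡ ℤ.- c ℤ.+ (c ℤ.- d)
        eq = solve-∀

  π/D-phase : ∀ D .{{_ : ℕ.NonZero D}} → Phase (π /ℝ D) (ℤ.+ D) -1ℤ
  π/D-phase D = ≈-trans (≈-reflexive λ m → cong (λ q → expo m (imag q))
    (trans (*-assoc (seq π m) (inv D) (fromℕ D)) (trans (cong (seq π m *_) (inv-inverse D)) (*-identityʳ (seq π m))))) cis-π

  0<π/D : ∀ D .{{_ : ℕ.NonZero D}} → 0ℝ <ℝ (π /ℝ D)
  0<π/D D = let δ , 0<δ , N , δ≤π = 0<π in δ * inv D , 0<p*q 0<δ (0<inv D) , N , λ m le →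
    ≤-trans (≤-reflexive (+-identityˡ (δ * inv D)))
      (*-monoʳ-≤-nonNeg (inv D) {{nonNegative (0≤inv D)}} (≤-trans (≤-reflexive (sym (+-identityˡ δ))) (δ≤π m le)))

  -- The two exceptional graphs and their minimum transfer times.

  pow-1 : ∀ n → pow 1ℤ n ≡ 1ℤ
  pow-1 zero    = refl
  pow-1 (suc n) = trans (ℤ.*-identityˡ (pow 1ℤ n)) (pow-1 n)

  pow-neg-even : ∀ x s → pow (ℤ.- x) (s ℕ.+ s) ≡ pow x (s ℕ.+ s)
  pow-neg-even x s = trans (pow-double (ℤ.- x) s) (trans (cong (λ y → pow y s) (eq x)) (sym (pow-double x s)))
    where
    eq : ∀ x → ℤ.- x ℤ.* ℤ.- x ≡ x ℤ.* x
    eq = solve-∀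

  pow-neg1-odd : ∀ s → pow -1ℤ (suc (s ℕ.+ s)) ≡ -1ℤ
  pow-neg1-odd s = cong (-1ℤ ℤ.*_) (trans (pow-neg-even 1ℤ s) (pow-1 (s ℕ.+ s)))

  pow-fromℕ : ∀ k n → pow (ℤ.+ k) n ≡ ℤ.+ (k ℕ.^ n)
  pow-fromℕ k zero    = refl
  pow-fromℕ k (suc n) = trans (cong (ℤ.+ k ℤ.*_) (pow-fromℕ k n)) (sym (ℤ.pos-* k (k ℕ.^ n)))

  ∣⇒even : ∀ {r} → 2 ∣ r → ∃[ s ] r ≡ s ℕ.+ s
  ∣⇒even (divides q eq) = q , trans eq (trans (ℕ.*-comm q 2) (cong (q ℕ.+_) (ℕ.+-identityʳ q)))

  even⇒∣ : ∀ {r s} → r ≡ s ℕ.+ s → 2 ∣ r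
  even⇒∣ {r} {s} eq = divides s (trans eq (trans (cong (s ℕ.+_) (sym (ℕ.+-identityʳ s))) (ℕ.*-comm 2 s)))

  ∤⇒odd : ∀ {r} → ¬ (2 ∣ r) → ∃[ s ] r ≡ suc (s ℕ.+ s)
  ∤⇒odd {r} 2∤r with parity r
  ... | s , inj₁ eq = ⊥-elim (2∤r (even⇒∣ {r} {s} eq))
  ... | s , inj₂ eq = s , eq

  odd⇒∤ : ∀ {r s} → r ≡ suc (s ℕ.+ s) → ¬ (2 ∣ r)
  odd⇒∤ {r} {s} eq 2∣r = let q , eq′ = ∣⇒even 2∣r in even≢odd q s (trans (sym eq′) eq)
    where
    even≢odd : ∀ q s → q ℕ.+ q ≢ suc (s ℕ.+ s)
    even≢odd (suc q) zero    eq with trans (sym (ℕ.+-suc q q)) (ℕ.suc-injective eq)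
    ... | ()
    even≢odd (suc q) (suc s) eq = even≢odd q s (ℕ.suc-injective (trans (sym (ℕ.+-suc q q))
      (trans (ℕ.suc-injective eq) (cong suc (ℕ.+-suc s s)))))

  complementary₂ : ∀ (a b : Vertex 2 1) → a ≢ b → Complementary a b
  complementary₂ (true ∷ false ∷ [] , h) (true ∷ false ∷ [] , h′) a≢b = ⊥-elim (a≢b (vertex-≡ refl))
  complementary₂ (true ∷ false ∷ [] , h) (false ∷ true ∷ [] , h′) a≢b = refl
  complementary₂ (false ∷ true ∷ [] , h) (true ∷ false ∷ [] , h′) a≢b = refl
  complementary₂ (false ∷ true ∷ [] , h) (false ∷ true ∷ [] , h′) a≢b = ⊥-elim (a≢b (vertex-≡ refl))

  Power : ∀ v m → ℕ → Real.Matrix (Johnson v m)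
  Power v m r = Real.matPow (Johnson v m) (adjacency v m) r

  phases₂ : ∀ {τ} s → Phase τ (ℤ.+ 2) -1ℤ → ∀ j → Phase τ (1ℤ ℤ.- pow (eigenvalue₂ j) (suc (s ℕ.+ s))) (eigenvalue₂ j)
  phases₂ {τ} s p 0F = subst (λ i → Phase τ (1ℤ ℤ.- i) 1ℤ) (sym (pow-1 (suc (s ℕ.+ s)))) (phase-0 {τ})
  phases₂ {τ} s p 1F = subst (λ i → Phase τ (1ℤ ℤ.- i) -1ℤ) (sym (pow-neg1-odd s)) p

  -- With r = 2s and P = 3ʳ, all exponents are multiples of c = P - 1: 9ʳ - 3ʳ = cP has the odd
  -- cofactor P, and 9ʳ - 1 = c(P + 1) has the even cofactor P + 1. Hence the single condition at c
  -- fixes all four signs.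
  phases₆ : ∀ {τ} s c → c ≡ pow (ℤ.+ 3) (s ℕ.+ s) ℤ.- 1ℤ → Phase τ c -1ℤ →
            ∀ j → Phase τ (pow (ℤ.+ 9) (s ℕ.+ s) ℤ.- pow (eigenvalue₆ j) (s ℕ.+ s)) (sign₆ j)
  phases₆ {τ} s c c≡ p = cases
    where
    P : ℤ
    P = pow (ℤ.+ 3) (s ℕ.+ s)
    odd-P : Odd P
    odd-P = odd-pow (1ℤ , refl) (s ℕ.+ s)
    pow-9 : P ℤ.* P ≡ pow (ℤ.+ 9) (s ℕ.+ s)
    pow-9 = sym (pow-* (ℤ.+ 3) (ℤ.+ 3) (s ℕ.+ s))
    minus : c ℤ.* P ≡ pow (ℤ.+ 9) (s ℕ.+ s) ℤ.- P
    minus = trans (cong (ℤ._* P) c≡) (trans (eq P) (cong (ℤ._- P) pow-9))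
      where
      eq : ∀ x → (x ℤ.- 1ℤ) ℤ.* x ≡ x ℤ.* x ℤ.- x
      eq = solve-∀
    plus : c ℤ.* (2ℤ ℤ.* (proj₁ odd-P ℤ.+ 1ℤ)) ≡ pow (ℤ.+ 9) (s ℕ.+ s) ℤ.- 1ℤ
    plus = trans (cong₂ ℤ._*_ c≡ (trans (eq₁ (proj₁ odd-P)) (cong (ℤ._+ 1ℤ) (sym (proj₂ odd-P)))))
        (trans (eq₂ P) (cong (ℤ._- 1ℤ) pow-9))
      where
      eq₁ : ∀ y → 2ℤ ℤ.* (y ℤ.+ 1ℤ) ≡ (2ℤ ℤ.* y ℤ.+ 1ℤ) ℤ.+ 1ℤ
      eq₁ = solve-∀
      eq₂ : ∀ x → (x ℤ.- 1ℤ) ℤ.* (x ℤ.+ 1ℤ) ≡ x ℤ.* x ℤ.- 1ℤ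
      eq₂ = solve-∀
    cases : ∀ j → Phase τ (pow (ℤ.+ 9) (s ℕ.+ s) ℤ.- pow (eigenvalue₆ j) (s ℕ.+ s)) (sign₆ j)
    cases 0F = subst (λ i → Phase τ i 1ℤ) (sym (ℤ.+-inverseʳ (pow (ℤ.+ 9) (s ℕ.+ s)))) (phase-0 {τ})
    cases 1F = subst (λ i → Phase τ i -1ℤ) minus (phase-odd {τ} {c} odd-P p)
    cases 2F = subst (λ i → Phase τ i 1ℤ)
      (trans plus (cong (λ i → pow (ℤ.+ 9) (s ℕ.+ s) ℤ.- i) (sym (trans (pow-neg-even 1ℤ s) (pow-1 (s ℕ.+ s))))))
      (phase-even {τ} {c} (proj₁ odd-P ℤ.+ 1ℤ) p)
    cases 3F = subst (λ i → Phase τ i -1ℤ)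
      (trans minus (cong (λ i → pow (ℤ.+ 9) (s ℕ.+ s) ℤ.- i) (sym (pow-neg-even (ℤ.+ 3) s))))
      (phase-odd {τ} {c} odd-P p)

  module _ {v m r : ℕ} (S : AntipodalSpectrum v m) (1≤m : 1 ℕ.≤ m) (2m≤v : 2 ℕ.* m ℕ.≤ v) {a b : Vertex v m} (a≢b : a ≢ b)
           (a-b : Complementary a b) (D : ℕ) .{{_ : ℕ.NonZero D}} where

    open AntipodalSpectrum S using (eigenvalue; sign)

    -- Sufficiency and minimality meet in the same integer D: phase -1 at D gives all the signs
    -- required, and conversely one gap of the powers equals -D, so every transfer time must give it
    -- phase -1.
    minimal-transfer : ∀ c →
      (∀ {τ} → Phase τ (ℤ.+ D) -1ℤ → ∀ j → Phase τ (c ℤ.- pow (eigenvalue j) r) (sign j)) →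
      ∀ k → suc k ℕ.≤ m → pow (μ m k) r ℤ.- pow (μ m (suc k)) r ≡ ℤ.- ℤ.+ D →
      IsMinTransferTime (Johnson v m) (Power v m r) a b (π /ℝ D)
    minimal-transfer c phases k k<m step =
      (0<π/D D , antipodal-transfer S r {π /ℝ D} {a} {b} a-b c (phases {π /ℝ D} (π/D-phase D))) ,
      λ σ (0<σ , transfer) → phase-minimal {σ} D 0<σ
        (subst (λ i → Phase σ i -1ℤ) step (transfer-minus {v} {m} {r} 1≤m 2m≤v {a} {b} a≢b {σ} transfer k k<m))

  caseI-minimal : ∀ {r s} (a b : Vertex 2 1) → a ≢ b → r ≡ suc (s ℕ.+ s) →
                  IsMinTransferTime (Johnson 2 1) (Power 2 1 r) a b (π /ℝ 2)
  caseI-minimal {s = s} a b a≢b refl =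
    minimal-transfer {2} {1} {suc (s ℕ.+ s)} spectrum₂ (ℕ.s≤s ℕ.z≤n) ℕ.≤-refl {a} {b} a≢b (complementary₂ a b a≢b) 2 1ℤ
    -- For k = 0 the eigenvalues are -1 and 1, and an odd exponent leaves the gap -2.
    (λ {τ} → phases₂ {τ} s) 0 ℕ.≤-refl (cong₂ ℤ._-_ (pow-neg1-odd s) (pow-1 (suc (s ℕ.+ s))))

  caseII-minimal : ∀ {r s} .{{_ : ℕ.NonZero r}} (a b : Vertex 6 3) → a ≢ b → r ≡ s ℕ.+ s → Complementary a b →
                   IsMinTransferTime (Johnson 6 3) (Power 6 3 r) a b (π /ℝ (3 ℕ.^ r ℕ.∸ 1))
  caseII-minimal {r} {s} a b a≢b refl a-b = minimal-transfer {6} {3} {r} spectrum₆ (ℕ.s≤s ℕ.z≤n) ℕ.≤-refl {a} {b} a≢b a-b (3 ℕ.^ r ℕ.∸ 1)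
      -- The index k = 1 is chosen because μ₁ = -1 and μ₂ = 3, so the gap for even r is 1 - 3ʳ = -D.
      (pow (ℤ.+ 9) r) (λ {τ} → phases₆ {τ} s (ℤ.+ (3 ℕ.^ r ℕ.∸ 1)) +D≡) 1 (ℕ.s≤s (ℕ.s≤s ℕ.z≤n))
      (trans (cong (ℤ._- pow (ℤ.+ 3) r) (trans (pow-neg-even 1ℤ s) (pow-1 r))) (trans (eq (pow (ℤ.+ 3) r)) (cong (λ i → ℤ.- i) (sym +D≡))))
    where
    +D≡ : ℤ.+ (3 ℕ.^ r ℕ.∸ 1) ≡ pow (ℤ.+ 3) r ℤ.- 1ℤ
    +D≡ = trans (sym (ℤ.⊖-≥ (ℕ.m^n>0 3 r))) (trans (sym (ℤ.m-n≡m⊖n (3 ℕ.^ r) 1)) (cong (ℤ._- 1ℤ) (sym (pow-fromℕ 3 r))))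
    eq : ∀ x → 1ℤ ℤ.- x ≡ ℤ.- (x ℤ.- 1ℤ)
    eq = solve-∀

  cases-PST : ∀ {v m r} {a b : Vertex v m} → Complementary a b → m ℕ.+ m ≡ v →
              (m ≡ 1 × ∃[ s ] r ≡ suc (s ℕ.+ s)) ⊎ (m ≡ 3 × ∃[ s ] r ≡ s ℕ.+ s) → CaseI v m r ⊎ CaseII v m r a b
  cases-PST a-b size (inj₁ (refl , s , eq)) = inj₁ (sym size , refl , odd⇒∤ {s = s} eq)
  cases-PST a-b size (inj₂ (refl , s , eq)) = inj₂ (sym size , refl , even⇒∣ {s = s} eq , a-b)

  module _ {v m r : ℕ} (1≤m : 1 ℕ.≤ m) (2m≤v : 2 ℕ.* m ℕ.≤ v) .{{_ : ℕ.NonZero r}} {a b : Vertex v m} (a≢b : a ≢ b) where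

    PST⇒cases : PST (Johnson v m) (Power v m r) a b → CaseI v m r ⊎ CaseII v m r a b
    PST⇒cases (τ , _ , transfer) = cases-PST {v} {m} {r} {a} {b}
      (transfer-complementary {v} {m} {r} 1≤m 2m≤v {a} {b} a≢b {τ} transfer)
      (transfer-size {v} {m} {r} 1≤m 2m≤v {a} {b} a≢b {τ} transfer)
      (transfer-cases {v} {m} {r} 1≤m 2m≤v {a} {b} a≢b {τ} transfer (ℕ.>-nonZero⁻¹ r))

  caseI-min : ∀ {v m r} (a b : Vertex v m) → a ≢ b → CaseI v m r →
              IsMinTransferTime (Johnson v m) (Power v m r) a b (π /ℝ 2)
  caseI-min {r = r} a b a≢b (refl , refl , 2∤r) = caseI-minimal {r} {proj₁ (∤⇒odd 2∤r)} a b a≢b (proj₂ (∤⇒odd 2∤r))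

  caseII-min : ∀ {v m r} .{{_ : ℕ.NonZero r}} (a b : Vertex v m) → a ≢ b → CaseII v m r a b →
               IsMinTransferTime (Johnson v m) (Power v m r) a b (π /ℝ (3 ℕ.^ r ℕ.∸ 1))
  caseII-min {r = r} a b a≢b (refl , refl , 2∣r , a-b) =
    caseII-minimal {r} {proj₁ (∣⇒even 2∣r)} a b a≢b (proj₂ (∣⇒even 2∣r)) a-b

  cases⇒PST : ∀ {v m r} .{{_ : ℕ.NonZero r}} (a b : Vertex v m) → a ≢ b → CaseI v m r ⊎ CaseII v m r a b →
              PST (Johnson v m) (Power v m r) a b
  cases⇒PST {r = r} a b a≢b (inj₁ c) = π /ℝ 2 , proj₁ (caseI-min {r = r} a b a≢b c)
  cases⇒PST {r = r} a b a≢b (inj₂ c) = π /ℝ (3 ℕ.^ r ℕ.∸ 1) , proj₁ (caseII-min {r = r} a b a≢b c)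

open import Data.Nat.Base using (NonZero; _≤_; _*_; _^_; _∸_)
open Analysis using (π; π-isPi)
open StateTransfer using (PST⇒cases; cases⇒PST; caseI-min; caseII-min)

theorem5p15 :
    Σ[ π ∈ ℝ ] IsPi π ×
      (∀ (v m r : ℕ) → 1 ≤ m → 2 * m ≤ v → .{{_ : NonZero r}} →
        (a b : Vertex v m) → a ≢ b →
        let J = Johnson v m
            Aʳ = Real.matPow J (adjacency v m) r
        in (PST J Aʳ a b ⇔ (CaseI v m r ⊎ CaseII v m r a b))
         × (CaseI v m r → IsMinTransferTime J Aʳ a b (π /ℝ 2))
         × (CaseII v m r a b → IsMinTransferTime J Aʳ a b (π /ℝ (3 ^ r ∸ 1))))
theorem5p15 = π , π-isPi , λ v m r 1≤m 2m≤v a b a≢b →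
  mk⇔ (PST⇒cases {v} {m} {r} 1≤m 2m≤v {a} {b} a≢b) (cases⇒PST {v} {m} {r} a b a≢b)
  , caseI-min {v} {m} {r} a b a≢b , caseII-min {v} {m} {r} a b a≢b
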